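{- Let $G$ be an undirected graph with $n$ vertices and integer edge weights in the range $[1,M]$, and let $s$ be a source vertex. Suppose we are given access to a shortest path tree $T_s$ of $G$ rooted at $s$ and to all values $d(s,t,e)$ for vertices $t$ of $G$ and edges $e$ of $T_s$. Then there is a deterministic, combinatorial algorithm that in time $O(n^2)$ builds a Single-Source Distance Sensitivity Oracle of size $O(M^{1/2}n^{3/2})$ with $\widetilde{O}(1)$ query time. The same statement holds for vertex failures if instead we are given access to the values $d(s,t,v)$ for all vertices $t$ and $v$ of $G$.
   Context: $d(s,t,e)$ denotes the length of a shortest $s$-$t$ path in $G-e$ (the graph with edge $e$ removed), and $d(s,t,v)$ the length of a shortest $s$-$t$ path in $G-v$ (vertex $v$ removed); these are $\infty$ if no such path exists. A Single-Source Distance Sensitivity Oracle (Single-Source DSO) with source $s$ is a data structure that answers queries $(t,e)$ (for vertex failures: $(t,v)$) by returning $d(s,t,e)$ (respectively $d(s,t,v)$). Space is measured in machine words of $O(\log n)$ bits; $M=\mathrm{poly}(n)$. $\widetilde{O}(f)$ means $O(f\cdot\mathrm{polylog}(n))$. The algorithm does not need access to $G$ itself. -}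

module Defs where

open import Data.Bool using (if_then_else_)
open import Data.Fin using (Fin; toℕ; fromℕ<; remQuot)
import Data.Fin.Properties as Fin
open import Data.Fin.Subset using (Subset; _∈_; _-_)
open import Data.Fin.Subset.Properties using (x∈p∧x≢y⇒x∈p-y)
open import Data.List using (List; []; _∷_; applyUpTo)
open import Data.List.Relation.Unary.Unique.Propositional using (Unique)
open import Data.Maybe using (Maybe; just; nothing; maybe′)
open import Data.Nat using (ℕ; zero; suc; _+_; _*_; _∸_; _^_; _/_; _%_; _≤_; _<_; _<?_; _≡ᵇ_; _<ᵇ_)
open import Data.Nat.Logarithm using (⌊log₂_⌋)
open import Data.Product using (Σ; ∃-syntax; _×_; _,_; proj₂; uncurry)
open import Data.Sum using (_⊎_; inj₁; inj₂; swap)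
open import Relation.Binary.PropositionalEquality using (_≡_; _≢_; refl)
open import Relation.Nullary using (¬_; Dec; yes; no; contradiction)
open import Relation.Nullary.Decidable using (_×-dec_; _⊎-dec_)

-- The vertex set is a subset of Fin n, so that deleting a vertex really
-- removes it: a deleted vertex is not even joined to itself by the
-- empty path.
record Graph (n : ℕ) : Set where
  field
    vertices   : Subset n
    weight     : Fin n → Fin n → Maybe ℕ      -- nothing: not an edge
    undirected : ∀ u v → weight u v ≡ weight v u
    loopless   : ∀ u → weight u u ≡ nothing
    incident   : ∀ {u v w} → weight u v ≡ just w → u ∈ vertices

open Graph public

WeightsInRange : ∀ {n} → ℕ → Graph n → Set
WeightsInRange M G = ∀ {u v w} → weight G u v ≡ just w → 1 ≤ w × w ≤ M

data Walk {n} (G : Graph n) : Fin n → Fin n → ℕ → Set where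
  here : ∀ {u} → u ∈ vertices G → Walk G u u 0
  step : ∀ {u v t w ℓ} → weight G u v ≡ just w → Walk G v t ℓ → Walk G u t (w + ℓ)

visited : ∀ {n} {G : Graph n} {s t ℓ} → Walk G s t ℓ → List (Fin n)
visited (here {u} _)   = u ∷ []
visited (step {u} _ p) = u ∷ visited p

Path : ∀ {n} → Graph n → Fin n → Fin n → ℕ → Set
Path G s t ℓ = Σ (Walk G s t ℓ) λ p → Unique (visited p)

-- d is the distance from s to t in G, where nothing stands for ∞.
IsDist : ∀ {n} → Graph n → Fin n → Fin n → Maybe ℕ → Set
IsDist G s t (just d) = Path G s t d × (∀ {ℓ} → Path G s t ℓ → d ≤ ℓ)
IsDist G s t nothing  = ∀ {ℓ} → ¬ Path G s t ℓ

SameEdge : ∀ {n} → Fin n × Fin n → Fin n → Fin n → Set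
SameEdge (a , b) u v = (u ≡ a × v ≡ b) ⊎ (u ≡ b × v ≡ a)

sameEdge? : ∀ {n} (e : Fin n × Fin n) u v → Dec (SameEdge e u v)
sameEdge? (a , b) u v =
  ((u Fin.≟ a) ×-dec (v Fin.≟ b)) ⊎-dec ((u Fin.≟ b) ×-dec (v Fin.≟ a))

unless : ∀ {P : Set} → Dec P → Maybe ℕ → Maybe ℕ
unless (yes _) _ = nothing
unless (no  _) w = w

unless-cong : ∀ {P Q : Set} (p : Dec P) (q : Dec Q) {x y} →
              (P → Q) → (Q → P) → x ≡ y → unless p x ≡ unless q y
unless-cong (yes _) (yes _) f g eq = refl
unless-cong (yes p) (no ¬q) f g eq = contradiction (f p) ¬q
unless-cong (no ¬p) (yes q) f g eq = contradiction (g q) ¬p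
unless-cong (no _)  (no _)  f g eq = eq

unless-nothing : ∀ {P : Set} (p : Dec P) {x} → x ≡ nothing → unless p x ≡ nothing
unless-nothing (yes _) eq = refl
unless-nothing (no _)  eq = eq

unless-just : ∀ {P : Set} (p : Dec P) {x w} → unless p x ≡ just w → ¬ P × x ≡ just w
unless-just (no ¬p) eq = ¬p , eq

sameEdge-sym : ∀ {n} (e : Fin n × Fin n) u v → SameEdge e u v → SameEdge e v u
sameEdge-sym e u v (inj₁ (p , q)) = inj₂ (q , p)
sameEdge-sym e u v (inj₂ (p , q)) = inj₁ (q , p)

touches? : ∀ {n} (x u v : Fin n) → Dec (u ≡ x ⊎ v ≡ x)
touches? x u v = (u Fin.≟ x) ⊎-dec (v Fin.≟ x)

infixl 6 _−edge_ _−vertex_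

_−edge_ : ∀ {n} → Graph n → Fin n × Fin n → Graph n
G −edge e = record
  { vertices   = vertices G
  ; weight     = λ u v → unless (sameEdge? e u v) (weight G u v)
  ; undirected = λ u v → unless-cong (sameEdge? e u v) (sameEdge? e v u)
                   (sameEdge-sym e u v) (sameEdge-sym e v u) (undirected G u v)
  ; loopless   = λ u → unless-nothing (sameEdge? e u u) (loopless G u)
  ; incident   = λ {u} {v} eq → incident G (proj₂ (unless-just (sameEdge? e u v) eq))
  }

_−vertex_ : ∀ {n} → Graph n → Fin n → Graph n
G −vertex x = record
  { vertices   = vertices G - x
  ; weight     = λ u v → unless (touches? x u v) (weight G u v)
  ; undirected = λ u v → unless-cong (touches? x u v) (touches? x v u)
                   swap swap (undirected G u v)
  ; loopless   = λ u → unless-nothing (touches? x u u) (loopless G u)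
  ; incident   = λ {u} {v} eq →
      let (untouched , eq′) = unless-just (touches? x u v) eq
      in x∈p∧x≢y⇒x∈p-y (incident G eq′) (λ u≡x → untouched (inj₁ u≡x))
  }

-- T v ≡ just (p , w): the tree edge above v leads to its parent p and has
-- weight w. The root and the vertices outside the tree have no parent.
Parents : ℕ → Set
Parents n = Fin n → Maybe (Fin n × ℕ)

data Branch {n} (T : Parents n) (s : Fin n) : Fin n → ℕ → Set where
  root : Branch T s s 0
  down : ∀ {v p w ℓ} → T v ≡ just (p , w) → Branch T s p ℓ → Branch T s v (ℓ + w)

-- If G is disconnected, the tree spans the component of s.
record IsShortestPathTree {n} (G : Graph n) (s : Fin n) (T : Parents n) : Set where
  field
    rootless : T s ≡ nothing
    subgraph : ∀ {v p w} → T v ≡ just (p , w) → weight G p v ≡ just w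
    rooted   : ∀ {v p w} → T v ≡ just (p , w) → ∃[ ℓ ] Branch T s v ℓ
    spanning : ∀ {v ℓ} → Path G s v ℓ → ∃[ ℓ′ ] Branch T s v ℓ′
    shortest : ∀ {v ℓ} → Branch T s v ℓ → IsDist G s v (just ℓ)

-- A word RAM: programs over finitely many scalar registers and arrays
-- (both named by numerals), with unit-cost word operations. A value that
-- does not fit in a word makes the program get stuck.

data Op : Set where
  add sub mul div mod less equal : Op

apply : Op → ℕ → ℕ → ℕ
apply add   x y       = x + y
apply sub   x y       = x ∸ y
apply mul   x y       = x * y
apply div   x zero    = 0
apply div   x (suc y) = x / suc y
apply mod   x zero    = 0
apply mod   x (suc y) = x % suc y
apply less  x y       = if x <ᵇ y then 1 else 0
apply equal x y       = if x ≡ᵇ y then 1 else 0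

data Expr : Set where
  lit : ℕ → Expr
  var : ℕ → Expr
  get : ℕ → Expr → Expr
  bin : Op → Expr → Expr → Expr

infixr 4 _⨾_

data Program : Set where
  skip  : Program
  set   : ℕ → Expr → Program
  put   : ℕ → Expr → Expr → Program     -- array, index, value
  _⨾_   : Program → Program → Program
  ifte  : Expr → Program → Program → Program
  while : Expr → Program → Program

record State : Set where
  constructor state
  field
    vars   : ℕ → ℕ
    arrays : ℕ → ℕ → ℕ

open State public

_[_↦_] : ∀ {A : Set} → (ℕ → A) → ℕ → A → ℕ → A
(f [ i ↦ a ]) j = if j ≡ᵇ i then a else f j

⟦_⟧ : Expr → State → ℕ
⟦ lit k ⟧      σ = k
⟦ var x ⟧      σ = vars σ x
⟦ get a i ⟧    σ = arrays σ a (⟦ i ⟧ σ)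
⟦ bin o e e′ ⟧ σ = apply o (⟦ e ⟧ σ) (⟦ e′ ⟧ σ)

cost : Expr → ℕ
cost (lit _)      = 1
cost (var _)      = 1
cost (get _ i)    = suc (cost i)
cost (bin _ e e′) = suc (cost e + cost e′)

-- All values arising in the evaluation, addresses included, are below W.
Fits : ℕ → State → Expr → Set
Fits W σ (lit k)      = k < W
Fits W σ (var x)      = vars σ x < W
Fits W σ (get a i)    = Fits W σ i × ⟦ get a i ⟧ σ < W
Fits W σ (bin o e e′) = Fits W σ e × Fits W σ e′ × ⟦ bin o e e′ ⟧ σ < W

-- Run W P σ k σ′: from state σ, program P halts in state σ′ after time k.
data Run (W : ℕ) : Program → State → ℕ → State → Set where
  skip : ∀ {σ} → Run W skip σ 1 σ
  set  : ∀ {σ x e} → Fits W σ e →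
         Run W (set x e) σ (suc (cost e))
             (state (vars σ [ x ↦ ⟦ e ⟧ σ ]) (arrays σ))
  put  : ∀ {σ a i e} → Fits W σ i → Fits W σ e →
         Run W (put a i e) σ (suc (cost i + cost e))
             (state (vars σ) (arrays σ [ a ↦ arrays σ a [ ⟦ i ⟧ σ ↦ ⟦ e ⟧ σ ] ]))
  _⨾_  : ∀ {P Q σ σ′ σ″ k l} → Run W P σ k σ′ → Run W Q σ′ l σ″ →
         Run W (P ⨾ Q) σ (k + l) σ″
  then : ∀ {e P Q σ σ′ k} → Fits W σ e → ⟦ e ⟧ σ ≢ 0 → Run W P σ k σ′ →
         Run W (ifte e P Q) σ (suc (cost e + k)) σ′
  else : ∀ {e P Q σ σ′ k} → Fits W σ e → ⟦ e ⟧ σ ≡ 0 → Run W Q σ k σ′ →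
         Run W (ifte e P Q) σ (suc (cost e + k)) σ′
  loop : ∀ {e P σ σ′ σ″ k l} → Fits W σ e → ⟦ e ⟧ σ ≢ 0 →
         Run W P σ k σ′ → Run W (while e P) σ′ l σ″ →
         Run W (while e P) σ (suc (cost e + (k + l))) σ″
  done : ∀ {e P σ} → Fits W σ e → ⟦ e ⟧ σ ≡ 0 →
         Run W (while e P) σ (suc (cost e)) σ

-- Words of b * (1 + ⌊log₂ n⌋) bits, as an exclusive bound on their values.
words : ℕ → ℕ → ℕ
words b n = 2 ^ (b * suc ⌊log₂ n ⌋)

polylog : ℕ → ℕ → ℕ
polylog e n = suc ⌊log₂ n ⌋ ^ e

-- Cells and registers beyond the given data are 0.
contents : List ℕ → ℕ → ℕ
contents []       _       = 0
contents (x ∷ _)  zero    = x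
contents (_ ∷ xs) (suc i) = contents xs i

tabulated : ∀ {m} → (Fin m → ℕ) → ℕ → ℕ
tabulated {m} f i with i <? m
... | yes i<m = f (fromℕ< i<m)
... | no  _   = 0

codeDist : Maybe ℕ → ℕ
codeDist = maybe′ suc 0

-- Row-major: the entry for (t , x) is in cell n * t + x.
table : ∀ {n} → (Fin n → Fin n → ℕ) → ℕ → ℕ
table {n} f = tabulated (λ i → uncurry f (remQuot {n} n i))

buildInput : ∀ {n} → ℕ → Fin n → Parents n → (Fin n → Fin n → ℕ) → State
buildInput {n} M s T D = state (contents (n ∷ M ∷ toℕ s ∷ [])) arrs
  where
  arrs : ℕ → ℕ → ℕ
  arrs 0 = tabulated (λ v → maybe′ (λ (p , _) → suc (toℕ p)) 0 (T v))
  arrs 1 = tabulated (λ v → maybe′ proj₂ 0 (T v))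
  arrs 2 = table D
  arrs _ = λ _ → 0

-- The edge of T above v is named by v; cells naming no tree edge hold 0.
edgeTable : ∀ {n} → Parents n → (Fin n → Fin n → Maybe ℕ) → Fin n → Fin n → ℕ
edgeTable T D t v = maybe′ (λ _ → codeDist (D t v)) 0 (T v)

vertexTable : ∀ {n} → (Fin n → Fin n → Maybe ℕ) → Fin n → Fin n → ℕ
vertexTable D t v = codeDist (D t v)

-- On halting, register 0 holds the size of the oracle and array 3 its words.
oracle : State → List ℕ
oracle σ = applyUpTo (arrays σ 3) (vars σ 0)

-- A query sees only the oracle (array 0) and its arguments (registers).
queryInput : List ℕ → List ℕ → State
queryInput ora args = state (contents args) arrs
  where
  arrs : ℕ → ℕ → ℕ
  arrs 0 = contents ora
  arrs _ = λ _ → 0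

-- Within the given time, the query program returns (in register 0) a
-- distance satisfying P.
Returns : ℕ → Program → State → ℕ → (Maybe ℕ → Set) → Set
Returns W query σ time P =
  ∃[ k ] ∃[ σ′ ] Run W query σ k σ′ × k ≤ time ×
  ∃[ d ] P d × vars σ′ 0 ≡ codeDist d

AnswersEdges : ∀ {n} → ℕ → Program → ℕ → Graph n → Fin n → List ℕ → Set
AnswersEdges W query time G s ora =
  ∀ t u v {w} → weight G u v ≡ just w →
  Returns W query (queryInput ora (toℕ t ∷ toℕ u ∷ toℕ v ∷ [])) time
          (IsDist (G −edge (u , v)) s t)

AnswersVertices : ∀ {n} → ℕ → Program → ℕ → Graph n → Fin n → List ℕ → Set
AnswersVertices W query time G s ora =
  ∀ t v →
  Returns W query (queryInput ora (toℕ t ∷ toℕ v ∷ [])) time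
          (IsDist (G −vertex v) s t)

-- The program halts within the given time, leaving an oracle that
-- satisfies P.
Builds : ℕ → Program → State → ℕ → (List ℕ → Set) → Set
Builds W build σ time P =
  ∃[ k ] ∃[ σ′ ] Run W build σ k σ′ × k ≤ time × P (oracle σ′)

-- The pivots are the vertices whose depth has the rarest residue modulo L,
-- where L is about √n. There are O(√n) of them, and the nearest pivot x at or
-- above t is less than L levels away. The failures of t at or below x are
-- tabulated, and so are all distances of the pivots.
--
-- For a failure v above x, the replacement path of t either may be routed
-- through x, or it meets no tree ancestor of t between v and x. In the latter
-- case it survives all failures between v and x, so the answer is the minimum
-- of the distance through x and of the least such distance for a failure at or
-- above v, and t only records where this least distance drops.
--
-- If it drops k times, consider the detours that leave the tree path above
-- every other one of the first k/2 recorded failures. Their first k/4M vertices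
-- are all distinct: a common vertex of two detours would join the upper one to
-- the tree path below its failure and thus give a route through x that is too
-- short. Hence k² = O(Mn), and the n lists have total length O(√M n^{3/2}).

module Submission where

open import Defs
open import Data.Bool using (Bool; true; false; T; if_then_else_; _∧_; _∨_; not)
open import Data.Empty using (⊥-elim)
open import Data.Fin using (Fin; toℕ; fromℕ<) renaming (zero to fzero; suc to fsuc)
import Data.Fin as F
import Data.Fin.Properties as Fin
open import Data.Fin.Subset using (Subset; ⊤; _∈_; _-_; ∣_∣; ⁅_⁆)
open import Data.Fin.Subset.Properties using (∈⊤; x∈p∧x≢y⇒x∈p-y; x∈p⇒∣p-x∣<∣p∣; p─q─q≡p─q)
open import Data.List using (List; []; _∷_; length; lookup; applyUpTo)
open import Data.List.Properties using (length-applyUpTo)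
open import Data.List.Membership.Propositional using () renaming (_∈_ to _∈ᴸ_)
open import Data.List.Membership.Propositional.Properties using (∈-lookup)
open import Data.List.Relation.Unary.All as All using (All; []; _∷_)
open import Data.List.Relation.Unary.Any using (here; there)
open import Data.List.Relation.Unary.AllPairs using ([]; _∷_)
open import Data.List.Relation.Unary.Unique.Propositional using (Unique)
open import Data.Maybe using (Maybe; just; nothing; maybe′)
open import Data.Maybe.Properties using (just-injective)
open import Data.Nat
open import Data.Nat.Properties
open import Data.Nat.DivMod using (m/n*n≤m; m≡m%n+[m/n]*n; m%n<n; m/n≤m; m%n≤m; m/n<m; m/n≡1+[m∸n]/n; [m+kn]%n≡m%n; m<n⇒m%n≡m)
open import Data.Nat.Logarithm using (⌊log₂_⌋; ⌊log₂⌋-mono-≤; ⌊log₂⌊n/2⌋⌋≡⌊log₂n⌋∸1; ⌊log₂[2^n]⌋≡n)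
open import Data.Nat.Tactic.RingSolver using (solve-∀)
open import Data.Product using (∃-syntax; Σ-syntax; _×_; _,_; proj₁; proj₂)
open import Data.Sum using (_⊎_; inj₁; inj₂)
import Data.Unit as Unit
open import Data.Unit using (tt)
open import Function using (_∘_; case_of_)
open import Relation.Binary.PropositionalEquality
open import Relation.Nullary using (¬_; Dec; yes; no; contradiction)
open import Relation.Binary.Definitions using (tri<; tri≈; tri>)

-- Edge and vertex failures are handled together by naming each failure after a vertex, a tree edge
-- after its lower endpoint. The two cases then differ only in what remains at the named vertex, so
-- most arguments keep strictly clear of it.
--
-- Integrality drives the count: each drop is at least 1, so the replacement distance for the `c`-th
-- of the failures 0 to `m` exceeds the tree distance by at least `m - c`, and its detour is long.
-- Every other failure is skipped because a detour is only known to leave the tree path at or below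
-- the preceding recorded failures; with a gap it leaves strictly below the failure of the upper
-- detour, so the joined walk avoids that failure. The fraction 1/4 splits the excess between two
-- initial pieces of detours and a doubled index.
--
-- On the machine, every pass is a double loop that writes the value of one branch-free expression,
-- so that running time and word size are settled once. All lists are padded to the longest, which
-- is harmless because each single list is short, and the tables are interleaved in records of
-- sixteen words.

variable
  n : ℕ
  G : Graph n
  s t u v x z : Fin n
  ℓ ℓ′ : ℕ

-- Walks

suffix : (p : Walk G z t ℓ) → Unique (visited p) → u ∈ᴸ visited p →
         ∃[ ℓ′ ] ℓ′ ≤ ℓ × Path G u t ℓ′
suffix (here z∈G)   un       (here refl) = 0 , z≤n , here z∈G , un
suffix p@(step _ _) un       (here refl) = _ , ≤-refl , p , un
suffix (step e q)   (_ ∷ un) (there i)   =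
  let (ℓ′ , ℓ′≤ , p) = suffix q un i in ℓ′ , m≤n⇒m≤o+n _ ℓ′≤ , p

walk⇒path : Walk G u t ℓ → ∃[ ℓ′ ] ℓ′ ≤ ℓ × Path G u t ℓ′
walk⇒path (here u∈G) = 0 , z≤n , here u∈G , [] ∷ []
walk⇒path {u = u} (step {w = w} e q) with walk⇒path q
... | ℓ′ , ℓ′≤ , p , un with Data.List.Membership.DecPropositional._∈?_ Fin._≟_ u (visited p)
  where import Data.List.Membership.DecPropositional
... | yes u∈p = let (ℓ″ , ℓ″≤ , r) = suffix p un u∈p
                in ℓ″ , ≤-trans ℓ″≤ (m≤n⇒m≤o+n w ℓ′≤) , r
... | no  u∉p = w + ℓ′ , +-monoʳ-≤ w ℓ′≤ , step e p ,
                All.tabulate (λ {y} y∈p u≡y → u∉p (subst (_∈ᴸ visited p) (sym u≡y) y∈p)) ∷ un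

start∈ : Walk G u t ℓ → u ∈ vertices G
start∈ (here u∈G)         = u∈G
start∈ {G = G} (step e _) = incident G e

_++ʷ_ : Walk G u v ℓ → Walk G v t ℓ′ → Walk G u t (ℓ + ℓ′)
here _ ++ʷ q = q
step {w = w} e p ++ʷ q = subst (Walk _ _ _) (sym (+-assoc w _ _)) (step e (p ++ʷ q))

reverse : Walk G u t ℓ → Walk G t u ℓ
reverse (here u∈G) = here u∈G
reverse {G = G} {u = u} (step {v = v} {w = w} {ℓ = ℓ} e p) =
  subst (Walk G _ _) (trans (cong (ℓ +_) (+-identityʳ w)) (+-comm ℓ w))
    (reverse p ++ʷ step (trans (undirected G v u) e) (here (incident G e)))

splitAt : (p : Walk G u t ℓ) → z ∈ᴸ visited p →
          ∃[ ℓ₁ ] ∃[ ℓ₂ ] Walk G u z ℓ₁ × Walk G z t ℓ₂ × ℓ₁ + ℓ₂ ≡ ℓ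
splitAt (here u∈G)     (here refl) = 0 , 0 , here u∈G , here u∈G , refl
splitAt p@(step _ _)   (here refl) = 0 , _ , here (start∈ p) , p , refl
splitAt (step {w = w} e p) (there i) =
  let (ℓ₁ , ℓ₂ , p₁ , p₂ , eq) = splitAt p i
  in w + ℓ₁ , ℓ₂ , step e p₁ , p₂ , trans (+-assoc w ℓ₁ ℓ₂) (cong (w +_) eq)

-- The last component carries any property of the visited vertices over to the prefix, so an initial
-- piece of a detour avoids whatever the detour avoids.
prefix : ∀ {M} → WeightsInRange M G → (p : Walk G u t ℓ) (i : Fin (length (visited p))) →
         ∃[ ℓ′ ] Σ[ q ∈ Walk G u (lookup (visited p) i) ℓ′ ] ℓ′ ≤ toℕ i * M ×
         (∀ {P : Fin n → Set} → All P (visited p) → All P (visited q))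
prefix _ (here u∈G)   fzero    = 0 , here u∈G , z≤n , λ ps → ps
prefix _ p@(step _ _) fzero    = 0 , here (start∈ p) , z≤n , λ { (px ∷ _) → px ∷ [] }
prefix r (step e p)   (fsuc i) =
  let (ℓ′ , q , ℓ′≤ , keep) = prefix r p i
  in _ , step e q , +-mono-≤ (proj₂ (r e)) ℓ′≤ , λ { (px ∷ ps) → px ∷ keep ps }

-- Read backwards: a walk longer than `k * M` visits more than `k + 1` vertices. Long detours thus
-- supply the vertices to be counted.
length-bound : ∀ {M} → WeightsInRange M G → (p : Walk G u t ℓ) →
               ∃[ k ] length (visited p) ≡ suc k × ℓ ≤ k * M
length-bound _ (here _)   = 0 , refl , z≤n
length-bound r (step e p) =
  let (k , eq , ℓ≤) = length-bound r p in suc k , cong suc eq , +-mono-≤ (proj₂ (r e)) ℓ≤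

lookup-injective : ∀ {A : Set} {xs : List A} → Unique xs → ∀ {i j} →
                   lookup xs i ≡ lookup xs j → i ≡ j
lookup-injective (_ ∷ _)    {fzero}  {fzero}  _  = refl
lookup-injective (≢s ∷ _)   {fzero}  {fsuc j} eq = contradiction eq (All.lookup ≢s (∈-lookup j))
lookup-injective (≢s ∷ _)   {fsuc i} {fzero}  eq = contradiction (sym eq) (All.lookup ≢s (∈-lookup i))
lookup-injective (_ ∷ un)   {fsuc i} {fsuc j} eq = cong fsuc (lookup-injective un eq)

path-bound : ∀ {n} {G : Graph n} {u t ℓ M} → WeightsInRange M G → Path G u t ℓ → ℓ ≤ n * M
path-bound {n} {M = M} r (p , un) with length-bound r p
... | k , eq , ℓ≤ = ≤-trans ℓ≤ (*-monoˡ-≤ M (≤-trans (n≤1+n k)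
        (subst (_≤ n) eq (Fin.injective⇒≤ {f = lookup (visited p)} (lookup-injective un)))))

-- Distances

-- Distances are restated with walks, which can be concatenated without making them simple again. A
-- code `suc d` stands for `d`, and 0 for infinity; the clause `1 ≤ c` makes the code finite as soon
-- as there is a walk.
record IsCode {n} (H : Graph n) (s t : Fin n) (c : ℕ) : Set where
  field
    lower    : ∀ {ℓ} → Walk H s t ℓ → 1 ≤ c × c ≤ suc ℓ
    attained : ∀ {d} → c ≡ suc d → Walk H s t d
open IsCode public

IsDist⇒IsCode : ∀ {d} → IsDist G s t d → IsCode G s t (codeDist d)
IsDist⇒IsCode {d = just d} ((p , _) , least) = record
  { lower    = λ q → s≤s z≤n , (let (_ , ≤ℓ , r) = walk⇒path q in s≤s (≤-trans (least r) ≤ℓ))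
  ; attained = λ { refl → p } }
IsDist⇒IsCode {d = nothing} none = record
  { lower    = λ q → ⊥-elim (none (proj₂ (proj₂ (walk⇒path q))))
  ; attained = λ () }

IsCode⇒IsDist : ∀ {c} → IsCode G s t c → ∃[ d ] IsDist G s t d × c ≡ codeDist d
IsCode⇒IsDist {c = zero}  code = nothing , (λ (p , _) → 1+n≰n (proj₁ (lower code p))) , refl
IsCode⇒IsDist {c = suc d} code with walk⇒path (attained code refl)
... | d′ , d′≤d , p with ≤-antisym d′≤d (≤-pred (proj₂ (lower code (proj₁ p))))
... | refl = just d , (p , λ (q , _) → ≤-pred (proj₂ (lower code q))) , refl

-- Ancestors in a shortest path tree

-- Up T a t j d: the ancestor j levels above t is a, at tree distance d.
data Up {n} (T : Parents n) : Fin n → Fin n → ℕ → ℕ → Set where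
  stop : ∀ {t} → Up T t t 0 0
  up   : ∀ {a p t w j d} → T a ≡ just (p , w) → Up T a t j d → Up T p t (suc j) (w + d)

-- The graphs H v left by the failures named by v. An edge is named by its
-- lower endpoint, which therefore keeps its edges to its children.
record Failures {n} (G : Graph n) (T : Parents n) (H : Fin n → Graph n) : Set where
  field
    keep   : ∀ {v a b w} → weight G a b ≡ just w → a ≢ v → b ≢ v → weight (H v) a b ≡ just w
    sound  : ∀ {v a b w} → weight (H v) a b ≡ just w → weight G a b ≡ just w
    member : ∀ {v z} → z ≢ v → z ∈ vertices (H v)
    below  : ∀ {v b w} → v ∈ vertices (H v) → T b ≡ just (v , w) → weight (H v) v b ≡ just w

-- Recursion towards the target finds the last vertex of p in B.
last∈ : ∀ {n} {G : Graph n} {B : Fin n → Set} → (∀ z → Dec (B z)) → ∀ {u t ℓ} (p : Walk G u t ℓ) →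
        Unique (visited p) → All (λ z → ¬ B z) (visited p) ⊎
        (∃[ z ] B z × z ∈ᴸ visited p × ∃[ ℓ₁ ] ∃[ ℓ₂ ] Walk G u z ℓ₁ × ℓ₁ + ℓ₂ ≡ ℓ ×
         Σ[ q ∈ Walk G z t ℓ₂ ] Unique (visited q) ×
         ∃[ zs ] visited q ≡ z ∷ zs × All (λ z → ¬ B z) zs)
last∈ B? (here {u} u∈G) un with B? u
... | yes b = inj₂ (u , b , here refl , 0 , 0 , here u∈G , refl , here u∈G , un , [] , refl , [])
... | no ¬b = inj₁ (¬b ∷ [])
last∈ B? p@(step {u} {w = w} e q) un@(_ ∷ un′) with last∈ B? q un′
... | inj₂ (z , b , z∈ , ℓ₁ , ℓ₂ , p₁ , eq , rest) =
  inj₂ (z , b , there z∈ , w + ℓ₁ , ℓ₂ , step e p₁ , trans (+-assoc w ℓ₁ ℓ₂) (cong (w +_) eq) , rest)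
... | inj₁ none with B? u
... | yes b = inj₂ (u , b , here refl , 0 , _ , here (start∈ p) , refl , p , un , _ , refl , none)
... | no ¬b = inj₁ (¬b ∷ none)

module Tree {n} (G : Graph n) (full : ∀ z → z ∈ vertices G) (s : Fin n) (T : Parents n)
            (tree : IsShortestPathTree G s T) where
  open IsShortestPathTree tree

  private
    variable
      a b : Fin n
      d e i j k : ℕ

  up-++ : Up T a b k e → Up T b t i d → Up T a t (k + i) (e + d)
  up-++ stop     V = V
  up-++ (up {w = w} eq U) V = subst (Up T _ _ _) (sym (+-assoc w _ _)) (up eq (up-++ U V))

  up-split : ∀ k → Up T b t (k + i) e →
             ∃[ a ] ∃[ e′ ] ∃[ d ] Up T b a k e′ × Up T a t i d × e ≡ e′ + d
  up-split zero    U = _ , 0 , _ , stop , U , refl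
  up-split (suc k) (up {w = w} eq U) =
    let (a , e′ , d , V , V′ , eq′) = up-split k U
    in a , w + e′ , d , up eq V , V′ , trans (cong (w +_) eq′) (sym (+-assoc w e′ d))

  up-det : Up T a t j d → Up T b t j e → a ≡ b × d ≡ e
  up-det stop stop = refl , refl
  up-det (up eq U) (up eq′ V) with up-det U V
  ... | refl , refl with trans (sym eq) eq′
  ... | refl = refl , refl

  ¬up-root : ¬ Up T a s (suc j) d
  ¬up-root (up eq stop) with trans (sym rootless) eq
  ... | ()
  ¬up-root (up eq U@(up _ _)) = ¬up-root U

  up-rest : Up T a t k d → Up T b t i e → i ≤ k → ∃[ δ ] Up T a b (k ∸ i) δ × d ≡ δ + e
  up-rest {t = t} {k = k} {i = i} U V i≤k
    with up-split (k ∸ i) (subst (λ k → Up T _ t k _) (sym (m∸n+n≡m i≤k)) U)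
  ... | _ , δ , _ , W , V′ , eq with up-det V V′
  ... | refl , refl = δ , W , eq

  up-≤ : Up T s t k d → Up T a t j e → j ≤ k
  up-≤ {k = k} {j = j} U V with ≤-<-connex j k
  ... | inj₁ j≤k = j≤k
  ... | inj₂ k<j with up-rest V U (<⇒≤ k<j)
  ... | _ , W , _ with j ∸ k in eq
  ... | zero  = contradiction (m∸n≡0⇒m≤n eq) (<⇒≱ k<j)
  ... | suc _ = ⊥-elim (¬up-root W)

  depth-unique : Up T s t k d → Up T s t j e → k ≡ j × d ≡ e
  depth-unique U V with ≤-antisym (up-≤ V U) (up-≤ U V)
  ... | refl = refl , proj₂ (up-det U V)

  depth-split : Up T s t k d → Up T a t j e → ∃[ i ] ∃[ δ ] Up T s a i δ × k ≡ i + j × d ≡ δ + e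
  depth-split U V =
    let (δ , W , eq) = up-rest U V (up-≤ U V)
    in _ , δ , W , sym (m∸n+n≡m (up-≤ U V)) , eq

  -- `T` is a mere function and might contain cycles. Below the root there are none: the depth of
  -- `t` is that of `a` plus either height, and depths are unique.
  height-unique : Up T s t k d → Up T a t i e → Up T a t j ℓ → i ≡ j × e ≡ ℓ
  height-unique U V W with depth-split U V | depth-split U W
  ... | i₁ , δ₁ , V′ , eq₁ , eq₁′ | i₂ , δ₂ , W′ , eq₂ , eq₂′ with depth-unique V′ W′
  ... | refl , refl = +-cancelˡ-≡ i₁ _ _ (trans (sym eq₁) eq₂) , +-cancelˡ-≡ δ₁ _ _ (trans (sym eq₁′) eq₂′)

  up? : Up T b t j d → ∀ z → Dec (∃[ i ] ∃[ e ] i ≤ j × Up T z t i e)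
  up? {t = t} stop z with z Fin.≟ t
  ... | yes refl = yes (0 , 0 , z≤n , stop)
  ... | no z≢t   = no λ { (_ , _ , z≤n , stop) → z≢t refl }
  up? (up {p = p} eq U) z with z Fin.≟ p | up? U z
  ... | yes refl | _ = yes (_ , _ , ≤-refl , up eq U)
  ... | no _ | yes (i , e , i≤ , V) = yes (i , e , m≤n⇒m≤1+n i≤ , V)
  ... | no z≢p | no none = no λ where
    (i , e , i≤ , V) → case m≤n⇒m<n∨m≡n i≤ of λ where
      (inj₁ i<)   → none (i , e , ≤-pred i< , V)
      (inj₂ refl) → z≢p (proj₁ (up-det V (up eq U)))

  Branch⇒Up : Branch T s t ℓ → ∃[ k ] Up T s t k ℓ
  Branch⇒Up root = 0 , stop
  Branch⇒Up (down {w = w} {ℓ = ℓ} eq B) =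
    let (k , U) = Branch⇒Up B
    in k + 1 , subst (Up T s _ _) (cong (ℓ +_) (+-identityʳ w)) (up-++ U (up eq stop))

  extend : Branch T s a ℓ → Up T a t j d → Branch T s t (ℓ + d)
  extend {ℓ = ℓ} B stop = subst (Branch T s _) (sym (+-identityʳ ℓ)) B
  extend {ℓ = ℓ} B (up {w = w} {d = d} eq U) =
    subst (Branch T s _) (+-assoc ℓ w d) (extend (down eq B) U)

  Up⇒Branch : Up T s t k d → Branch T s t d
  Up⇒Branch = extend root

  tree-walk : Up T a t j d → Walk G a t d
  tree-walk stop      = here (full _)
  tree-walk (up eq U) = step (subgraph eq) (tree-walk U)

  tree-shortest : Up T s t k d → Walk G s t ℓ → d ≤ ℓ
  tree-shortest U p =
    let (_ , ≤ℓ , q) = walk⇒path p in ≤-trans (proj₂ (shortest (Up⇒Branch U)) q) ≤ℓ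

  -- Prefixing the tree path from the root to `a` turns a walk from `a` into one from `s`, to which
  -- minimality of tree paths applies.
  up-shortest : Up T s t k d → Up T a t j e → Walk G a t ℓ → e ≤ ℓ
  up-shortest U V p with depth-split U V
  ... | _ , δ , W , _ , refl = +-cancelˡ-≤ δ _ _ (tree-shortest U (tree-walk W ++ʷ p))

  reachable : Walk G s t ℓ → ∃[ k ] ∃[ d ] Up T s t k d
  reachable p = let (_ , B) = spanning (proj₂ (proj₂ (walk⇒path p)))
                    (k , U) = Branch⇒Up B in k , _ , U

  module Failing {H : Fin n → Graph n} (failures : Failures G T H) where
    open Failures failures

    toG : Walk (H v) u t ℓ → Walk G u t ℓ
    toG (here _)   = here (full _)
    toG (step e p) = step (sound e) (toG p)

    visited-toG : (p : Walk (H v) u t ℓ) → visited (toG p) ≡ visited p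
    visited-toG (here _)         = refl
    visited-toG (step {u} e p) = cong (u ∷_) (visited-toG p)

    fromG : (p : Walk G u t ℓ) → All (_≢ v) (visited p) → Walk (H v) u t ℓ
    fromG (here _)              (u≢v ∷ []) = here (member u≢v)
    fromG (step e (here _))     (u≢v ∷ z≢v ∷ []) = step (keep e u≢v z≢v) (here (member z≢v))
    fromG (step e p@(step _ _)) (u≢v ∷ ≢vs@(z≢v ∷ _)) = step (keep e u≢v z≢v) (fromG p ≢vs)

    avoiding : Up T a t j d → (∀ {z i e} → Up T z t i e → i ≤ j → z ≢ v) → Walk (H v) a t d
    avoiding stop ≢v = here (member (≢v stop z≤n))
    avoiding (up eq U) ≢v =
      step (keep (subgraph eq) (≢v (up eq U) ≤-refl) (≢v U (n≤1+n _)))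
           (avoiding U λ V i≤j → ≢v V (m≤n⇒m≤1+n i≤j))

    -- A tree path that starts at or below v survives the failure of v
    -- unless v itself is gone.
    downward : Up T s x k ℓ → Up T v x i e → Up T z x j d → j ≤ i → z ∈ vertices (H v) →
               Walk (H v) z x d
    downward X V Z j≤i z∈ with m≤n⇒m<n∨m≡n j≤i
    ... | inj₁ j<i = avoiding Z λ { W l≤j refl → <⇒≱ j<i (subst (_≤ _) (proj₁ (height-unique X W V)) l≤j) }
    downward X V Z j≤i z∈ | inj₂ refl with up-det V Z
    downward X V stop j≤i z∈ | inj₂ refl | refl , refl = here z∈
    downward X V (up eq Z) j≤i z∈ | inj₂ refl | refl , refl =
      step (below z∈ eq)
        (avoiding Z λ { W l≤j refl → 1+n≰n (subst (_≤ _) (proj₁ (height-unique X W V)) l≤j) })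

    walk∈ : (p : Walk (H v) u t ℓ) → z ∈ᴸ visited p → z ∈ vertices (H v)
    walk∈ p i = start∈ (proj₁ (proj₂ (proj₂ (proj₂ (splitAt p i)))))

    module Coded (C : Fin n → Fin n → ℕ) where

      Coded-at : Fin n → Set
      Coded-at v = ∀ t → IsCode (H v) s t (C t v)

      -- The replacement distance of t is less than the one through x.
      Relevant : (t x v : Fin n) → ℕ → Set
      Relevant t x v off = 1 ≤ C t v × (C x v ≡ 0 ⊎ C t v < C x v + off)

      -- Suppose `p` met an ancestor `z` of `x` at or below `v`. The tree path from `z` down to `x`
      -- survives the failure, and the tree path from `z` through `x` to `t` is no longer than the
      -- rest of `p`. Going through `x` would then be as good as `p`, against relevance.
      relevant-clear : Coded-at v → Up T s t k ℓ → Up T x t i ℓ′ → Up T v x j d →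
                       Relevant t x v ℓ′ → ∀ {ℓ″} (p : Walk (H v) s t ℓ″) → suc ℓ″ ≤ C t v →
                       ∀ {z i e} → z ∈ᴸ visited p → Up T z x i e → ¬ i ≤ j
      relevant-clear {v = v} {t = t} {x = x} {ℓ′ = off} Cv S U V (_ , rel) p p≤ {e = e} z∈ Z i≤j
        with splitAt p z∈ | depth-split S U
      ... | ℓ₁ , ℓ₂ , p₁ , p₂ , refl | _ , _ , X , _
        with rel | lower (Cv x) (p₁ ++ʷ downward X V Z i≤j (walk∈ p z∈))
      ... | inj₁ eq | 1≤C , _ = 1+n≰n (subst (1 ≤_) eq 1≤C)
      ... | inj₂ C<  | _ , C≤ = <-irrefl refl (begin-strict
        C t v             <⟨ C< ⟩
        C x v + off       ≤⟨ +-monoˡ-≤ off C≤ ⟩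
        suc (ℓ₁ + e) + off ≡⟨ +-assoc (suc ℓ₁) e off ⟩
        suc ℓ₁ + (e + off) ≤⟨ +-monoʳ-≤ (suc ℓ₁) (up-shortest S (up-++ Z U) (toG p₂)) ⟩
        suc ℓ₁ + ℓ₂        ≤⟨ p≤ ⟩
        C t v ∎)
        where open ≤-Reasoning

      -- A shortest replacement path for the upper failure `v′` keeps off the tree path from `v′` to
      -- `x`, hence off `v`, and so serves for `v` as well. This is what lets one prefix minimum
      -- answer all lower failures.
      relevant-lower : ∀ {v v′ i₀} → Coded-at v → Coded-at v′ → Up T s t k ℓ → Up T x t i₀ ℓ′ →
                       Up T v′ x j d → Up T v x i e → i ≤ j → Relevant t x v′ ℓ′ →
                       1 ≤ C t v × C t v ≤ C t v′
      relevant-lower {t = t} {v = v} {v′ = v′} Cv Cv′ S U V′ V i≤j rel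
        with v Fin.≟ v′
      ... | yes refl = proj₁ rel , ≤-refl
      ... | no v≢v′ = from-code (C t v′) refl
        where
        from-code : ∀ c → C t v′ ≡ c → 1 ≤ C t v × C t v ≤ C t v′
        from-code zero    eq = contradiction (subst (1 ≤_) eq (proj₁ rel)) 1+n≰n
        from-code (suc ℓ₀) eq =
          let p = attained (Cv′ t) eq
              (1≤C , C≤) = lower (Cv t) (fromG (toG p) (All.tabulate λ {z} z∈ z≡v →
                relevant-clear Cv′ S U V′ rel p (≤-reflexive (sym eq))
                  (subst (z ∈ᴸ_) (visited-toG p) z∈) (subst (λ z → Up T z _ _ _) (sym z≡v) V) i≤j))
          in 1≤C , subst (C t v ≤_) (sym eq) C≤

source∈ : (p : Walk G u t ℓ) → u ∈ᴸ visited p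
source∈ (here _)   = here refl
source∈ (step _ _) = here refl

quotient< : ∀ a d .{{_ : NonZero d}} → suc a ≤ d * suc (a / d)
quotient< a d = begin
  suc a                    ≡⟨ cong suc (m≡m%n+[m/n]*n a d) ⟩
  suc (a % d) + a / d * d  ≤⟨ +-monoˡ-≤ _ (m%n<n a d) ⟩
  d + a / d * d            ≡⟨ *-comm (suc (a / d)) d ⟩
  d * suc (a / d)          ∎
  where open ≤-Reasoning

-- The map from a list and a position to the entry is injective: within a list by uniqueness, across
-- lists by the last hypothesis, which is asked for one order of the lists only.
disjoint-heads : ∀ {n a b} (xs : Fin a → List (Fin n)) → (∀ α → Unique (xs α)) →
                 (∀ α (r : Fin b) → toℕ r < length (xs α)) →
                 (∀ α β i j → toℕ β < toℕ α → toℕ i < b → toℕ j < b → lookup (xs α) i ≢ lookup (xs β) j) →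
                 a * b ≤ n
disjoint-heads {n} {a} {b} xs unique long disjoint =
  Fin.injective⇒≤ {f = f} λ {i} {j} eq →
    let (eq₁ , eq₂) = injective (proj₁ (F.remQuot {a} b i)) (proj₁ (F.remQuot {a} b j)) _ _ eq in
    trans (sym (Fin.combine-remQuot {a} b i)) (trans (cong₂ F.combine eq₁ eq₂) (Fin.combine-remQuot {a} b j))
  where
  index : ∀ α (r : Fin b) → Fin (length (xs α))
  index α r = fromℕ< (long α r)
  index< : ∀ α r → toℕ (index α r) < b
  index< α r = subst (_< b) (sym (Fin.toℕ-fromℕ< (long α r))) (Fin.toℕ<n r)
  f : Fin (a * b) → Fin n
  f i = lookup (xs (proj₁ (F.remQuot {a} b i))) (index _ (proj₂ (F.remQuot {a} b i)))
  injective : ∀ α β r r′ → lookup (xs α) (index α r) ≡ lookup (xs β) (index β r′) → α ≡ β × r ≡ r′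
  injective α β r r′ eq with Fin.<-cmp α β
  ... | tri< α<β _ _ = contradiction (sym eq) (disjoint β α _ _ α<β (index< β r′) (index< α r))
  ... | tri> _ _ β<α = contradiction eq (disjoint α β _ _ β<α (index< α r) (index< β r′))
  ... | tri≈ _ refl _ = refl , Fin.toℕ-injective (trans (sym (Fin.toℕ-fromℕ< (long α r)))
          (trans (cong toℕ (lookup-injective (unique α) {index α r} {index α r′} eq)) (Fin.toℕ-fromℕ< (long α r′))))

-- The number of distinct relevant replacement distances of t

module Counting {n} (G : Graph n) (full : ∀ z → z ∈ vertices G) (s : Fin n) (T : Parents n)
                (tree : IsShortestPathTree G s T) {H : Fin n → Graph n}
                (failures : Failures G T H) (C : Fin n → Fin n → ℕ)
                {M : ℕ} .{{_ : NonZero M}} (range : WeightsInRange M G) where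
  open Tree G full s T tree
  open Failing failures
  open Failures failures using (member)
  open Coded C

  private
    variable
      a b : Fin n
      d e i j k h : ℕ

  -- The part of a replacement path behind its last vertex that is an ancestor of x.
  record Detour (x v t : Fin n) (i : ℕ) : Set where
    field
      {vertex}         : Fin n
      {height toVertex len} : ℕ
      above    : Up T vertex x height toVertex
      higher   : i < height
      survives : Walk (H v) vertex t len
      simple   : Unique (visited (toG survives))
      {rest}   : List (Fin n)
      visits   : visited (toG survives) ≡ vertex ∷ rest
      leaves   : All (λ z → ∀ i e → ¬ Up T z x i e) rest
      short    : ∀ {k δ} → Up T s vertex k δ → suc (δ + len) ≤ C t v

  -- The root is an ancestor of `x` on the path, so there is a last such vertex, and relevance
  -- forces it above `v`. In `short` the piece before it is replaced by the tree path, which is no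
  -- longer.
  detour : Coded-at v → Up T s t k ℓ → Up T x t h ℓ′ → Up T v x i d → Relevant t x v ℓ′ → Detour x v t i
  detour {v = v} {t = t} {x = x} {i = i} Cv S U V rel = from-code (C t v) refl
    where
    from-code : ∀ c → C t v ≡ c → Detour x v t i
    from-code zero     eq = contradiction (subst (1 ≤_) eq (proj₁ rel)) 1+n≰n
    from-code (suc ℓ₀) eq with walk⇒path (attained (Cv t) eq)
    ... | ℓ₁ , ℓ₁≤ , p , un
      with last∈ (up? (proj₁ (proj₂ (proj₂ (depth-split S U))))) p un
    ... | inj₁ none = ⊥-elim (All.lookup none (source∈ p) (_ , _ , ≤-refl , proj₁ (proj₂ (proj₂ (depth-split S U)))))
    ... | inj₂ (z , (j , e , _ , Z) , z∈ , ℓ₂ , ℓ₃ , p₁ , refl , q , un′ , zs , eq′ , none) = record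
      { above    = Z
      ; higher   = ≰⇒> (relevant-clear Cv S U V rel p p≤ z∈ Z)
      ; survives = q
      ; simple   = subst Unique (sym (visited-toG q)) un′
      ; visits   = trans (visited-toG q) eq′
      ; leaves   = All.map (λ ¬b _ _ W → ¬b (_ , _ , up-≤ X W , W)) none
      ; short    = λ W → ≤-trans (s≤s (+-monoˡ-≤ ℓ₃ (tree-shortest W (toG p₁)))) p≤
      }
      where
      X = proj₁ (proj₂ (proj₂ (depth-split S U)))
      p≤ = subst (suc (ℓ₂ + ℓ₃) ≤_) (sym eq) (s≤s ℓ₁≤)

  -- Behind its first vertex a detour meets no ancestor of `x`, so only the height of the first
  -- vertex has to be excluded.
  detour-avoids : ∀ {v v′} → Up T s x k ℓ → (Q : Detour x v t i) → Up T v′ x j d →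
                  Detour.height Q ≢ j → All (_≢ v′) (visited (toG (Detour.survives Q)))
  detour-avoids X Q V′ h≢j = subst (All _) (sym visits)
    ((λ { refl → h≢j (proj₁ (height-unique X above V′)) }) ∷
     All.map (λ ¬anc → λ { refl → ¬anc _ _ V′ }) leaves)
    where open Detour Q

  private
   -- The failures `v 0` to `v m` are numbered from the root downwards. In `drops`, each code is
   -- smaller than its predecessor by at least 1; sums express this without truncated subtraction.
   module Sampling {t x off} {k ℓ h k₀ ℓ₀} (S : Up T s t k ℓ) (X : Up T s x k₀ ℓ₀) (U : Up T x t h off)
           (m : ℕ) (v : ℕ → Fin n) (height : ℕ → ℕ) (toX : ℕ → ℕ)
           (above : ∀ {c} → c ≤ m → Up T (v c) x (height c) (toX c))
           (coded : ∀ {c} → c ≤ m → Coded-at (v c))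
           (relevant : ∀ {c} → c ≤ m → Relevant t x (v c) off)
           (descends : ∀ {b c} → b < c → c ≤ m → height c < height b)
           (drops : ∀ {b c} → b ≤ c → c ≤ m → C t (v c) + c ≤ C t (v b) + b)
           (Q : ∀ {c} → c ≤ m → Detour x (v c) t (height c)) where

      module Q {c} (c≤m : c ≤ m) = Detour (Q c≤m)

      to-vertex : ∀ {c} (c≤m : c ≤ m) → ∃[ i ] ∃[ δ ] Up T s (Q.vertex c≤m) i δ × ℓ ≡ δ + (Q.toVertex c≤m + off)
      to-vertex c≤m with depth-split S (up-++ (Q.above c≤m) U)
      ... | i , δ , W , _ , eq = i , δ , W , eq

      detached : ∀ {v u i δ j e l f} → Up T s u i δ → Up T u x j e → Up T v x l f → l < j → Walk (H v) s u δ
      detached W Z V l<j = avoiding W λ { V′ _ refl →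
        <⇒≱ l<j (subst (_ ≤_) (sym (proj₁ (height-unique X V (up-++ V′ Z)))) (m≤n+m _ _)) }

      distance≤ : ∀ {c} → c ≤ m → suc ℓ ≤ C t (v c)
      distance≤ {c} c≤m = from-code (C t (v c)) refl
        where
        from-code : ∀ c₀ → C t (v c) ≡ c₀ → suc ℓ ≤ C t (v c)
        from-code zero    eq = contradiction (subst (1 ≤_) eq (proj₁ (relevant c≤m))) 1+n≰n
        from-code (suc d) eq = subst (suc ℓ ≤_) (sym eq) (s≤s (tree-shortest S (toG (attained (coded c≤m t) eq))))

      -- Even the last replacement distance is at least the tree distance `ℓ`, and each step back to
      -- an earlier failure adds one.
      slack : ∀ {c} → c ≤ m → suc ℓ + m ≤ C t (v c) + c
      slack c≤m = ≤-trans (+-monoˡ-≤ m (distance≤ ≤-refl)) (drops c≤m ≤-refl)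

      -- The tree path to the first vertex of the detour, of length at most `ℓ`, followed by the
      -- detour avoids the failure. The whole excess given by `slack` must therefore lie in the
      -- detour.
      detour-long : ∀ {c} (c≤m : c ≤ m) → m ≤ Q.len c≤m + c
      detour-long {c} c≤m with to-vertex c≤m
      ... | _ , δ , W , eq = +-cancelˡ-≤ (suc ℓ) _ _ (begin
        suc ℓ + m                   ≤⟨ slack c≤m ⟩
        C t (v c) + c               ≤⟨ +-monoˡ-≤ c (proj₂ (lower (coded c≤m t)
                                        (detached W (Q.above c≤m) (above c≤m) (Q.higher c≤m) ++ʷ Q.survives c≤m))) ⟩
        suc (δ + Q.len c≤m) + c     ≤⟨ +-monoˡ-≤ c (s≤s (+-monoˡ-≤ (Q.len c≤m)
                                        (subst (δ ≤_) (sym eq) (m≤m+n δ _)))) ⟩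
        suc (ℓ + Q.len c≤m) + c     ≡⟨ +-assoc (suc ℓ) _ c ⟩
        suc ℓ + (Q.len c≤m + c)     ∎)
        where open ≤-Reasoning

      -- Otherwise the replacement path for v a also avoids v b, although
      -- it is shorter than that for v b.
      leaves-low : ∀ {a b} (a≤m : a ≤ m) → b < a → Q.height a≤m ≤ height b
      leaves-low {a} {b} a≤m b<a with ≤-<-connex (Q.height a≤m) (height b)
      ... | inj₁ h≤ = h≤
      ... | inj₂ h> with to-vertex a≤m
      ... | _ , δ , W , _ = contradiction (begin
        C t (v a) + a             ≤⟨ drops (<⇒≤ b<a) a≤m ⟩
        C t (v b) + b             ≤⟨ +-monoˡ-≤ b (proj₂ (lower (coded b≤m t)
                                      (detached W (Q.above a≤m) (above b≤m) h> ++ʷ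
                                       fromG (toG (Q.survives a≤m))
                                         (detour-avoids X (Q a≤m) (above b≤m) (λ eq → <-irrefl (sym eq) h>))))) ⟩
        suc (δ + Q.len a≤m) + b   ≤⟨ +-monoˡ-≤ b (Q.short a≤m W) ⟩
        C t (v a) + b             ∎) (<⇒≱ (+-monoʳ-< (C t (v a)) b<a))
        where
        open ≤-Reasoning
        b≤m = ≤-trans (<⇒≤ b<a) a≤m

      -- At a common vertex, switch from the detour for `v b` to the one for `v a`, follow it back
      -- to its start and descend to `x`. The gap `suc b < a` puts this start strictly below `v b`,
      -- by `leaves-low` for `suc b`, so the walk avoids `v b`. By relevance the two pieces must
      -- make up for the excess of the replacement distance for `v b`.
      collision : ∀ {a b} (a≤m : a ≤ m) (b≤m : b ≤ m) → suc b < a → ∀ i j →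
                  lookup (visited (toG (Q.survives a≤m))) i ≡ lookup (visited (toG (Q.survives b≤m))) j →
                  m < toℕ i * M + toℕ j * M + b
      collision {a} {b} a≤m b≤m b+1<a i j eq
        with prefix range (toG (Q.survives a≤m)) i | prefix range (toG (Q.survives b≤m)) j
           | to-vertex a≤m | to-vertex b≤m
      ... | A , qa , A≤ , keepa | B , qb , B≤ , keepb | _ , δa , Wa , eqa | _ , δb , Wb , eqb =
        +-cancelˡ-≤ ℓ _ _ (begin
          ℓ + suc m                          ≡⟨ +-suc ℓ m ⟩
          suc ℓ + m                          ≤⟨ slack b≤m ⟩
          C t (v b) + b                      ≤⟨ +-monoˡ-≤ b Cb≤ ⟩
          δa + (B + (A + ea)) + off + b      ≡⟨ regroup δa A B ea off b ⟩
          δa + (ea + off) + (A + B + b)      ≡⟨ cong (_+ (A + B + b)) (sym eqa) ⟩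
          ℓ + (A + B + b)                    ≤⟨ +-monoʳ-≤ ℓ (+-monoˡ-≤ b (+-mono-≤ A≤ B≤)) ⟩
          ℓ + (toℕ i * M + toℕ j * M + b)    ∎)
        where
        open ≤-Reasoning
        regroup : ∀ δ A B e off b → δ + (B + (A + e)) + off + b ≡ δ + (e + off) + (A + B + b)
        regroup = solve-∀
        ea = Q.toVertex a≤m
        ha<hb : Q.height a≤m < height b
        ha<hb = ≤-<-trans (leaves-low a≤m b+1<a) (descends ≤-refl (≤-trans (<⇒≤ b+1<a) a≤m))
        ha≤ : Q.height a≤m ≤ Q.height b≤m
        ha≤ = <⇒≤ (<-trans ha<hb (Q.higher b≤m))
        -- The detour for `v b` starts higher up, so its tree path is part of the one to the start
        -- of the other detour. This turns the length of `walk` into a bound relative to `ℓ`.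
        δb≤δa : δb ≤ δa
        δb≤δa with up-rest (Q.above b≤m) (Q.above a≤m) ha≤
        ... | _ , Y , _ with depth-split Wa Y
        ... | _ , δ , Wb′ , _ , eq′ =
          subst (_≤ δa) (sym (proj₂ (depth-unique Wb Wb′))) (subst (δ ≤_) (sym eq′) (m≤m+n δ _))
        walk : Walk (H (v b)) s x (δb + (B + (A + ea)))
        walk = detached Wb (Q.above b≤m) (above b≤m) (Q.higher b≤m) ++ʷ
          (fromG qb (keepb (detour-avoids X (Q b≤m) (above b≤m) (λ e → <-irrefl (sym e) (Q.higher b≤m)))) ++ʷ
          (reverse (subst (λ y → Walk (H (v b)) _ y A) eq
             (fromG qa (keepa (detour-avoids X (Q a≤m) (above b≤m) (<⇒≢ ha<hb))))) ++ʷ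
           downward X (above b≤m) (Q.above a≤m) (<⇒≤ ha<hb) (member λ { vertex≡v →
             <⇒≢ ha<hb (proj₁ (height-unique X (subst (λ z → Up T z x (Q.height a≤m) ea) vertex≡v (Q.above a≤m)) (above b≤m))) })))
        Cb≤ : C t (v b) ≤ δa + (B + (A + ea)) + off
        Cb≤ with proj₂ (relevant b≤m) | lower (coded b≤m x) walk
        ... | inj₁ C≡0 | 1≤C , _ = contradiction (subst (1 ≤_) C≡0 1≤C) 1+n≰n
        ... | inj₂ C<  | _ , C≤  = ≤-pred (≤-trans C< (+-monoˡ-≤ off (≤-trans C≤ (s≤s (+-monoˡ-≤ _ δb≤δa)))))

      -- The sample consists of the indices `2α` with `α ≤ q` and the first `p + 1` vertices of each
      -- detour. Two initial pieces of length at most `q` and a doubled index of at most `2q` stay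
      -- within `4q ≤ m`, which `collision` excludes.
      module Sample (q p : ℕ) (4q≤m : q + q + (q + q) ≤ m) (pM≤q : p * M ≤ q) where

        double≤ : (α : Fin (suc q)) → toℕ α + toℕ α ≤ q + q
        double≤ α = let α≤ = ≤-pred (Fin.toℕ<n α) in +-mono-≤ α≤ α≤

        even≤m : (α : Fin (suc q)) → toℕ α + toℕ α ≤ m
        even≤m α = ≤-trans (double≤ α) (≤-trans (m≤m+n _ _) 4q≤m)

        near : ∀ {r} → r < suc p → r * M ≤ q
        near r<p = ≤-trans (*-monoˡ-≤ M (≤-pred r<p)) pM≤q

        index< : ∀ α (r : Fin (suc p)) → toℕ r < length (visited (toG (Q.survives (even≤m α))))
        index< α r with length-bound range (toG (Q.survives (even≤m α)))
        ... | k , eq , len≤ = subst (toℕ r <_) (sym eq) (s≤s (≮⇒≥ λ k<r → <-irrefl refl (begin-strict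
          k * M                        <⟨ m<n+m (k * M) (>-nonZero⁻¹ M) ⟩
          suc k * M                    ≤⟨ *-monoˡ-≤ M k<r ⟩
          toℕ r * M                    ≤⟨ near (Fin.toℕ<n r) ⟩
          q                            ≤⟨ m≤m+n q q ⟩
          q + q                        ≤⟨ +-cancelʳ-≤ (q + q) (q + q) (Q.len (even≤m α)) (begin
            q + q + (q + q)                      ≤⟨ 4q≤m ⟩
            m                                    ≤⟨ detour-long (even≤m α) ⟩
            Q.len (even≤m α) + (toℕ α + toℕ α)   ≤⟨ +-monoʳ-≤ (Q.len (even≤m α)) (double≤ α) ⟩
            Q.len (even≤m α) + (q + q)           ∎) ⟩
          Q.len (even≤m α)             ≤⟨ len≤ ⟩
          k * M                        ∎)))
          where open ≤-Reasoning

        apart : ∀ α β i j → toℕ β < toℕ α → toℕ i < suc p → toℕ j < suc p →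
                lookup (visited (toG (Q.survives (even≤m α)))) i ≢ lookup (visited (toG (Q.survives (even≤m β)))) j
        apart α β i j β<α i<p j<p eq = <⇒≱ (collision (even≤m α) (even≤m β) 2β+1<2α i j eq) (begin
          toℕ i * M + toℕ j * M + (toℕ β + toℕ β)
            ≤⟨ +-mono-≤ (+-mono-≤ (near i<p) (near j<p)) (double≤ β) ⟩
          q + q + (q + q)  ≤⟨ 4q≤m ⟩
          m                ∎)
          where
          open ≤-Reasoning
          2β+1<2α : suc (toℕ β + toℕ β) < toℕ α + toℕ α
          2β+1<2α = subst (_≤ toℕ α + toℕ α) (cong suc (+-suc (toℕ β) (toℕ β))) (+-mono-≤ β<α β<α)

        product≤n : suc q * suc p ≤ n
        product≤n = disjoint-heads (λ α → visited (toG (Q.survives (even≤m α))))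
          (λ α → Q.simple (even≤m α)) index< apart

  few-relevant : ∀ {t x off k ℓ h} → Up T s t k ℓ → Up T x t h off →
    (m : ℕ) (v : ℕ → Fin n) (height : ℕ → ℕ) (toX : ℕ → ℕ) →
    (∀ {c} → c ≤ m → Up T (v c) x (height c) (toX c)) →
    (∀ {c} → c ≤ m → Coded-at (v c)) →
    (∀ {c} → c ≤ m → Relevant t x (v c) off) →
    (∀ {b c} → b < c → c ≤ m → height c < height b) →
    (∀ {b c} → b ≤ c → c ≤ m → C t (v c) + c ≤ C t (v b) + b) →
    suc m * suc m ≤ 16 * (M * n)
  few-relevant S U m v height toX above coded relevant descends drops = begin
    -- One factor is rounded up through the quotient by 4, the other through the quotients by 4 and
    -- by `M`; what remains is the product of the two sample sizes.
    suc m * suc m                             ≤⟨ *-mono-≤ (quotient< m 4) (≤-trans (quotient< m 4) (*-monoʳ-≤ 4 (quotient< (m / 4) M))) ⟩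
    4 * suc (m / 4) * (4 * (M * suc (m / 4 / M))) ≡⟨ regroup M (suc (m / 4)) (suc (m / 4 / M)) ⟩
    16 * (M * (suc (m / 4) * suc (m / 4 / M)))    ≤⟨ *-monoʳ-≤ 16 (*-monoʳ-≤ M
      (product≤n (m / 4) (m / 4 / M) (subst (_≤ m) (quadruple (m / 4)) (m/n*n≤m m 4)) (m/n*n≤m (m / 4) M))) ⟩
    16 * (M * n)                              ∎
    where
    open ≤-Reasoning
    open Sampling.Sample S (proj₁ (proj₂ (proj₂ (depth-split S U)))) U m v height toX above coded relevant descends drops
      (λ c≤m → detour (coded c≤m) S U (above c≤m) (relevant c≤m))
    regroup : ∀ M a b → 4 * a * (4 * (M * b)) ≡ 16 * (M * (a * b))
    regroup = solve-∀
    quadruple : ∀ q → q * 4 ≡ q + q + (q + q)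
    quadruple = solve-∀

-- Programs that fill arrays

infixl 6 _⊕_ _⊖_
infixl 7 _⊗_ _⊘_ _⊛_
infix  5 _≺_ _≈ᵉ_

_⊕_ _⊖_ _⊗_ _⊘_ _⊛_ _≺_ _≈ᵉ_ : Expr → Expr → Expr
_⊕_  = bin add
_⊖_  = bin sub
_⊗_  = bin mul
_⊘_  = bin div
_⊛_  = bin mod
_≺_  = bin less
_≈ᵉ_ = bin equal

-- The only loop of the programs: registers 7 and 9 count rows and columns up to the limits in 6 and
-- 8. Termination, time and word bounds are thus proved for a single shape.
fill : ℕ → Expr → Expr → Expr → Expr → Program
fill a rows columns index value =
  set 6 rows ⨾ set 8 columns ⨾ set 7 (lit 0) ⨾
  while (var 7 ≺ var 6)
    (set 9 (lit 0) ⨾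
     while (var 9 ≺ var 8) (put a index value ⨾ set 9 (var 9 ⊕ lit 1)) ⨾
     set 7 (var 7 ⊕ lit 1))

-- Charging every instruction once; a fill takes at most this much time per
-- cell, with an extra row and an extra column.
charge : Program → ℕ
charge skip         = 1
charge (set x e)    = suc (cost e)
charge (put a i e)  = suc (cost i + cost e)
charge (P ⨾ Q)      = charge P + charge Q
charge (ifte e P Q) = suc (cost e) + (charge P + charge Q)
charge (while e P)  = suc (cost e) + charge P

charge-fill : ∀ a rows columns index value → charge (fill a rows columns index value) ≡
              23 + (cost rows + cost columns + (cost index + cost value))
charge-fill a rows columns index value = eq (cost rows) (cost columns) (cost index) (cost value)
  where
  eq : ∀ x y i e → suc x + (suc y + (2 + (4 + (2 + (4 + (suc (i + e) + 4) + 4))))) ≡ 23 + (x + y + (i + e))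
  eq = solve-∀

-- What an expression may see of the registers during a fill: the unchanged inputs `ρ` and the two
-- counters.
counting : (ℕ → ℕ) → ℕ → ℕ → ℕ → ℕ
counting ρ q r x = if x ≡ᵇ 9 then r else if x ≡ᵇ 7 then q else ρ x

-- An array during a fill of rows of length m, when q rows and r further
-- cells have been written.
scatter : (ℕ → ℕ) → (ℕ → ℕ) → ℕ → (ℕ → ℕ) → ℕ → ℕ
scatter index value zero    init = init
scatter index value (suc r) init = scatter index value r init [ index r ↦ value r ]

written : (ℕ → ℕ → ℕ) → (ℕ → ℕ → ℕ) → ℕ → (ℕ → ℕ) → ℕ → ℕ → ℕ → ℕ
rows : (ℕ → ℕ → ℕ) → (ℕ → ℕ → ℕ) → ℕ → (ℕ → ℕ) → ℕ → ℕ → ℕ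
written index value m init q r = scatter (index q) (value q) r (rows index value m init q)
rows index value m init zero    = init
rows index value m init (suc q) = written index value m init q m

readable : ℕ → Bool
readable x = (x <ᵇ 6) ∨ ((x ≡ᵇ 7) ∨ (x ≡ᵇ 9))

-- A Boolean, so that it is checked by evaluation for each concrete expression. Literals stay below
-- 17, the number by which the bound `V` on all contents is bounded from below.
admissible : Expr → Bool
admissible (lit k)      = k <ᵇ 17
admissible (var x)      = readable x
admissible (get a i)    = admissible i
admissible (bin o e e′) = admissible e ∧ admissible e′

∧⁻ : ∀ a {b} → T (a ∧ b) → T a × T b
∧⁻ true tb = tt , tb

≡ᵇ-refl : ∀ i → (i ≡ᵇ i) ≡ true
≡ᵇ-refl zero    = refl
≡ᵇ-refl (suc i) = ≡ᵇ-refl i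

update-same : ∀ {A : Set} (f : ℕ → A) i {a} → (f [ i ↦ a ]) i ≡ a
update-same f i rewrite ≡ᵇ-refl i = refl

update-other : ∀ {A : Set} (f : ℕ → A) {i j a} → j ≢ i → (f [ i ↦ a ]) j ≡ f j
update-other f {i} {j} j≢i with j ≡ᵇ i in eq
... | true  = contradiction (≡ᵇ⇒≡ j i (subst T (sym eq) tt)) j≢i
... | false = refl

update-all : ∀ {f : ℕ → ℕ} {i a V} → (∀ x → f x ≤ V) → a ≤ V → ∀ x → (f [ i ↦ a ]) x ≤ V
update-all {i = i} f≤ a≤ x with x ≡ᵇ i
... | true  = a≤
... | false = f≤ x

-- With costs as exponents, one more unit absorbs any operation: a product adds exponents, a sum at
-- most doubles, and the others yield at most their left operand or 1.
apply-bound : ∀ {V} o {x y} a b → 2 ≤ V → x ≤ V ^ a → y ≤ V ^ b → apply o x y ≤ V ^ suc (a + b)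
apply-bound {V} o {x} {y} a b 2≤V x≤ y≤ = go o
  where
  instance _ = >-nonZero (≤-trans (s≤s z≤n) 2≤V)
  open ≤-Reasoning
  1≤ : ∀ k → 1 ≤ V ^ k
  1≤ k = m^n>0 V k
  x≤′ : x ≤ V ^ suc (a + b)
  x≤′ = ≤-trans x≤ (^-monoʳ-≤ V (m≤n⇒m≤1+n (m≤m+n a b)))
  bool : ∀ c → (if c then 1 else 0) ≤ V ^ suc (a + b)
  bool true  = 1≤ (suc (a + b))
  bool false = z≤n
  go : ∀ o → apply o x y ≤ V ^ suc (a + b)
  go add = begin
    x + y                      ≤⟨ +-mono-≤ (≤-trans x≤ (^-monoʳ-≤ V (m≤m+n a b))) (≤-trans y≤ (^-monoʳ-≤ V (m≤n+m b a))) ⟩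
    V ^ (a + b) + V ^ (a + b)  ≡⟨ cong (V ^ (a + b) +_) (sym (+-identityʳ _)) ⟩
    2 * V ^ (a + b)            ≤⟨ *-monoˡ-≤ (V ^ (a + b)) 2≤V ⟩
    V ^ suc (a + b)            ∎
  go sub = ≤-trans (m∸n≤m x y) x≤′
  go mul = begin
    x * y            ≤⟨ *-mono-≤ x≤ y≤ ⟩
    V ^ a * V ^ b    ≡⟨ sym (^-distribˡ-+-* V a b) ⟩
    V ^ (a + b)      ≤⟨ ^-monoʳ-≤ V (n≤1+n (a + b)) ⟩
    V ^ suc (a + b)  ∎
  go div = ≤-trans (quotient y) x≤′
    where
    quotient : ∀ y → apply div x y ≤ x
    quotient zero     = z≤n
    quotient (suc y′) = m/n≤m x (suc y′)
  go mod = ≤-trans (remainder y) x≤′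
    where
    remainder : ∀ y → apply mod x y ≤ x
    remainder zero     = z≤n
    remainder (suc y′) = m%n≤m x (suc y′)
  go less  = bool (x <ᵇ y)
  go equal = bool (x ≡ᵇ y)

update-cong : ∀ {A : Set} {f g : ℕ → A} {i i′ a a′} j → f j ≡ g j → i ≡ i′ → a ≡ a′ →
              (f [ i ↦ a ]) j ≡ (g [ i′ ↦ a′ ]) j
update-cong {i = i} j eq refl refl with j ≡ᵇ i
... | true  = refl
... | false = eq

less-true : ∀ {x y} → x < y → apply less x y ≡ 1
less-true {x} {y} x<y with x <ᵇ y in eq
... | true  = refl
... | false = ⊥-elim (subst T eq (<⇒<ᵇ x<y))

less-false : ∀ {x y} → y ≤ x → apply less x y ≡ 0
less-false {x} {y} y≤x with x <ᵇ y in eq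
... | true  = contradiction y≤x (<⇒≱ (<ᵇ⇒< x y (subst T (sym eq) tt)))
... | false = refl

equal-true : ∀ {x y} → x ≡ y → apply equal x y ≡ 1
equal-true {x} refl rewrite ≡ᵇ-refl x = refl

equal-false : ∀ {x y} → x ≢ y → apply equal x y ≡ 0
equal-false {x} {y} x≢y with x ≡ᵇ y in eq
... | true  = contradiction (≡ᵇ⇒≡ x y (subst T (sym eq) tt)) x≢y
... | false = refl

less≤1 : ∀ x y → apply less x y ≤ 1
less≤1 x y with x <ᵇ y
... | true  = ≤-refl
... | false = z≤n

equal≤1 : ∀ x y → apply equal x y ≤ 1
equal≤1 x y with x ≡ᵇ y
... | true  = ≤-refl
... | false = z≤n

scatter≤ : ∀ {index value : ℕ → ℕ} {init V} r → (∀ j → init j ≤ V) → (∀ i → i < r → value i ≤ V) →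
           ∀ j → scatter index value r init j ≤ V
scatter≤ zero    init≤ value≤ = init≤
scatter≤ (suc r) init≤ value≤ =
  update-all (scatter≤ r init≤ λ i i<r → value≤ i (m≤n⇒m≤1+n i<r)) (value≤ r ≤-refl)

rows≤ : ∀ {index value : ℕ → ℕ → ℕ} {m init V} q → (∀ j → init j ≤ V) →
        (∀ i r → i < q → r < m → value i r ≤ V) → ∀ j → rows index value m init q j ≤ V
rows≤ zero    init≤ value≤ = init≤
rows≤ {m = m} (suc q) init≤ value≤ =
  scatter≤ m (rows≤ q init≤ λ i r i<q → value≤ i r (m≤n⇒m≤1+n i<q)) λ r → value≤ q r ≤-refl

-- V bounds the contents of all registers and cells, W the words.
module Machine {V W : ℕ} (17≤V : 17 ≤ V) (room : ∀ k → T (k <ᵇ 4096) → V ^ k < W)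
               (ρ : ℕ → ℕ) where

  record Bounded (σ : State) : Set where
    field
      vars≤  : ∀ x → vars σ x ≤ V
      cells≤ : ∀ a j → arrays σ a j ≤ V
  open Bounded

  instance
    nonZeroV : NonZero V
    nonZeroV = >-nonZero (≤-trans (s≤s z≤n) 17≤V)

  V≤V^ : ∀ k → V ≤ V ^ suc k
  V≤V^ k = subst (_≤ V ^ suc k) (^-identityʳ V) (^-monoʳ-≤ V {1} {suc k} (s≤s z≤n))

  value≤ : ∀ {σ} → Bounded σ → ∀ e → T (admissible e) → ⟦ e ⟧ σ ≤ V ^ cost e
  value≤ β (lit k)      ok = ≤-trans (≤-trans (<⇒≤ (<ᵇ⇒< k 17 ok)) 17≤V) (V≤V^ 0)
  value≤ β (var x)      ok = ≤-trans (vars≤ β x) (V≤V^ 0)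
  value≤ β (get a i)    ok = ≤-trans (cells≤ β a _) (V≤V^ (cost i))
  value≤ β (bin o e e′) ok =
    let (ok₁ , ok₂) = ∧⁻ (admissible e) ok
    in apply-bound o (cost e) (cost e′) (≤-trans (s≤s (s≤s z≤n)) 17≤V) (value≤ β e ok₁) (value≤ β e′ ok₂)

  fits : ∀ {σ} → Bounded σ → ∀ e → T (admissible e) → V ^ cost e < W → Fits W σ e
  fits β e@(lit _)      ok <W = ≤-<-trans (value≤ β e ok) <W
  fits β e@(var _)      ok <W = ≤-<-trans (value≤ β e ok) <W
  fits β e@(get a i)    ok <W = fits β i ok (≤-<-trans (^-monoʳ-≤ V {cost i} {suc (cost i)} (n≤1+n _)) <W) , ≤-<-trans (value≤ β e ok) <W
  fits β e@(bin o l r)  ok <W =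
    let (ok₁ , ok₂) = ∧⁻ (admissible l) ok
    in fits β l ok₁ (≤-<-trans (^-monoʳ-≤ V {cost l} {suc (cost l + cost r)} (m≤n⇒m≤1+n (m≤m+n _ _))) <W) ,
       fits β r ok₂ (≤-<-trans (^-monoʳ-≤ V {cost r} {suc (cost l + cost r)} (m≤n⇒m≤1+n (m≤n+m _ _))) <W) ,
       ≤-<-trans (value≤ β e ok) <W

  -- The number 4096 is a generous limit for the cost of a single expression; `room` fits the word
  -- size to it.
  fitting : Expr → Bool
  fitting e = admissible e ∧ (cost e <ᵇ 4096)

  fit : ∀ {σ} → Bounded σ → ∀ e → T (fitting e) → Fits W σ e
  fit β e ok = let (ok₁ , ok₂) = ∧⁻ (admissible e) ok in fits β e ok₁ (room (cost e) ok₂)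

  fit-var : ∀ {σ} → Bounded σ → ∀ x → vars σ x < W
  fit-var β x = ≤-<-trans (vars≤ β x) (≤-<-trans (V≤V^ 0) (room 1 tt))

  -- The registers 0 to 5 are never written.
  record Represents (σ : State) (S : ℕ → ℕ → ℕ) : Set where
    field
      low   : ∀ x → T (x <ᵇ 6) → vars σ x ≡ ρ x
      cells : ∀ a j → arrays σ a j ≡ S a j
      vars≤ : ∀ x → vars σ x ≤ V
  open Represents

  bounded : ∀ {σ S} → Represents σ S → (∀ a j → S a j ≤ V) → Bounded σ
  bounded rep S≤ = record { vars≤ = vars≤ rep ; cells≤ = λ a j → subst (_≤ V) (sym (cells rep a j)) (S≤ a j) }

  agrees : ∀ {σ S} → Represents σ S → ∀ {q r} → vars σ 7 ≡ q → vars σ 9 ≡ r →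
           ∀ e → T (admissible e) → ⟦ e ⟧ σ ≡ ⟦ e ⟧ (state (counting ρ q r) S)
  agrees rep eq7 eq9 (lit k) ok = refl
  agrees {σ} rep {q} {r} eq7 eq9 (var x) ok = go x ok
    where
    go : ∀ x → T (readable x) → vars σ x ≡ counting ρ q r x
    go 0 _ = low rep 0 tt
    go 1 _ = low rep 1 tt
    go 2 _ = low rep 2 tt
    go 3 _ = low rep 3 tt
    go 4 _ = low rep 4 tt
    go 5 _ = low rep 5 tt
    go 6 ()
    go 7 _ = eq7
    go 8 ()
    go 9 _ = eq9
    go (2+ (2+ (2+ (2+ (2+ x))))) ()
  agrees {S = S} rep eq7 eq9 (get a i) ok = trans (cells rep a _) (cong (S a) (agrees rep eq7 eq9 i ok))
  agrees rep eq7 eq9 (bin o e e′) ok =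
    let (ok₁ , ok₂) = ∧⁻ (admissible e) ok
    in cong₂ (apply o) (agrees rep eq7 eq9 e ok₁) (agrees rep eq7 eq9 e′ ok₂)

  -- States are compared with ideal array contents pointwise. The bound on the final contents is
  -- derived from the one on the initial contents, so compositions need no side conditions.
  record Exec (N : ℕ) (P : Program) (S S′ : ℕ → ℕ → ℕ) : Set where
    constructor exec
    field
      runs : (∀ a j → S a j ≤ V) → (∀ a j → S′ a j ≤ V) ×
        (∀ σ → Represents σ S → ∃[ k ] ∃[ σ′ ] Run W P σ k σ′ × k ≤ charge P * N × Represents σ′ S′)
  open Exec public

  infixr 4 _⨾ᵉ_
  _⨾ᵉ_ : ∀ {N P Q S S′ S″} → Exec N P S S′ → Exec N Q S′ S″ → Exec N (P ⨾ Q) S S″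
  _⨾ᵉ_ {N} {P} {Q} {S} {S′} {S″} p q = exec both
    where
    both : (∀ a j → S a j ≤ V) → (∀ a j → S″ a j ≤ V) ×
           (∀ σ → Represents σ S → ∃[ k ] ∃[ σ′ ] Run W (P ⨾ Q) σ k σ′ × k ≤ charge (P ⨾ Q) * N × Represents σ′ S″)
    both S≤ with runs p S≤
    ... | S′≤ , run with runs q S′≤
    ... | S″≤ , run′ = S″≤ , λ σ rep →
      let (k  , σ′ , r  , k≤  , rep′) = run σ rep
          (k′ , σ″ , r′ , k′≤ , rep″) = run′ σ′ rep′
      in k + k′ , σ″ , (r ⨾ r′) , subst (k + k′ ≤_) (sym (*-distribʳ-+ N (charge P) (charge Q))) (+-mono-≤ k≤ k′≤) , rep″

  assign : ∀ {σ S x v} → Represents σ S → T (not (x <ᵇ 6)) → v ≤ V →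
           Represents (state (vars σ [ x ↦ v ]) (arrays σ)) S
  assign {σ} {x = x} rep 6≤x v≤ = record
    { low   = λ y y<6 → trans (update-other (vars σ) (λ { refl → not-both (y <ᵇ 6) y<6 6≤x })) (low rep y y<6)
    ; cells = cells rep
    ; vars≤ = update-all (vars≤ rep) v≤ }
    where
    not-both : ∀ b → T b → ¬ T (not b)
    not-both true _ ()

  -- In `spec` the array `a` is seen half written. An expression may thus read earlier cells of the
  -- array it is filling, which is how recurrences are computed.
  module Filling {S : ℕ → ℕ → ℕ} (a : ℕ) {R m : ℕ} (I E : Expr) (index value : ℕ → ℕ → ℕ)
                 (okI : T (fitting I)) (okE : T (fitting E)) (R≤V : R ≤ V) (m≤V : m ≤ V)
                 (spec : ∀ q r → q < R → r < m →
                   (⟦ I ⟧ (state (counting ρ q r) (S [ a ↦ written index value m (S a) q r ])) ≡ index q r) ×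
                   (⟦ E ⟧ (state (counting ρ q r) (S [ a ↦ written index value m (S a) q r ])) ≡ value q r) ×
                   value q r ≤ V) where

    mem : ℕ → ℕ → ℕ → ℕ → ℕ
    mem q r = S [ a ↦ written index value m (S a) q r ]

    record At (σ : State) (q r : ℕ) : Set where
      field
        represents : Represents σ (mem q r)
        mem≤       : ∀ b j → mem q r b j ≤ V
        reg6       : vars σ 6 ≡ R
        reg7       : vars σ 7 ≡ q
        reg8       : vars σ 8 ≡ m
    open At

    at-bounded : ∀ {σ q r} → At σ q r → Bounded σ
    at-bounded α = bounded (represents α) (mem≤ α)

    fit-less : ∀ {σ} → Bounded σ → ∀ x y → Fits W σ (var x ≺ var y)
    fit-less {σ} β x y = fit-var β x , fit-var β y ,
      ≤-<-trans (less≤1 (vars σ x) (vars σ y)) (≤-<-trans (≤-trans (s≤s z≤n) 17≤V) (≤-<-trans (V≤V^ 0) (room 1 tt)))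

    store row line : Program
    store = put a I E ⨾ set 9 (var 9 ⊕ lit 1)
    row   = while (var 9 ≺ var 8) store
    line  = set 9 (lit 0) ⨾ row ⨾ set 7 (var 7 ⊕ lit 1)

    store-run : ∀ {σ q r} → q < R → r < m → At σ q r → vars σ 9 ≡ r →
                ∃[ σ′ ] Run W store σ (suc (cost I + cost E) + 4) σ′ × At σ′ q (suc r) × vars σ′ 9 ≡ suc r
    store-run {σ} {q} {r} q<R r<m α eq9 =
      _ , (put (fit β I okI) (fit β E okE) ⨾ set (fit β′ (var 9 ⊕ lit 1) tt)) ,
      record
        { represents = assign rep′ tt (subst (_≤ V) (trans (+-comm 1 r) (cong (_+ 1) (sym eq9))) (≤-trans r<m m≤V))
        ; mem≤ = mem≤′
        ; reg6 = reg6 α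
        ; reg7 = reg7 α
        ; reg8 = reg8 α
        } , trans (cong (_+ 1) eq9) (+-comm r 1)
      where
      β   = at-bounded α
      eqs = spec q r q<R r<m
      eqI : ⟦ I ⟧ σ ≡ index q r
      eqI = trans (agrees (represents α) (reg7 α) eq9 I (proj₁ (∧⁻ (admissible I) okI))) (proj₁ eqs)
      eqE : ⟦ E ⟧ σ ≡ value q r
      eqE = trans (agrees (represents α) (reg7 α) eq9 E (proj₁ (∧⁻ (admissible E) okE))) (proj₁ (proj₂ eqs))
      arrays′ : ℕ → ℕ → ℕ
      arrays′ = arrays σ [ a ↦ arrays σ a [ ⟦ I ⟧ σ ↦ ⟦ E ⟧ σ ] ]
      cells′ : ∀ b j → arrays′ b j ≡ mem q (suc r) b j
      cells′ b j with b ≡ᵇ a | cells (represents α) b j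
      ... | true  | _  = update-cong {f = arrays σ a} {g = written index value m (S a) q r} j (trans (cells (represents α) a j) (cong-app (update-same S a) j)) eqI eqE
      ... | false | eq = eq
      mem≤′ : ∀ b j → mem q (suc r) b j ≤ V
      mem≤′ b j with b ≡ᵇ a | mem≤ α b j
      ... | true  | _  = update-all (λ j → subst (_≤ V) (cong-app (update-same S a) j) (mem≤ α a j)) (proj₂ (proj₂ eqs)) j
      ... | false | le = le
      rep′ : Represents (state (vars σ) arrays′) (mem q (suc r))
      rep′ = record { low = low (represents α) ; cells = cells′ ; vars≤ = Represents.vars≤ (represents α) }
      β′ = bounded rep′ mem≤′

    rowCost lineCost : ℕ
    -- A cell costs a test (4), the store (1 and the two expressions) and an increment (4); a row
    -- adds its own test (4), the reset (2) and the increment (4).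
    rowCost = 9 + (cost I + cost E)
    lineCost = rowCost + 10

    row-run : ∀ d {σ q r} → q < R → r + d ≡ m → At σ q r → vars σ 9 ≡ r →
              ∃[ k ] ∃[ σ′ ] Run W row σ k σ′ × k ≤ rowCost * suc d × At σ′ q m
    row-run zero {σ} {r = r} q<R r+d≡m α eq9 with trans (sym (+-identityʳ r)) r+d≡m
    ... | refl = _ , _ , done (fit-less (at-bounded α) 9 8) (less-false (≤-reflexive (trans (reg8 α) (sym eq9)))) ,
      s≤s (s≤s (s≤s (s≤s z≤n))) , α
    row-run (suc d) {σ} {r = r} q<R r+d≡m α eq9
      with store-run q<R (subst (r <_) r+d≡m (m<m+n r (s≤s z≤n))) α eq9
    ... | σ′ , run , α′ , eq9′ with row-run d q<R (trans (sym (+-suc r d)) r+d≡m) α′ eq9′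
    ... | k , σ″ , run′ , k≤ , α″ =
      _ , σ″ , loop (fit-less (at-bounded α) 9 8) (λ eq → case trans (sym (less-true r<m)) eq of λ ()) run run′ ,
      subst₂ _≤_ (eq₁ (cost I) (cost E) k) (sym (*-suc rowCost (suc d))) (+-monoʳ-≤ rowCost k≤) , α″
      where
      r<m : vars σ 9 < vars σ 8
      r<m = subst₂ _<_ (sym eq9) (sym (reg8 α)) (subst (r <_) r+d≡m (m<m+n r (s≤s z≤n)))
      eq₁ : ∀ x y k → 9 + (x + y) + k ≡ suc (3 + (suc (x + y) + 4 + k))
      eq₁ = solve-∀

    lines-run : ∀ d {σ q} → q + d ≡ R → At σ q 0 →
                ∃[ k ] ∃[ σ′ ] Run W (while (var 7 ≺ var 6) line) σ k σ′ × k ≤ lineCost * suc m * suc d × At σ′ R 0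
    lines-run zero {σ} {q} q+d≡R α with trans (sym (+-identityʳ q)) q+d≡R
    ... | refl = _ , _ , done (fit-less (at-bounded α) 7 6) (less-false (≤-reflexive (trans (reg6 α) (sym (reg7 α))))) ,
      ≤-trans (≤-trans (s≤s (s≤s (s≤s (s≤s z≤n)))) (m≤m*n lineCost (suc m))) (m≤m*n (lineCost * suc m) 1) , α
    lines-run (suc d) {σ} {q} q+d≡R α
      with row-run m q<R refl α₀ refl
      where
      q<R : q < R
      q<R = subst (q <_) q+d≡R (m<m+n q (s≤s z≤n))
      α₀ : At (state (vars σ [ 9 ↦ 0 ]) (arrays σ)) q 0
      α₀ = record { represents = assign (represents α) tt z≤n ; mem≤ = mem≤ α
                  ; reg6 = reg6 α ; reg7 = reg7 α ; reg8 = reg8 α }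
    ... | k , σ₁ , run , k≤ , α₁
      with lines-run d (trans (sym (+-suc q d)) q+d≡R) α₂
      where
      q<R : q < R
      q<R = subst (q <_) q+d≡R (m<m+n q (s≤s z≤n))
      eq7 : vars σ₁ 7 + 1 ≡ suc q
      eq7 = trans (cong (_+ 1) (reg7 α₁)) (+-comm q 1)
      α₂ : At (state (vars σ₁ [ 7 ↦ vars σ₁ 7 + 1 ]) (arrays σ₁)) (suc q) 0
      α₂ = record { represents = assign (represents α₁) tt (subst (_≤ V) (sym eq7) (≤-trans q<R R≤V))
                  ; mem≤ = mem≤ α₁ ; reg6 = reg6 α₁ ; reg7 = eq7 ; reg8 = reg8 α₁ }
    ... | k′ , σ₃ , run′ , k′≤ , α₃ =
      _ , σ₃ ,
      loop (fit-less (at-bounded α) 7 6) (λ eq → case trans (sym (less-true 7<6)) eq of λ ())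
        (set (fit (at-bounded α) (lit 0) tt) ⨾ run ⨾ set (fit (at-bounded α₁) (var 7 ⊕ lit 1) tt)) run′ ,
      (begin
        suc (3 + (2 + (k + 4) + k′))                      ≡⟨ eq₁ k k′ ⟩
        k + 10 + k′                                       ≤⟨ +-mono-≤ (+-mono-≤ k≤ (m≤m*n 10 (suc m))) k′≤ ⟩
        rowCost * suc m + 10 * suc m + lineCost * suc m * suc d ≡⟨ cong (_+ lineCost * suc m * suc d) (sym (*-distribʳ-+ (suc m) rowCost 10)) ⟩
        lineCost * suc m + lineCost * suc m * suc d       ≡⟨ sym (*-suc (lineCost * suc m) (suc d)) ⟩
        lineCost * suc m * suc (suc d)                    ∎) , α₃
      where
      open ≤-Reasoning
      7<6 : vars σ 7 < vars σ 6
      7<6 = subst₂ _<_ (sym (reg7 α)) (sym (reg6 α)) (subst (q <_) q+d≡R (m<m+n q (s≤s z≤n)))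
      eq₁ : ∀ k l → suc (3 + (2 + (k + 4) + l)) ≡ k + 10 + l
      eq₁ = solve-∀

  fill-exec : ∀ {S N} (a R m : ℕ) (Rᵉ mᵉ I E : Expr) (index value : ℕ → ℕ → ℕ) →
    T (fitting Rᵉ ∧ (fitting mᵉ ∧ (fitting I ∧ fitting E))) → suc R * suc m ≤ N → N ≤ V →
    (∀ q r → ⟦ Rᵉ ⟧ (state (counting ρ q r) S) ≡ R × ⟦ mᵉ ⟧ (state (counting ρ q r) S) ≡ m) →
    (∀ q r → q < R → r < m →
      let σ = state (counting ρ q r) (S [ a ↦ written index value m (S a) q r ])
      in ⟦ I ⟧ σ ≡ index q r × ⟦ E ⟧ σ ≡ value q r × value q r ≤ V) →
    Exec N (fill a Rᵉ mᵉ I E) S (S [ a ↦ rows index value m (S a) R ])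
  fill-exec {S} {N} a R m Rᵉ mᵉ I E index value ok RM≤N N≤V sizes spec = exec λ S≤ → let open Go S≤ in final≤ , run
    where
    module Go (S≤ : ∀ a j → S a j ≤ V) where
      open Filling {S} a {R} {m} I E index value
        (proj₁ (∧⁻ (fitting I) (proj₂ (∧⁻ (fitting mᵉ) (proj₂ (∧⁻ (fitting Rᵉ) ok))))))
        (proj₂ (∧⁻ (fitting I) (proj₂ (∧⁻ (fitting mᵉ) (proj₂ (∧⁻ (fitting Rᵉ) ok))))))
        (≤-trans (n≤1+n R) (≤-trans (m≤m*n (suc R) (suc m)) (≤-trans RM≤N N≤V)))
        (≤-trans (n≤1+n m) (≤-trans (m≤n*m (suc m) (suc R)) (≤-trans RM≤N N≤V)))
        spec
      okR = proj₁ (∧⁻ (fitting Rᵉ) ok)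
      okm = proj₁ (∧⁻ (fitting mᵉ) (proj₂ (∧⁻ (fitting Rᵉ) ok)))
      R≤V = ≤-trans (n≤1+n R) (≤-trans (m≤m*n (suc R) (suc m)) (≤-trans RM≤N N≤V))
      m≤V = ≤-trans (n≤1+n m) (≤-trans (m≤n*m (suc m) (suc R)) (≤-trans RM≤N N≤V))
      final≤ : ∀ b j → (S [ a ↦ rows index value m (S a) R ]) b j ≤ V
      final≤ b j with b ≡ᵇ a
      ... | true  = rows≤ R (S≤ a) (λ q r q<R r<m → proj₂ (proj₂ (spec q r q<R r<m))) j
      ... | false = S≤ b j
      unchanged : ∀ b j → S b j ≡ (S [ a ↦ S a ]) b j
      unchanged b j with b ≡ᵇ a in eq
      ... | true  = cong (λ b → S b j) (≡ᵇ⇒≡ b a (subst T (sym eq) tt))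
      ... | false = refl
      run : ∀ σ → Represents σ S → ∃[ k ] ∃[ σ′ ] Run W (fill a Rᵉ mᵉ I E) σ k σ′ ×
            k ≤ charge (fill a Rᵉ mᵉ I E) * N × Represents σ′ (S [ a ↦ rows index value m (S a) R ])
      run σ rep =
        let (k , σ′ , r , k≤ , α′) = lines-run R refl α
        in _ , σ′ , (set (fit (bounded rep S≤) Rᵉ okR) ⨾ set (fit (bounded rep₁ S≤) mᵉ okm) ⨾
                     set (fit (bounded rep₂ S≤) (lit 0) tt) ⨾ r) ,
           (begin
             suc (cost Rᵉ) + (suc (cost mᵉ) + (2 + k))             ≡⟨ eq₁ (cost Rᵉ) (cost mᵉ) k ⟩
             4 + (cost Rᵉ + cost mᵉ) + k                           ≤⟨ +-mono-≤ (m≤m*n (4 + (cost Rᵉ + cost mᵉ)) (suc R * suc m)) k≤ ⟩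
             (4 + (cost Rᵉ + cost mᵉ)) * (suc R * suc m) + lineCost * suc m * suc R
               ≡⟨ eq₂ (cost Rᵉ) (cost mᵉ) (cost I) (cost E) (suc R) (suc m) ⟩
             fillCost * (suc R * suc m)        ≤⟨ *-monoʳ-≤ fillCost RM≤N ⟩
             fillCost * N                      ≡⟨ cong (_* N) (sym (charge-fill a Rᵉ mᵉ I E)) ⟩
             charge (fill a Rᵉ mᵉ I E) * N     ∎) ,
           At.represents α′
        where
        open ≤-Reasoning
        fillCost = 23 + (cost Rᵉ + cost mᵉ + (cost I + cost E))
        eqR = trans (agrees rep refl refl Rᵉ (proj₁ (∧⁻ (admissible Rᵉ) okR))) (proj₁ (sizes _ _))
        rep₁ = assign {x = 6} {v = ⟦ Rᵉ ⟧ σ} rep tt (subst (_≤ V) (sym eqR) R≤V)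
        σ₁ = state (vars σ [ 6 ↦ ⟦ Rᵉ ⟧ σ ]) (arrays σ)
        eqm = trans (agrees rep₁ refl refl mᵉ (proj₁ (∧⁻ (admissible mᵉ) okm))) (proj₂ (sizes _ _))
        rep₂ = assign {x = 8} {v = ⟦ mᵉ ⟧ σ₁} rep₁ tt (subst (_≤ V) (sym eqm) m≤V)
        rep₃ = assign {x = 7} {v = 0} rep₂ tt z≤n
        α : At (state (((vars σ [ 6 ↦ ⟦ Rᵉ ⟧ σ ]) [ 8 ↦ ⟦ mᵉ ⟧ σ₁ ]) [ 7 ↦ 0 ]) (arrays σ)) 0 0
        α = record
          { represents = record { low = low rep₃ ; cells = λ b j → trans (cells rep b j) (unchanged b j)
                                ; vars≤ = Represents.vars≤ rep₃ }
          ; mem≤ = λ b j → subst (_≤ V) (unchanged b j) (S≤ b j)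
          ; reg6 = eqR ; reg7 = refl ; reg8 = eqm }
        eq₁ : ∀ x y k → suc x + (suc y + (2 + k)) ≡ 4 + (x + y) + k
        eq₁ = solve-∀
        eq₂ : ∀ x y i e R m → (4 + (x + y)) * (R * m) + (9 + (i + e) + 10) * m * R ≡ (23 + (x + y + (i + e))) * (R * m)
        eq₂ = solve-∀

  run-output : ∀ {N P S S′} → 1 ≤ N → Exec N P S S′ → (∀ a j → S a j ≤ V) → ∀ x e → T (fitting e) →
    ∀ {σ} → Represents σ S → ∃[ k ] ∃[ σ′ ] Run W (P ⨾ set x e) σ k σ′ × k ≤ charge (P ⨾ set x e) * N ×
      (∃[ q ] ∃[ r ] vars σ′ x ≡ ⟦ e ⟧ (state (counting ρ q r) S′)) ×
      (∀ a j → arrays σ′ a j ≡ S′ a j × arrays σ′ a j ≤ V)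
  run-output {N} {P} 1≤N p S≤ x e ok {σ} rep with runs p S≤
  ... | S′≤ , run with run σ rep
  ... | k , σ′ , r , k≤ , rep′ =
    k + suc (cost e) , _ , (r ⨾ set (fit (bounded rep′ S′≤) e ok)) ,
    subst (k + suc (cost e) ≤_) (sym (*-distribʳ-+ N (charge P) (suc (cost e))))
      (+-mono-≤ k≤ (m≤m*n (suc (cost e)) N {{>-nonZero 1≤N}})) ,
    (vars σ′ 7 , vars σ′ 9 , trans (update-same (vars σ′) x)
      (agrees rep′ refl refl e (proj₁ (∧⁻ (admissible e) ok)))) ,
    (λ a j → Represents.cells rep′ a j , subst (_≤ V) (sym (Represents.cells rep′ a j)) (S′≤ a j))

-- Contents of a filled array

scatter-last : ∀ (index value : ℕ → ℕ) r init j →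
  (∃[ r′ ] r′ < r × index r′ ≡ j × scatter index value r init j ≡ value r′ ×
     (∀ i → i < r → index i ≡ j → i ≤ r′)) ⊎
  ((∀ i → i < r → index i ≢ j) × scatter index value r init j ≡ init j)
scatter-last index value zero init j = inj₂ ((λ _ ()) , refl)
scatter-last index value (suc r) init j with index r ≟ j
... | yes refl = inj₁ (r , ≤-refl , refl , update-same (scatter index value r init) j , λ _ i≤r _ → ≤-pred i≤r)
... | no  r↛j with scatter-last index value r init j
... | inj₁ (r′ , r′<r , eq , val , last) =
  inj₁ (r′ , m≤n⇒m≤1+n r′<r , eq , trans (update-other (scatter index value r init) (r↛j ∘ sym)) val , λ i i≤r eq′ →
    case m≤n⇒m<n∨m≡n (≤-pred i≤r) of λ { (inj₁ i<r) → last i i<r eq′ ; (inj₂ refl) → contradiction eq′ r↛j })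
... | inj₂ (none , val) = inj₂ ((λ i i≤r eq′ →
    case m≤n⇒m<n∨m≡n (≤-pred i≤r) of λ { (inj₁ i<r) → none i i<r eq′ ; (inj₂ refl) → contradiction eq′ r↛j }) ,
  trans (update-other (scatter index value r init) (r↛j ∘ sym)) val)

-- Colliding writes are wanted: the last one in the order of the loops prevails. Lists and pivot
-- rows are stored in this way without computing where a run of equal indices ends.
rows-last : ∀ (index value : ℕ → ℕ → ℕ) m init q j →
  (∃[ q′ ] ∃[ r′ ] q′ < q × r′ < m × index q′ r′ ≡ j × rows index value m init q j ≡ value q′ r′ ×
     (∀ p i → p < q → i < m → index p i ≡ j → p < q′ ⊎ p ≡ q′ × i ≤ r′)) ⊎
  ((∀ p i → p < q → i < m → index p i ≢ j) × rows index value m init q j ≡ init j)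
rows-last index value m init zero j = inj₂ ((λ _ _ ()) , refl)
rows-last index value m init (suc q) j with scatter-last (index q) (value q) m (rows index value m init q) j
... | inj₁ (r′ , r′<m , eq , val , last) =
  inj₁ (q , r′ , ≤-refl , r′<m , eq , val , λ p i p≤q i<m eq′ →
    case m≤n⇒m<n∨m≡n (≤-pred p≤q) of λ { (inj₁ p<q) → inj₁ p<q ; (inj₂ refl) → inj₂ (refl , last i i<m eq′) })
... | inj₂ (none , val) with rows-last index value m init q j
... | inj₁ (q′ , r′ , q′<q , r′<m , eq , val′ , last) =
  inj₁ (q′ , r′ , m≤n⇒m≤1+n q′<q , r′<m , eq , trans val val′ , λ p i p≤q i<m eq′ →
    case m≤n⇒m<n∨m≡n (≤-pred p≤q) of λ { (inj₁ p<q) → last p i p<q i<m eq′ ; (inj₂ refl) → contradiction eq′ (none i i<m) })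
... | inj₂ (none′ , val′) = inj₂ ((λ p i p≤q i<m eq′ →
    case m≤n⇒m<n∨m≡n (≤-pred p≤q) of λ { (inj₁ p<q) → none′ p i p<q i<m eq′ ; (inj₂ refl) → none i i<m eq′ }) ,
  trans val val′)

rowMajor : ℕ → ℕ → ℕ → ℕ
rowMajor m q r = q * m + r

rowMajor-< : ∀ {m q q′ r} → q < q′ → r < m → ∀ r′ → rowMajor m q r < rowMajor m q′ r′
rowMajor-< {m} {q} {q′} {r} q<q′ r<m r′ = begin-strict
  q * m + r     <⟨ +-monoʳ-< (q * m) r<m ⟩
  q * m + m     ≡⟨ +-comm (q * m) m ⟩
  suc q * m     ≤⟨ *-monoˡ-≤ m q<q′ ⟩
  q′ * m        ≤⟨ m≤m+n (q′ * m) r′ ⟩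
  q′ * m + r′   ∎
  where open ≤-Reasoning

rowMajor-injective : ∀ {m q q′ r r′} → r < m → r′ < m → rowMajor m q r ≡ rowMajor m q′ r′ → q ≡ q′ × r ≡ r′
rowMajor-injective {m} {q} {q′} {r} {r′} r<m r′<m eq with <-cmp q q′
... | tri< q<q′ _ _ = contradiction eq (<⇒≢ (rowMajor-< q<q′ r<m r′))
... | tri> _ _ q′<q = contradiction (sym eq) (<⇒≢ (rowMajor-< q′<q r′<m r))
... | tri≈ _ refl _ = refl , +-cancelˡ-≡ (q * m) r r′ eq

written-row : ∀ value m init q r {r′} → r′ < r → r ≤ m →
              written (rowMajor m) value m init q r (rowMajor m q r′) ≡ value q r′
written-row value m init q r {r′} r′<r r≤m
  with scatter-last (rowMajor m q) (value q) r (rows (rowMajor m) value m init q) (rowMajor m q r′)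
... | inj₁ (r″ , r″<r , eq , val , _) =
  trans val (cong (value q) (proj₂ (rowMajor-injective {m} {q} {q} (≤-trans r″<r r≤m) (≤-trans r′<r r≤m) eq)))
... | inj₂ (none , _) = contradiction refl (none r′ r′<r)

written-rows : ∀ value m init q r {q′ r′} → q′ < q → r′ < m → r ≤ m →
               written (rowMajor m) value m init q r (rowMajor m q′ r′) ≡ value q′ r′
written-rows value m init q r {q′} {r′} q′<q r′<m r≤m
  with scatter-last (rowMajor m q) (value q) r (rows (rowMajor m) value m init q) (rowMajor m q′ r′)
... | inj₁ (r″ , r″<r , eq , val , _) =
  contradiction (sym (proj₁ (rowMajor-injective {m} {q} {q′} (≤-trans r″<r r≤m) r′<m eq))) (<⇒≢ q′<q)
... | inj₂ (_ , val) with rows-last (rowMajor m) value m init q (rowMajor m q′ r′)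
... | inj₂ (none , _) = contradiction refl (none q′ r′ q′<q r′<m)
... | inj₁ (q″ , r″ , q″<q , r″<m , eq , val′ , _) =
  let (eq₁ , eq₂) = rowMajor-injective {q = q″} {q′} r″<m r′<m eq in trans val (trans val′ (cong₂ value eq₁ eq₂))

abstract
  stored : (ℕ → ℕ → ℕ) → ℕ → ℕ → ℕ → ℕ
  stored value m R = rows (rowMajor m) value m (λ _ → 0) R

  stored-rows : ∀ {value m R} → stored value m R ≡ rows (rowMajor m) value m (λ _ → 0) R
  stored-rows = refl

  stored-at : ∀ {value m R} q r → q < R → r < m → stored value m R (q * m + r) ≡ value q r
  stored-at {value} {m} {R} q r q<R r<m = written-rows value m (λ _ → 0) R 0 q<R r<m z≤n

  scattered : (ℕ → ℕ → ℕ) → (ℕ → ℕ → ℕ) → ℕ → ℕ → ℕ → ℕ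
  scattered index value m R = rows index value m (λ _ → 0) R

  scattered-rows : ∀ {index value m R} → scattered index value m R ≡ rows index value m (λ _ → 0) R
  scattered-rows = refl

scattered-at : ∀ {index value m R} q r → q < R → r < m →
  ∃[ q′ ] ∃[ r′ ] q′ < R × r′ < m × index q′ r′ ≡ index q r × scattered index value m R (index q r) ≡ value q′ r′ ×
    (∀ p i → p < R → i < m → index p i ≡ index q r → p < q′ ⊎ p ≡ q′ × i ≤ r′)
scattered-at {index} {value} {m} {R} q r q<R r<m
  with rows-last index value m (λ _ → 0) R (index q r)
... | inj₂ (none , _) = contradiction refl (none q r q<R r<m)
... | inj₁ (q′ , r′ , q′<R , r′<m , eq , val , last) =
  q′ , r′ , q′<R , r′<m , eq , trans (cong-app scattered-rows (index q r)) val , last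

stored-at₁ : ∀ {value : ℕ → ℕ} {m} r → r < m → stored (λ _ → value) m 1 r ≡ value r
stored-at₁ r r<m = stored-at 0 r ≤-refl r<m

-- Branch-free expressions and the fills built from them

sel : ℕ → ℕ → ℕ → ℕ
sel c a b = c * a + (1 ∸ c) * b

-- For a bit `c` this is a conditional, so each table entry is a single expression. Both branches
-- are evaluated; as operations and reads are total, the branch not selected does no harm.
ite : Expr → Expr → Expr → Expr
ite c a b = c ⊗ a ⊕ (lit 1 ⊖ c) ⊗ b

sel-1 : ∀ {c} a b → c ≡ 1 → sel c a b ≡ a
sel-1 a b refl = trans (+-identityʳ (a + 0)) (+-identityʳ a)

sel-0 : ∀ {c} a b → c ≡ 0 → sel c a b ≡ b
sel-0 a b refl = +-identityʳ b

sel≤ : ∀ c {a b V} → c ≤ 1 → a ≤ V → b ≤ V → sel c a b ≤ V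
sel≤ zero          {a} {b} _ a≤ b≤ = subst (_≤ _) (sym (sel-0 a b refl)) b≤
sel≤ (suc zero)    {a} {b} _ a≤ b≤ = subst (_≤ _) (sym (sel-1 a b refl)) a≤
sel≤ (suc (suc _)) (s≤s ())

bit*≤ : ∀ c {a V} → c ≤ 1 → a ≤ V → c * a ≤ V
bit*≤ c {a} c≤1 a≤ = ≤-trans (*-monoˡ-≤ a c≤1) (subst (_≤ _) (sym (+-identityʳ a)) a≤)

posᵉ : Expr → Expr
posᵉ e = lit 0 ≺ e

pos : ℕ → ℕ
pos x = apply less 0 x

fill₁ : ℕ → Expr → Expr → Program
fill₁ a m E = fill a (lit 1) m (var 9) E

fill₂ : ℕ → Expr → Expr → Expr → Program
fill₂ a R m E = fill a R m (var 7 ⊗ m ⊕ var 9) E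

module Fills {V W : ℕ} (17≤V : 17 ≤ V) (room : ∀ k → T (k <ᵇ 4096) → V ^ k < W)
             (ρ : ℕ → ℕ) {N : ℕ} (N≤V : N ≤ V) where
  open Machine 17≤V room ρ

  exec₂ : ∀ {S} (a R m : ℕ) (Rᵉ mᵉ E : Expr) (value : ℕ → ℕ → ℕ) →
    T (fitting Rᵉ ∧ (fitting mᵉ ∧ (fitting (var 7 ⊗ mᵉ ⊕ var 9) ∧ fitting E))) → suc R * suc m ≤ N →
    (∀ q r → ⟦ Rᵉ ⟧ (state (counting ρ q r) S) ≡ R) →
    (∀ q r X → ⟦ mᵉ ⟧ (state (counting ρ q r) (S [ a ↦ X ])) ≡ m) →
    S a ≡ (λ _ → 0) →
    (∀ q r X → q < R → r < m →
      (∀ p i → p < q → i < m → X (p * m + i) ≡ value p i) →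
      (∀ i → i < r → X (q * m + i) ≡ value q i) →
      ⟦ E ⟧ (state (counting ρ q r) (S [ a ↦ X ])) ≡ value q r × value q r ≤ V) →
    Exec N (fill₂ a Rᵉ mᵉ E) S (S [ a ↦ stored value m R ])
  exec₂ {S} a R m Rᵉ mᵉ E value ok fits Rᵉ≡ mᵉ≡ empty spec =
    subst (λ X → Exec N _ S (S [ a ↦ X ])) (sym (trans stored-rows (cong (λ init → rows (rowMajor m) value m init R) (sym empty))))
      (fill-exec a R m Rᵉ mᵉ (var 7 ⊗ mᵉ ⊕ var 9) E (rowMajor m) value ok fits N≤V
        (λ q r → Rᵉ≡ q r , trans (agree-unchanged q r) (mᵉ≡ q r (S a)))
        (λ q r q<R r<m → cong (λ m → q * m + r) (mᵉ≡ q r _) ,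
          spec q r _ q<R r<m (λ p i p<q i<m → written-rows value m (S a) q r p<q i<m (<⇒≤ r<m))
                             (λ i i<r → written-row value m (S a) q r i<r (<⇒≤ r<m))))
    where
    same : ∀ b j → S b j ≡ (S [ a ↦ S a ]) b j
    same b j with b ≡ᵇ a in eq
    ... | true  = cong (λ b → S b j) (≡ᵇ⇒≡ b a (subst T (sym eq) tt))
    ... | false = refl
    evaluates : ∀ {ρ′} e → ⟦ e ⟧ (state ρ′ S) ≡ ⟦ e ⟧ (state ρ′ (S [ a ↦ S a ]))
    evaluates (lit k)      = refl
    evaluates (var x)      = refl
    evaluates (get b i)    = trans (same b _) (cong ((S [ a ↦ S a ]) b) (evaluates i))
    evaluates (bin o e e′) = cong₂ (apply o) (evaluates e) (evaluates e′)
    agree-unchanged : ∀ q r → ⟦ mᵉ ⟧ (state (counting ρ q r) S) ≡ ⟦ mᵉ ⟧ (state (counting ρ q r) (S [ a ↦ S a ]))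
    agree-unchanged q r = evaluates mᵉ

  exec₁ : ∀ {S} (a m : ℕ) (mᵉ E : Expr) (value : ℕ → ℕ) →
    T (fitting mᵉ ∧ fitting E) → 2 * suc m ≤ N →
    (∀ q r → ⟦ mᵉ ⟧ (state (counting ρ q r) S) ≡ m) →
    S a ≡ (λ _ → 0) →
    (∀ r X → r < m → (∀ i → i < r → X i ≡ value i) →
      ⟦ E ⟧ (state (counting ρ 0 r) (S [ a ↦ X ])) ≡ value r × value r ≤ V) →
    Exec N (fill₁ a mᵉ E) S (S [ a ↦ stored (λ _ → value) m 1 ])
  exec₁ {S} a m mᵉ E value ok fits mᵉ≡ empty spec =
    subst (λ X → Exec N _ S (S [ a ↦ X ])) (sym (trans stored-rows (cong (λ init → rows (rowMajor m) (λ _ → value) m init 1) (sym empty))))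
      (fill-exec a 1 m (lit 1) mᵉ (var 9) E (rowMajor m) (λ _ → value) ok fits N≤V
        (λ q r → refl , mᵉ≡ q r)
        (λ { zero r _ r<m → refl , spec r _ r<m (λ i i<r → written-row (λ _ → value) m (S a) 0 r i<r (<⇒≤ r<m))
           ; (suc _) r (s≤s ()) _ }))

  exec-scatter : ∀ {S} (a R m : ℕ) (Rᵉ mᵉ I E : Expr) (index value : ℕ → ℕ → ℕ) →
    T (fitting Rᵉ ∧ (fitting mᵉ ∧ (fitting I ∧ fitting E))) → suc R * suc m ≤ N →
    (∀ q r → ⟦ Rᵉ ⟧ (state (counting ρ q r) S) ≡ R × ⟦ mᵉ ⟧ (state (counting ρ q r) S) ≡ m) →
    S a ≡ (λ _ → 0) →
    (∀ q r X → q < R → r < m →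
      let σ = state (counting ρ q r) (S [ a ↦ X ])
      in ⟦ I ⟧ σ ≡ index q r × ⟦ E ⟧ σ ≡ value q r × value q r ≤ V) →
    Exec N (fill a Rᵉ mᵉ I E) S (S [ a ↦ scattered index value m R ])
  exec-scatter {S} a R m Rᵉ mᵉ I E index value ok fits sizes empty spec =
    subst (λ X → Exec N _ S (S [ a ↦ X ])) (sym (trans scattered-rows (cong (λ init → rows index value m init R) (sym empty))))
      (fill-exec a R m Rᵉ mᵉ I E index value ok fits N≤V sizes (λ q r q<R r<m → spec q r _ q<R r<m))

-- The contents of the arrays computed by the build program

n<2^n : ∀ n → n < 2 ^ n
n<2^n zero    = s≤s z≤n
n<2^n (suc n) = begin
  suc (suc n)              ≤⟨ s≤s (n<2^n n) ⟩
  1 + 2 ^ n                ≤⟨ +-monoˡ-≤ (2 ^ n) (m^n>0 2 n) ⟩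
  2 ^ n + 2 ^ n            ≡⟨ cong (2 ^ n +_) (sym (+-identityʳ (2 ^ n))) ⟩
  2 ^ suc n                ∎
  where open ≤-Reasoning

log≤ : ∀ n → ⌊log₂ n ⌋ ≤ n
log≤ n = subst (⌊log₂ n ⌋ ≤_) (⌊log₂[2^n]⌋≡n n) (⌊log₂⌋-mono-≤ (<⇒≤ (n<2^n n)))

n<2^[1+log] : ∀ n → n < 2 ^ suc ⌊log₂ n ⌋
n<2^[1+log] n with ≤-<-connex (2 ^ suc ⌊log₂ n ⌋) n
... | inj₁ 2^≤n = contradiction (subst (_≤ ⌊log₂ n ⌋) (⌊log₂[2^n]⌋≡n _) (⌊log₂⌋-mono-≤ 2^≤n)) 1+n≰n
... | inj₂ n<2^ = n<2^

half : ∀ n → ⌊ n /2⌋ ≡ n / 2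
half zero          = refl
half (suc zero)    = refl
half (suc (suc n)) = trans (cong suc (half n)) (sym (m/n≡1+[m∸n]/n {2+ n} {2} (s≤s (s≤s z≤n))))

-- The halving recurrence that fills the table of logarithms; its first factor vanishes for `n ≤ 1`,
-- where the logarithm is 0.
log-step : ∀ n → apply less 0 (n / 2) * suc ⌊log₂ n / 2 ⌋ ≡ ⌊log₂ n ⌋
log-step zero          = refl
log-step (suc zero)    = refl
log-step n@(suc (suc m)) = begin
  apply less 0 (n / 2) * suc ⌊log₂ n / 2 ⌋   ≡⟨ cong (λ h → apply less 0 h * suc ⌊log₂ h ⌋) (sym (half n)) ⟩
  suc ⌊log₂ ⌊ n /2⌋ ⌋ + 0                    ≡⟨ +-identityʳ _ ⟩
  suc ⌊log₂ ⌊ n /2⌋ ⌋                        ≡⟨ cong suc (⌊log₂⌊n/2⌋⌋≡⌊log₂n⌋∸1 n) ⟩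
  suc (⌊log₂ n ⌋ ∸ 1)                        ≡⟨ m+[n∸m]≡n {1} (⌊log₂⌋-mono-≤ {2} {n} (s≤s (s≤s z≤n))) ⟩
  ⌊log₂ n ⌋                                  ∎
  where open ≡-Reasoning

-- Recognises the code 0 of infinity. Added to a comparison under `pos`, it makes an infinite bound
-- count as exceeded by nothing.
cap : ℕ → ℕ
cap x = apply equal x 0

-- par, w and C are the given arrays; ancestors are named by successors of
-- vertices, and 0 stands for none.
module Tables (n s : ℕ) (par w C : ℕ → ℕ) where

  n₁ : ℕ
  n₁ = n + 1

  anc len cnt : ℕ → ℕ → ℕ
  anc zero    t = t + 1
  anc (suc j) t = pos (anc j t) * par (anc j t ∸ 1)

  len zero    t = 0
  len (suc j) t = len j t + pos (anc j t) * w (anc j t ∸ 1)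

  cnt zero    t = 0
  cnt (suc j) t = cnt j t + pos (anc (suc j) t)

  -- Tree paths have fewer than `n` edges, so the counts and sums are stable after `n` steps. A
  -- vertex is in the tree if it is `s` or has a parent; for all others `dst` is the code of
  -- infinity.
  dep dst : ℕ → ℕ
  dep t = cnt n t
  dst t = pos (apply equal t s + par t) * suc (len n t)

  sqrt : ℕ → ℕ
  sqrt zero    = 0
  sqrt (suc i) = sqrt i + apply less ((sqrt i + 1) * (sqrt i + 1)) (suc i + 1)

  L : ℕ
  L = sqrt n

  -- Serves twice: `cum r n` is the size of a residue class, and `cum r* x` the rank of a pivot `x`,
  -- hence its row in the pivot table. Vertices outside the tree have depth 0 and are counted along.
  cum : ℕ → ℕ → ℕ
  cum r zero    = 0
  cum r (suc t) = cum r t + apply equal (apply mod (dep t) L) r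

  best : ℕ → ℕ
  best zero    = 0
  best (suc r) = sel (apply less (cum r n) (cum (best r) n)) r (best r)

  r* : ℕ
  r* = best L

  -- `hop` is the number of levels up to the next depth congruent to `r*`; adding `L` keeps the
  -- subtraction from being truncated. If it exceeds the depth, there is no such ancestor, and every
  -- failure is answered from the tail tables.
  hop px off row : ℕ → ℕ
  hop t = apply mod (dep t + L ∸ r*) L
  px t  = anc (hop t) t
  off t = len (hop t) t
  row t = cum r* (px t ∸ 1)

  -- Column `i` of the last three is the failure at depth `i`, so that a prefix minimum runs
  -- downwards from the root. The first factor of `rel` says that the failure lies strictly above
  -- the pivot.
  tid tv cv cx rel : ℕ → ℕ → ℕ
  tid t j = anc j t
  tv t j  = C (n * t + (anc j t ∸ 1))
  cv t i  = C (n * t + (anc (dep t ∸ i) t ∸ 1))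
  cx t i  = C (n * (px t ∸ 1) + (anc (dep t ∸ i) t ∸ 1))
  rel t i = apply less (i + hop t) (dep t) *
            (pos (cv t i) * pos (cap (cx t i) + apply less (cv t i) (cx t i + off t)))

  -- The least value of a relevant failure above depth i, and the number of
  -- its changes up to i; the value is 0 as long as there is none.
  ma ca better : ℕ → ℕ → ℕ
  better t i = pos (cap (ma t i) + apply less (cv t i) (ma t i))
  ma t zero    = 0
  ma t (suc i) = sel (rel t i * better t i) (cv t i) (ma t i)

  ca t zero    = 0
  ca t (suc i) = ca t i + (1 ∸ apply equal (ma t i) (ma t (suc i)))

  -- With every list padded to the longest, the address of a list is a product and needs no table of
  -- offsets.
  km : ℕ → ℕ
  km zero    = 0
  km (suc t) = sel (apply less (km t) (ca t n)) (ca t n) (km t)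

  K₁ : ℕ
  K₁ = km n + 1

  pivots : ℕ
  pivots = cum r* n

  -- The sum bounds the index range of each table; all of them are padded to this length and
  -- interleaved.
  size : ℕ
  size = n + n * L + pivots * n + n * K₁

  module Bounds (1≤n : 1 ≤ n) {M : ℕ} (par≤ : ∀ v → par v ≤ n) (w≤ : ∀ v → w v ≤ M)
                (C≤ : ∀ i → C i ≤ suc (n * M)) where

    anc≤ : ∀ j {t} → t < n → anc j t ≤ n
    anc≤ zero    {t} t<n = subst (_≤ n) (+-comm 1 t) t<n
    anc≤ (suc j) t<n = bit*≤ (pos (anc j _)) (less≤1 0 (anc j _)) (par≤ (anc j _ ∸ 1))

    anc-1< : ∀ j {t} → t < n → anc j t ∸ 1 < n
    anc-1< j {t} t<n with anc j t | anc≤ j t<n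
    ... | zero  | _ = 1≤n
    ... | suc _ | p = p

    len≤ : ∀ j t → len j t ≤ j * M
    len≤ zero    t = z≤n
    len≤ (suc j) t = subst (len (suc j) t ≤_) (+-comm (j * M) M)
      (+-mono-≤ (len≤ j t) (bit*≤ (pos (anc j t)) (less≤1 0 (anc j t)) (w≤ (anc j t ∸ 1))))

    cnt≤ : ∀ j t → cnt j t ≤ j
    cnt≤ zero    t = z≤n
    cnt≤ (suc j) t = subst (cnt (suc j) t ≤_) (+-comm j 1) (+-mono-≤ (cnt≤ j t) (less≤1 0 (anc (suc j) t)))

    dep≤ : ∀ t → dep t ≤ n
    dep≤ = cnt≤ n

    dst≤ : ∀ t → dst t ≤ suc (n * M)
    dst≤ t = bit*≤ (pos (apply equal t s + par t)) (less≤1 0 (apply equal t s + par t)) (s≤s (len≤ n t))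

    sqrt≤ : ∀ i → sqrt i ≤ i
    sqrt≤ zero    = z≤n
    sqrt≤ (suc i) = subst (sqrt (suc i) ≤_) (+-comm i 1) (+-mono-≤ (sqrt≤ i) (less≤1 ((sqrt i + 1) * (sqrt i + 1)) (suc i + 1)))

    sqrt-square : ∀ i → sqrt i * sqrt i ≤ i
    sqrt-square zero    = z≤n
    sqrt-square (suc i) with (sqrt i + 1) * (sqrt i + 1) <? suc i + 1
    ... | yes p = subst (λ b → (sqrt i + b) * (sqrt i + b) ≤ suc i) (sym (less-true p))
                    (≤-pred (subst ((sqrt i + 1) * (sqrt i + 1) <_) (+-comm (suc i) 1) p))
    ... | no ¬p = subst (λ b → (sqrt i + b) * (sqrt i + b) ≤ suc i) (sym (less-false (≮⇒≥ ¬p)))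
                    (subst (λ x → x * x ≤ suc i) (sym (+-identityʳ (sqrt i))) (m≤n⇒m≤1+n (sqrt-square i)))

    sqrt-next : ∀ i → i < (sqrt i + 1) * (sqrt i + 1)
    sqrt-next zero    = s≤s z≤n
    sqrt-next (suc i) with (sqrt i + 1) * (sqrt i + 1) <? suc i + 1
    ... | yes p = subst (λ b → suc i < (sqrt i + b + 1) * (sqrt i + b + 1)) (sym (less-true p))
                    (≤-trans (s≤s (sqrt-next i)) (subst (_≤ (sqrt i + 1 + 1) * (sqrt i + 1 + 1)) (+-comm _ 1) (step² (sqrt i + 1))))
      where
      step² : ∀ x → x * x + 1 ≤ (x + 1) * (x + 1)
      step² x = subst (x * x + 1 ≤_) (eq x) (m≤m+n (x * x + 1) (x + x))
        where
        eq : ∀ x → x * x + 1 + (x + x) ≡ (x + 1) * (x + 1)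
        eq = solve-∀
    ... | no ¬p = subst (λ b → suc i < (sqrt i + b + 1) * (sqrt i + b + 1)) (sym (less-false (≮⇒≥ ¬p)))
                    (subst (λ x → suc i < (x + 1) * (x + 1)) (sym (+-identityʳ (sqrt i)))
                      (subst (_≤ (sqrt i + 1) * (sqrt i + 1)) (+-comm (suc i) 1) (≮⇒≥ ¬p)))

    L≤n : L ≤ n
    L≤n = sqrt≤ n

    1≤L : 1 ≤ L
    1≤L with L in eq | sqrt-next n
    ... | zero  | n<1 = contradiction 1≤n (<⇒≱ n<1)
    ... | suc _ | _   = s≤s z≤n

    cum≤ : ∀ r t → cum r t ≤ t
    cum≤ r zero    = z≤n
    cum≤ r (suc t) = subst (cum r (suc t) ≤_) (+-comm t 1) (+-mono-≤ (cum≤ r t) (equal≤1 (apply mod (dep t) L) r))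

    best≤ : ∀ r → best r ≤ r
    best≤ zero    = z≤n
    best≤ (suc r) = sel≤ (apply less (cum r n) (cum (best r) n)) (less≤1 (cum r n) (cum (best r) n)) (n≤1+n r) (m≤n⇒m≤1+n (best≤ r))

    best< : ∀ {r} → 1 ≤ r → best r < r
    best< {suc r} _ = s≤s (sel≤ (apply less (cum r n) (cum (best r) n)) (less≤1 (cum r n) (cum (best r) n)) ≤-refl (best≤ r))

    r*<L : r* < L
    r*<L = best< 1≤L

    hop<L : ∀ t → hop t < L
    hop<L t with L | 1≤L
    ... | suc l | _ = m%n<n (dep t + suc l ∸ best (suc l)) (suc l)

    hop≤n : ∀ t → hop t < n₁
    hop≤n t = subst (hop t <_) (+-comm 1 n) (m≤n⇒m≤1+n (≤-trans (hop<L t) L≤n))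

    rel≤1 : ∀ t i → rel t i ≤ 1
    rel≤1 t i = bit*≤ (apply less (i + hop t) (dep t)) (less≤1 (i + hop t) (dep t))
      (bit*≤ (pos (cv t i)) (less≤1 0 (cv t i)) (less≤1 0 (cap (cx t i) + apply less (cv t i) (cx t i + off t))))

    ma≤ : ∀ t i → ma t i ≤ suc (n * M)
    ma≤ t zero    = z≤n
    ma≤ t (suc i) = sel≤ (rel t i * better t i) (bit*≤ (rel t i) (rel≤1 t i) (less≤1 0 (cap (ma t i) + apply less (cv t i) (ma t i))))
      (C≤ (n * t + (anc (dep t ∸ i) t ∸ 1))) (ma≤ t i)

    ca≤ : ∀ t i → ca t i ≤ i
    ca≤ t zero    = z≤n
    ca≤ t (suc i) = subst (ca t (suc i) ≤_) (+-comm i 1) (+-mono-≤ (ca≤ t i) (m∸n≤m 1 (apply equal (ma t i) (ma t (suc i)))))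

    km≤ : ∀ t → km t ≤ n
    km≤ zero    = z≤n
    km≤ (suc t) = sel≤ (apply less (km t) (ca t n)) (less≤1 (km t) (ca t n)) (ca≤ t n) (km≤ t)

    ca≤km : ∀ {t} t′ → t < t′ → ca t n ≤ km t′
    ca≤km {t} (suc t′) (s≤s t≤t′) with km t′ <? ca t′ n | m≤n⇒m<n∨m≡n t≤t′
    ... | yes p | inj₁ t<t′ = subst (ca t n ≤_) (sym (sel-1 (ca t′ n) (km t′) (less-true {km t′} p))) (≤-trans (ca≤km t′ t<t′) (<⇒≤ p))
    ... | yes p | inj₂ refl = ≤-reflexive (sym (sel-1 (ca t′ n) (km t′) (less-true {km t′} p)))
    ... | no ¬p | inj₁ t<t′ = subst (ca t n ≤_) (sym (sel-0 (ca t′ n) (km t′) (less-false {km t′} (≮⇒≥ ¬p)))) (ca≤km t′ t<t′)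
    ... | no ¬p | inj₂ refl = subst (ca t n ≤_) (sym (sel-0 (ca t′ n) (km t′) (less-false {km t′} (≮⇒≥ ¬p)))) (≮⇒≥ ¬p)

    size≤ : size ≤ 5 * (n * n)
    size≤ = begin
      n + n * L + pivots * n + n * K₁
        ≤⟨ +-mono-≤ (+-mono-≤ (+-mono-≤ (m≤m*n n n {{>-nonZero 1≤n}}) (*-monoʳ-≤ n L≤n)) (*-monoˡ-≤ n (cum≤ r* n)))
             (*-monoʳ-≤ n (≤-trans (+-monoˡ-≤ 1 (km≤ n)) (+-monoʳ-≤ n 1≤n))) ⟩
      n * n + n * n + n * n + n * (n + n)  ≡⟨ eq n ⟩
      5 * (n * n)                          ∎
      where
      open ≤-Reasoning
      eq : ∀ n → n * n + n * n + n * n + n * (n + n) ≡ 5 * (n * n)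
      eq = solve-∀

-- The build program

nᵉ n₁ᵉ ancestorᵉ lastᵉ : Expr
nᵉ        = var 0
n₁ᵉ       = nᵉ ⊕ lit 1
ancestorᵉ = get 4 ((var 7 ⊖ lit 1) ⊗ nᵉ ⊕ var 9)
lastᵉ     = nᵉ ⊗ nᵉ ⊕ var 9

ancᵉ lenᵉ cntᵉ depᵉ dstᵉ : Expr
ancᵉ = ite (var 7 ≺ lit 1) (var 9 ⊕ lit 1) (posᵉ ancestorᵉ ⊗ get 0 (ancestorᵉ ⊖ lit 1))
lenᵉ = posᵉ (var 7) ⊗ (get 5 ((var 7 ⊖ lit 1) ⊗ nᵉ ⊕ var 9) ⊕ posᵉ ancestorᵉ ⊗ get 1 (ancestorᵉ ⊖ lit 1))
cntᵉ = posᵉ (var 7) ⊗ (get 6 ((var 7 ⊖ lit 1) ⊗ nᵉ ⊕ var 9) ⊕ posᵉ (get 4 (var 7 ⊗ nᵉ ⊕ var 9)))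
depᵉ = get 6 lastᵉ
dstᵉ = posᵉ ((var 9 ≈ᵉ var 2) ⊕ get 0 (var 9)) ⊗ (lit 1 ⊕ get 5 lastᵉ)

sqrtᵉ lgᵉ Lᵉ cumᵉ bestᵉ r*ᵉ : Expr
sqrtᵉ = posᵉ (var 9) ⊗ (p ⊕ ((p ⊕ lit 1) ⊗ (p ⊕ lit 1) ≺ var 9 ⊕ lit 1))
  where p = get 9 (var 9 ⊖ lit 1)
lgᵉ = posᵉ (var 9 ⊘ lit 2) ⊗ (lit 1 ⊕ get 10 (var 9 ⊘ lit 2))
Lᵉ = get 9 nᵉ
cumᵉ = posᵉ (var 9) ⊗ (get 11 (var 7 ⊗ n₁ᵉ ⊕ (var 9 ⊖ lit 1)) ⊕ (get 7 (var 9 ⊖ lit 1) ⊛ Lᵉ ≈ᵉ var 7))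
bestᵉ = posᵉ (var 9) ⊗ ite (total (var 9 ⊖ lit 1) ≺ total p) (var 9 ⊖ lit 1) p
  where
  p = get 12 (var 9 ⊖ lit 1)
  total : Expr → Expr
  total r = get 11 (r ⊗ n₁ᵉ ⊕ nᵉ)
r*ᵉ = get 12 Lᵉ

hopᵉ pxᵉ offᵉ rowᵉ tidᵉ tvᵉ rvᵢ rvᵉ : Expr
hopᵉ = (get 7 (var 9) ⊕ Lᵉ ⊖ r*ᵉ) ⊛ Lᵉ
pxᵉ  = get 4 (get 13 (var 9) ⊗ nᵉ ⊕ var 9)
offᵉ = get 5 (get 13 (var 9) ⊗ nᵉ ⊕ var 9)
rowᵉ = get 11 (r*ᵉ ⊗ n₁ᵉ ⊕ (get 14 (var 9) ⊖ lit 1))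
tidᵉ = get 4 (var 9 ⊗ nᵉ ⊕ var 7)
tvᵉ  = get 2 (nᵉ ⊗ var 7 ⊕ (get 4 (var 9 ⊗ nᵉ ⊕ var 7) ⊖ lit 1))
rvᵢ  = get 11 (r*ᵉ ⊗ n₁ᵉ ⊕ var 7) ⊗ nᵉ ⊕ var 9
rvᵉ  = get 2 (nᵉ ⊗ var 7 ⊕ var 9)

cvᵉ relᵉ maᵉ caᵉ kmᵉ K₁ᵉ listᵢ lvᵉ : Expr
cvᵉ  = get 2 (nᵉ ⊗ var 7 ⊕ (get 4 ((get 7 (var 7) ⊖ var 9) ⊗ nᵉ ⊕ var 7) ⊖ lit 1))
relᵉ = (var 9 ⊕ get 13 (var 7) ≺ get 7 (var 7)) ⊗ (posᵉ cv ⊗ posᵉ ((cx ≈ᵉ lit 0) ⊕ (cv ≺ cx ⊕ get 15 (var 7))))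
  where
  cv = get 20 (var 7 ⊗ nᵉ ⊕ var 9)
  cx = get 2 (nᵉ ⊗ (get 14 (var 7) ⊖ lit 1) ⊕ (get 4 ((get 7 (var 7) ⊖ var 9) ⊗ nᵉ ⊕ var 7) ⊖ lit 1))
maᵉ  = posᵉ (var 9) ⊗ ite (get 21 (var 7 ⊗ nᵉ ⊕ (var 9 ⊖ lit 1)) ⊗ posᵉ ((p ≈ᵉ lit 0) ⊕ (cv ≺ p))) cv p
  where
  p  = get 22 (var 7 ⊗ n₁ᵉ ⊕ (var 9 ⊖ lit 1))
  cv = get 20 (var 7 ⊗ nᵉ ⊕ (var 9 ⊖ lit 1))
caᵉ  = posᵉ (var 9) ⊗ (get 23 (var 7 ⊗ n₁ᵉ ⊕ (var 9 ⊖ lit 1)) ⊕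
         (lit 1 ⊖ (get 22 (var 7 ⊗ n₁ᵉ ⊕ (var 9 ⊖ lit 1)) ≈ᵉ get 22 (var 7 ⊗ n₁ᵉ ⊕ var 9))))
kmᵉ  = posᵉ (var 9) ⊗ ite (k ≺ c) c k
  where
  k = get 24 (var 9 ⊖ lit 1)
  c = get 23 ((var 9 ⊖ lit 1) ⊗ n₁ᵉ ⊕ nᵉ)
K₁ᵉ  = get 24 nᵉ ⊕ lit 1
listᵢ = var 7 ⊗ K₁ᵉ ⊕ get 23 (var 7 ⊗ n₁ᵉ ⊕ var 9)
lvᵉ  = get 22 (var 7 ⊗ n₁ᵉ ⊕ var 9)

-- A record of the oracle: four global parameters repeated in every record, seven words about vertex
-- number `q`, and cell number `q` of the five long tables. Beyond the range of a table the record
-- holds whatever its array contains there.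
streamᵉ : List Expr
streamᵉ = nᵉ ∷ Lᵉ ∷ K₁ᵉ ∷ get 10 nᵉ ∷ get 7 q ∷ get 8 q ∷ get 13 q ∷ get 15 q ∷ get 16 q ∷ get 23 (q ⊗ n₁ᵉ ⊕ nᵉ) ∷
          get 0 q ∷ get 17 q ∷ get 18 q ∷ get 19 q ∷ get 25 q ∷ get 26 q ∷ []
  where q = var 7

sizeᵉ : Expr
sizeᵉ = nᵉ ⊕ nᵉ ⊗ Lᵉ ⊕ get 11 (r*ᵉ ⊗ n₁ᵉ ⊕ nᵉ) ⊗ nᵉ ⊕ nᵉ ⊗ K₁ᵉ

choose : ℕ → List Expr → Expr
choose k []       = lit 0
choose k (e ∷ es) = ite (var 9 ≈ᵉ lit k) e (choose (suc k) es)

-- The order respects dependencies: each array is filled once, from the input, from completed arrays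
-- and from its own earlier cells. The output array 3 comes last.
fills build : Program
fills =
  fill₂ 4 n₁ᵉ nᵉ ancᵉ ⨾ fill₂ 5 n₁ᵉ nᵉ lenᵉ ⨾ fill₂ 6 n₁ᵉ nᵉ cntᵉ ⨾ fill₁ 7 nᵉ depᵉ ⨾ fill₁ 8 nᵉ dstᵉ ⨾
  fill₁ 9 n₁ᵉ sqrtᵉ ⨾ fill₁ 10 n₁ᵉ lgᵉ ⨾ fill₂ 11 Lᵉ n₁ᵉ cumᵉ ⨾ fill₁ 12 (Lᵉ ⊕ lit 1) bestᵉ ⨾
  fill₁ 13 nᵉ hopᵉ ⨾ fill₁ 14 nᵉ pxᵉ ⨾ fill₁ 15 nᵉ offᵉ ⨾ fill₁ 16 nᵉ rowᵉ ⨾ fill₂ 17 nᵉ Lᵉ tidᵉ ⨾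
  fill₂ 18 nᵉ Lᵉ tvᵉ ⨾ fill 19 nᵉ nᵉ rvᵢ rvᵉ ⨾ fill₂ 20 nᵉ nᵉ cvᵉ ⨾ fill₂ 21 nᵉ nᵉ relᵉ ⨾
  fill₂ 22 nᵉ n₁ᵉ maᵉ ⨾ fill₂ 23 nᵉ n₁ᵉ caᵉ ⨾ fill₁ 24 n₁ᵉ kmᵉ ⨾ fill 25 nᵉ n₁ᵉ listᵢ (var 9) ⨾
  fill 26 nᵉ n₁ᵉ listᵢ lvᵉ ⨾ fill₂ 3 sizeᵉ (lit 16) (choose 0 streamᵉ)
build = fills ⨾ set 0 (sizeᵉ ⊗ lit 16)

module Build {V W : ℕ} (17≤V : 17 ≤ V) (room : ∀ k → T (k <ᵇ 4096) → V ^ k < W)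
             {N : ℕ} (N≤V : N ≤ V) (n M s : ℕ) (par w C : ℕ → ℕ) (1≤n : 1 ≤ n)
             (par≤ : ∀ v → par v ≤ n) (w≤ : ∀ v → w v ≤ M) (C≤ : ∀ i → C i ≤ suc (n * M))
             (table≤V : suc (n * M) ≤ V) (square≤N : suc (n + 1) * suc (n + 1) ≤ N)
             (size≤N : suc (Tables.size n s par w C) * 17 ≤ N) where
  open Tables n s par w C
  open Bounds 1≤n par≤ w≤ C≤

  ρ : ℕ → ℕ
  ρ = contents (n ∷ M ∷ s ∷ [])

  open Machine 17≤V room ρ
  open Fills 17≤V room ρ N≤V

  n<n₁ : n < n₁
  n<n₁ = subst (n <_) (+-comm 1 n) ≤-refl

  n₁≤V : n₁ ≤ V
  n₁≤V = ≤-trans (n≤1+n n₁) (≤-trans (m≤m*n (suc n₁) (suc n₁)) (≤-trans square≤N N≤V))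

  n≤V : n ≤ V
  n≤V = ≤-trans (<⇒≤ n<n₁) n₁≤V

  below-n₁ : ∀ {q} → q < n₁ → q ≤ n
  below-n₁ {q} q<n₁ = ≤-pred (subst (q <_) (+-comm n 1) q<n₁)

  within : ∀ {a b} → a ≤ n₁ → b ≤ n₁ → suc a * suc b ≤ N
  within a≤ b≤ = ≤-trans (*-mono-≤ (s≤s a≤) (s≤s b≤)) square≤N

  narrow : ∀ {b} → b ≤ n₁ → 2 * suc b ≤ N
  narrow = within {1} (subst (1 ≤_) (+-comm 1 n) (s≤s z≤n))

  n≤n₁ : n ≤ n₁
  n≤n₁ = <⇒≤ n<n₁

  S₀ S₄ S₅ S₆ S₇ S₈ : ℕ → ℕ → ℕ
  S₀ 0 = par
  S₀ 1 = w
  S₀ 2 = C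
  S₀ _ = λ _ → 0
  S₄ = S₀ [ 4 ↦ stored anc n n₁ ]
  S₅ = S₄ [ 5 ↦ stored len n n₁ ]
  S₆ = S₅ [ 6 ↦ stored cnt n n₁ ]
  S₇ = S₆ [ 7 ↦ stored (λ _ → dep) n 1 ]
  S₈ = S₇ [ 8 ↦ stored (λ _ → dst) n 1 ]

  anc-at : ∀ {j t} → j ≤ n → t < n → stored anc n n₁ (j * n + t) ≡ anc j t
  anc-at j≤n = stored-at _ _ (≤-<-trans j≤n n<n₁)

  exec-anc : Exec N (fill₂ 4 n₁ᵉ nᵉ ancᵉ) S₀ S₄
  exec-anc = exec₂ 4 n₁ n n₁ᵉ nᵉ ancᵉ anc tt (within ≤-refl n≤n₁) (λ _ _ → refl) (λ _ _ _ → refl) refl λ where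
    zero    r X q< r<n above left → sel-1 (r + 1) (pos (X r) * par (X r ∸ 1)) refl , ≤-trans (anc≤ 0 r<n) n≤V
    (suc q) r X q< r<n above left →
      trans (sel-0 (r + 1) (pos (X (q * n + r)) * par (X (q * n + r) ∸ 1)) refl) (cong (λ a → pos a * par (a ∸ 1)) (above q r ≤-refl r<n)) ,
      ≤-trans (anc≤ (suc q) r<n) n≤V

  exec-len : Exec N (fill₂ 5 n₁ᵉ nᵉ lenᵉ) S₄ S₅
  exec-len = exec₂ 5 n₁ n n₁ᵉ nᵉ lenᵉ len tt (within ≤-refl n≤n₁) (λ _ _ → refl) (λ _ _ _ → refl) refl λ where
    zero    r X q< r<n above left → refl , z≤n
    (suc q) r X q< r<n above left →
      trans (+-identityʳ _) (cong₂ (λ l a → l + pos a * w (a ∸ 1)) (above q r ≤-refl r<n) (anc-at (<⇒≤ (below-n₁ q<)) r<n)) ,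
      ≤-trans (len≤ (suc q) r) (≤-trans (*-monoˡ-≤ M (below-n₁ q<)) (≤-trans (n≤1+n _) table≤V))

  exec-cnt : Exec N (fill₂ 6 n₁ᵉ nᵉ cntᵉ) S₅ S₆
  exec-cnt = exec₂ 6 n₁ n n₁ᵉ nᵉ cntᵉ cnt tt (within ≤-refl n≤n₁) (λ _ _ → refl) (λ _ _ _ → refl) refl λ where
    zero    r X q< r<n above left → refl , z≤n
    (suc q) r X q< r<n above left →
      trans (+-identityʳ _) (cong₂ (λ l a → l + pos a) (above q r ≤-refl r<n) (anc-at (below-n₁ q<) r<n)) ,
      ≤-trans (cnt≤ (suc q) r) (≤-trans (below-n₁ q<) n≤V)

  exec-dep : Exec N (fill₁ 7 nᵉ depᵉ) S₆ S₇
  exec-dep = exec₁ 7 n nᵉ depᵉ dep tt (narrow n≤n₁) (λ _ _ → refl) refl λ r X r<n left →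
    stored-at n r n<n₁ r<n , ≤-trans (dep≤ r) n≤V

  exec-dst : Exec N (fill₁ 8 nᵉ dstᵉ) S₇ S₈
  exec-dst = exec₁ 8 n nᵉ dstᵉ dst tt (narrow n≤n₁) (λ _ _ → refl) refl λ r X r<n left →
    cong (λ l → pos (apply equal r s + par r) * suc l) (stored-at n r n<n₁ r<n) , ≤-trans (dst≤ r) table≤V

  S₉ S₁₀ S₁₁ S₁₂ S₁₃ S₁₄ S₁₅ S₁₆ S₁₇ S₁₈ S₁₉ : ℕ → ℕ → ℕ
  S₉  = S₈ [ 9 ↦ stored (λ _ → sqrt) n₁ 1 ]
  S₁₀ = S₉ [ 10 ↦ stored (λ _ → ⌊log₂_⌋) n₁ 1 ]
  S₁₁ = S₁₀ [ 11 ↦ stored cum n₁ L ]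
  S₁₂ = S₁₁ [ 12 ↦ stored (λ _ → best) (L + 1) 1 ]
  S₁₃ = S₁₂ [ 13 ↦ stored (λ _ → hop) n 1 ]
  S₁₄ = S₁₃ [ 14 ↦ stored (λ _ → px) n 1 ]
  S₁₅ = S₁₄ [ 15 ↦ stored (λ _ → off) n 1 ]
  S₁₆ = S₁₅ [ 16 ↦ stored (λ _ → row) n 1 ]
  S₁₇ = S₁₆ [ 17 ↦ stored tid L n ]
  S₁₈ = S₁₇ [ 18 ↦ stored tv L n ]
  S₁₉ = S₁₈ [ 19 ↦ scattered (λ t v → cum r* t * n + v) (λ t v → C (n * t + v)) n n ]

  L≤n₁ : L ≤ n₁
  L≤n₁ = ≤-trans L≤n n≤n₁

  dep-at : ∀ {t} → t < n → stored (λ _ → dep) n 1 t ≡ dep t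
  dep-at = stored-at₁ _

  L-at : stored (λ _ → sqrt) n₁ 1 n ≡ L
  L-at = stored-at₁ n n<n₁

  cum-at : ∀ {r t} → r < L → t ≤ n → stored cum n₁ L (r * n₁ + t) ≡ cum r t
  cum-at r<L t≤n = stored-at _ _ r<L (≤-<-trans t≤n n<n₁)

  r*-at : stored (λ _ → best) (L + 1) 1 (stored (λ _ → sqrt) n₁ 1 n) ≡ r*
  r*-at = trans (cong (stored (λ _ → best) (L + 1) 1) L-at) (stored-at₁ L (subst (L <_) (+-comm 1 L) ≤-refl))

  hop-at : ∀ {t} → t < n → stored (λ _ → hop) n 1 t ≡ hop t
  hop-at = stored-at₁ _

  px-at : ∀ {t} → t < n → stored (λ _ → px) n 1 t ≡ px t
  px-at = stored-at₁ _

  hop≤ : ∀ t → hop t ≤ n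
  hop≤ t = below-n₁ (hop≤n t)

  exec-sqrt : Exec N (fill₁ 9 n₁ᵉ sqrtᵉ) S₈ S₉
  exec-sqrt = exec₁ 9 n₁ n₁ᵉ sqrtᵉ sqrt tt (narrow ≤-refl) (λ _ _ → refl) refl λ where
    zero    X r< left → refl , z≤n
    (suc r) X r< left →
      trans (+-identityʳ _) (cong (λ p → p + apply less ((p + 1) * (p + 1)) (suc r + 1)) (left r ≤-refl)) ,
      ≤-trans (sqrt≤ (suc r)) (≤-trans (below-n₁ r<) n≤V)

  exec-lg : Exec N (fill₁ 10 n₁ᵉ lgᵉ) S₉ S₁₀
  exec-lg = exec₁ 10 n₁ n₁ᵉ lgᵉ ⌊log₂_⌋ tt (narrow ≤-refl) (λ _ _ → refl) refl λ where
    zero    X r< left → refl , z≤n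
    (suc r) X r< left →
      trans (cong (λ l → pos (suc r / 2) * suc l) (left (suc r / 2) (m/n<m (suc r) 2 (s≤s (s≤s z≤n))))) (log-step (suc r)) ,
      ≤-trans (log≤ (suc r)) (≤-trans (below-n₁ r<) n≤V)

  exec-cum : Exec N (fill₂ 11 Lᵉ n₁ᵉ cumᵉ) S₁₀ S₁₁
  exec-cum = exec₂ 11 L n₁ Lᵉ n₁ᵉ cumᵉ cum tt (within L≤n₁ ≤-refl) (λ _ _ → L-at) (λ _ _ _ → refl) refl λ where
    q zero    X q< r< above left → refl , z≤n
    q (suc r) X q< r< above left →
      trans (+-identityʳ _) (cong₂ _+_ (left r ≤-refl)
        (cong₂ (λ d l → apply equal (apply mod d l) q) (dep-at (below-n₁ r<)) L-at)) ,
      ≤-trans (cum≤ q (suc r)) (≤-trans (below-n₁ r<) n≤V)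

  exec-best : Exec N (fill₁ 12 (Lᵉ ⊕ lit 1) bestᵉ) S₁₁ S₁₂
  exec-best = exec₁ 12 (L + 1) (Lᵉ ⊕ lit 1) bestᵉ best tt (narrow (+-monoˡ-≤ 1 L≤n)) (λ _ _ → cong (_+ 1) L-at) refl λ where
    zero    X r< left → refl , z≤n
    (suc r) X r< left → let r<L = ≤-pred (subst (suc (suc r) ≤_) (+-comm L 1) r<) in
      trans (+-identityʳ _)
        (trans (cong (λ p → sel (apply less (stored cum n₁ L (r * n₁ + n)) (stored cum n₁ L (p * n₁ + n))) r p) (left r ≤-refl))
               (cong₂ (λ a b → sel (apply less a b) r (best r)) (cum-at r<L ≤-refl) (cum-at (≤-<-trans (best≤ r) r<L) ≤-refl))) ,
      ≤-trans (best≤ (suc r)) (≤-trans r<L (≤-trans L≤n n≤V))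

  exec-hop : Exec N (fill₁ 13 nᵉ hopᵉ) S₁₂ S₁₃
  exec-hop = exec₁ 13 n nᵉ hopᵉ hop tt (narrow n≤n₁) (λ _ _ → refl) refl λ r X r< left →
    trans (cong₂ (λ l b → apply mod (stored (λ _ → dep) n 1 r + l ∸ b) l) L-at r*-at)
          (cong (λ d → apply mod (d + L ∸ r*) L) (dep-at r<)) ,
    ≤-trans (hop≤ r) n≤V

  exec-px : Exec N (fill₁ 14 nᵉ pxᵉ) S₁₃ S₁₄
  exec-px = exec₁ 14 n nᵉ pxᵉ px tt (narrow n≤n₁) (λ _ _ → refl) refl λ r X r< left →
    trans (cong (λ h → stored anc n n₁ (h * n + r)) (hop-at r<)) (anc-at (hop≤ r) r<) ,
    ≤-trans (anc≤ (hop r) r<) n≤V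

  exec-off : Exec N (fill₁ 15 nᵉ offᵉ) S₁₄ S₁₅
  exec-off = exec₁ 15 n nᵉ offᵉ off tt (narrow n≤n₁) (λ _ _ → refl) refl λ r X r< left →
    trans (cong (λ h → stored len n n₁ (h * n + r)) (hop-at r<)) (stored-at (hop r) r (hop≤n r) r<) ,
    ≤-trans (len≤ (hop r) r) (≤-trans (*-monoˡ-≤ M (hop≤ r)) (≤-trans (n≤1+n _) table≤V))

  exec-row : Exec N (fill₁ 16 nᵉ rowᵉ) S₁₅ S₁₆
  exec-row = exec₁ 16 n nᵉ rowᵉ row tt (narrow n≤n₁) (λ _ _ → refl) refl λ r X r< left →
    trans (cong₂ (λ b p → stored cum n₁ L (b * n₁ + (p ∸ 1))) r*-at (px-at r<))
          (cum-at r*<L (<⇒≤ (anc-1< (hop r) r<))) ,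
    ≤-trans (cum≤ r* (px r ∸ 1)) (≤-trans (<⇒≤ (anc-1< (hop r) r<)) n≤V)

  exec-tid : Exec N (fill₂ 17 nᵉ Lᵉ tidᵉ) S₁₆ S₁₇
  exec-tid = exec₂ 17 n L nᵉ Lᵉ tidᵉ tid tt (within n≤n₁ L≤n₁) (λ _ _ → refl) (λ _ _ _ → L-at) refl λ q r X q< r< above left →
    anc-at (≤-trans (<⇒≤ r<) L≤n) q< , ≤-trans (anc≤ r q<) n≤V

  exec-tv : Exec N (fill₂ 18 nᵉ Lᵉ tvᵉ) S₁₇ S₁₈
  exec-tv = exec₂ 18 n L nᵉ Lᵉ tvᵉ tv tt (within n≤n₁ L≤n₁) (λ _ _ → refl) (λ _ _ _ → L-at) refl λ q r X q< r< above left →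
    cong (λ a → C (n * q + (a ∸ 1))) (anc-at (≤-trans (<⇒≤ r<) L≤n) q<) , ≤-trans (C≤ _) table≤V

  exec-rv : Exec N (fill 19 nᵉ nᵉ rvᵢ rvᵉ) S₁₈ S₁₉
  exec-rv = exec-scatter 19 n n nᵉ nᵉ rvᵢ rvᵉ _ _ tt (within n≤n₁ n≤n₁) (λ _ _ → refl , refl) refl λ q r X q< r< →
    trans (cong (λ b → stored cum n₁ L (b * n₁ + q) * n + r) r*-at) (cong (λ k → k * n + r) (cum-at r*<L (<⇒≤ q<))) ,
    refl , ≤-trans (C≤ _) table≤V

  S₂₀ S₂₁ S₂₂ S₂₃ S₂₄ S₂₅ S₂₆ : ℕ → ℕ → ℕ
  S₂₀ = S₁₉ [ 20 ↦ stored cv n n ]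
  S₂₁ = S₂₀ [ 21 ↦ stored rel n n ]
  S₂₂ = S₂₁ [ 22 ↦ stored ma n₁ n ]
  S₂₃ = S₂₂ [ 23 ↦ stored ca n₁ n ]
  S₂₄ = S₂₃ [ 24 ↦ stored (λ _ → km) n₁ 1 ]
  S₂₅ = S₂₄ [ 25 ↦ scattered (λ t i → t * K₁ + ca t i) (λ _ i → i) n₁ n ]
  S₂₆ = S₂₅ [ 26 ↦ scattered (λ t i → t * K₁ + ca t i) ma n₁ n ]

  cv-at : ∀ {t i} → t < n → i < n → stored cv n n (t * n + i) ≡ cv t i
  cv-at = stored-at _ _

  ma-at : ∀ {t i} → t < n → i < n₁ → stored ma n₁ n (t * n₁ + i) ≡ ma t i
  ma-at = stored-at _ _

  ca-at : ∀ {t i} → t < n → i < n₁ → stored ca n₁ n (t * n₁ + i) ≡ ca t i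
  ca-at = stored-at _ _

  K-at : stored (λ _ → km) n₁ 1 n ≡ km n
  K-at = stored-at₁ n n<n₁

  failure-at : ∀ {t} i → t < n → stored anc n n₁ ((stored (λ _ → dep) n 1 t ∸ i) * n + t) ≡ anc (dep t ∸ i) t
  failure-at {t} i t<n = trans (cong (λ d → stored anc n n₁ ((d ∸ i) * n + t)) (dep-at t<n))
    (anc-at (≤-trans (m∸n≤m (dep t) i) (dep≤ t)) t<n)

  cx-at : ∀ {t} i → t < n →
    C (n * (stored (λ _ → px) n 1 t ∸ 1) + (stored anc n n₁ ((stored (λ _ → dep) n 1 t ∸ i) * n + t) ∸ 1)) ≡ cx t i
  cx-at i t<n = cong₂ (λ p a → C (n * (p ∸ 1) + (a ∸ 1))) (px-at t<n) (failure-at i t<n)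

  relevance : (i h d c x o : ℕ) → ℕ
  relevance i h d c x o = apply less (i + h) d * (pos c * pos (cap x + apply less c (x + o)))

  relevance-cong : ∀ {i h h′ d d′ c c′ x x′ o o′} → h ≡ h′ → d ≡ d′ → c ≡ c′ → x ≡ x′ → o ≡ o′ →
                   relevance i h d c x o ≡ relevance i h′ d′ c′ x′ o′
  relevance-cong refl refl refl refl refl = refl

  improve : ℕ → ℕ → ℕ → ℕ
  improve r c p = sel (r * pos (cap p + apply less c p)) c p

  improve-cong : ∀ {r r′ c c′ p p′} → r ≡ r′ → c ≡ c′ → p ≡ p′ → improve r c p ≡ improve r′ c′ p′
  improve-cong refl refl refl = refl

  exec-cv : Exec N (fill₂ 20 nᵉ nᵉ cvᵉ) S₁₉ S₂₀
  exec-cv = exec₂ 20 n n nᵉ nᵉ cvᵉ cv tt (within n≤n₁ n≤n₁) (λ _ _ → refl) (λ _ _ _ → refl) refl λ q r X q< r< above left →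
    cong (λ a → C (n * q + (a ∸ 1))) (failure-at r q<) , ≤-trans (C≤ _) table≤V

  exec-rel : Exec N (fill₂ 21 nᵉ nᵉ relᵉ) S₂₀ S₂₁
  exec-rel = exec₂ 21 n n nᵉ nᵉ relᵉ rel tt (within n≤n₁ n≤n₁) (λ _ _ → refl) (λ _ _ _ → refl) refl λ q r X q< r< above left →
    relevance-cong {r} (hop-at q<) (dep-at q<) (cv-at q< r<) (cx-at r q<) (stored-at₁ q q<) ,
    ≤-trans (rel≤1 q r) (≤-trans 1≤n n≤V)

  exec-ma : Exec N (fill₂ 22 nᵉ n₁ᵉ maᵉ) S₂₁ S₂₂
  exec-ma = exec₂ 22 n n₁ nᵉ n₁ᵉ maᵉ ma tt (within n≤n₁ ≤-refl) (λ _ _ → refl) (λ _ _ _ → refl) refl λ where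
    q zero    X q< r< above left → refl , z≤n
    q (suc r) X q< r< above left →
      trans (+-identityʳ _) (improve-cong (stored-at q r q< (below-n₁ r<)) (cv-at q< (below-n₁ r<)) (left r ≤-refl)) ,
      ≤-trans (ma≤ q (suc r)) table≤V

  exec-ca : Exec N (fill₂ 23 nᵉ n₁ᵉ caᵉ) S₂₂ S₂₃
  exec-ca = exec₂ 23 n n₁ nᵉ n₁ᵉ caᵉ ca tt (within n≤n₁ ≤-refl) (λ _ _ → refl) (λ _ _ _ → refl) refl λ where
    q zero    X q< r< above left → refl , z≤n
    q (suc r) X q< r< above left →
      trans (+-identityʳ _) (cong₂ (λ x e → x + (1 ∸ e)) (left r ≤-refl)
        (cong₂ (apply equal) (ma-at q< (<-trans ≤-refl r<)) (ma-at q< r<))) ,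
      ≤-trans (ca≤ q (suc r)) (≤-trans (below-n₁ r<) n≤V)

  exec-km : Exec N (fill₁ 24 n₁ᵉ kmᵉ) S₂₃ S₂₄
  exec-km = exec₁ 24 n₁ n₁ᵉ kmᵉ km tt (narrow ≤-refl) (λ _ _ → refl) refl λ where
    zero    X r< left → refl , z≤n
    (suc r) X r< left →
      trans (+-identityʳ _) (cong₂ (λ k c → sel (apply less k c) c k) (left r ≤-refl) (ca-at (below-n₁ r<) n<n₁)) ,
      ≤-trans (km≤ (suc r)) n≤V

  list-index : ∀ {t i} → t < n → i < n₁ →
    t * (stored (λ _ → km) n₁ 1 n + 1) + stored ca n₁ n (t * n₁ + i) ≡ t * K₁ + ca t i
  list-index {t} t< i< = cong₂ (λ k c → t * (k + 1) + c) K-at (ca-at t< i<)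

  exec-le : Exec N (fill 25 nᵉ n₁ᵉ listᵢ (var 9)) S₂₄ S₂₅
  exec-le = exec-scatter 25 n n₁ nᵉ n₁ᵉ listᵢ (var 9) _ _ tt (within n≤n₁ ≤-refl) (λ _ _ → refl , refl) refl λ q r X q< r< →
    list-index q< r< , refl , ≤-trans (below-n₁ r<) n≤V

  exec-lv : Exec N (fill 26 nᵉ n₁ᵉ listᵢ lvᵉ) S₂₅ S₂₆
  exec-lv = exec-scatter 26 n n₁ nᵉ n₁ᵉ listᵢ lvᵉ _ _ tt (within n≤n₁ ≤-refl) (λ _ _ → refl , refl) refl λ q r X q< r< →
    list-index q< r< , ma-at q< r< , ≤-trans (ma≤ q r) table≤V

  stream : ℕ → ℕ → ℕ
  stream k i = ⟦ choose 0 streamᵉ ⟧ (state (counting ρ i k) S₂₆)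

  S₃ : ℕ → ℕ → ℕ
  S₃ = S₂₆ [ 3 ↦ stored (λ i k → stream k i) 16 size ]

  choose≤ : ∀ {σ} k es → All (λ e → ⟦ e ⟧ σ ≤ V) es → ⟦ choose k es ⟧ σ ≤ V
  choose≤ k []       []         = z≤n
  choose≤ {σ} k (e ∷ es) (e≤ ∷ es≤) =
    sel≤ (apply equal (vars σ 9) k) (equal≤1 (vars σ 9) k) e≤ (choose≤ (suc k) es es≤)

  size-at : ∀ {ρ′} → ρ′ 0 ≡ n → ⟦ sizeᵉ ⟧ (state ρ′ S₂₆) ≡ size
  size-at {ρ′} eq rewrite eq = cong₂ _+_ (cong₂ _+_ (cong (λ l → n + n * l) L-at)
    (cong (_* n) (trans (cong (λ b → stored cum n₁ L (b * n₁ + n)) r*-at) (cum-at r*<L ≤-refl))))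
    (cong (λ k → n * (k + 1)) K-at)

  exec-out : Exec N (fill₂ 3 sizeᵉ (lit 16) (choose 0 streamᵉ)) S₂₆ S₃
  exec-out = exec λ S≤ → runs (exec₂ 3 size 16 sizeᵉ (lit 16) (choose 0 streamᵉ) (λ i k → stream k i) tt
    size≤N (λ q r → size-at {counting ρ q r} refl) (λ _ _ _ → refl) refl (λ q r X q< r< above left →
      refl , choose≤ {state (counting ρ q r) S₂₆} 0 streamᵉ
        (n≤V ∷ S≤ 9 n ∷ subst (_≤ V) (cong (_+ 1) (sym K-at)) (≤-trans (+-monoˡ-≤ 1 (km≤ n)) n₁≤V) ∷ S≤ 10 n ∷ S≤ 7 q ∷ S≤ 8 q ∷ S≤ 13 q ∷
         S≤ 15 q ∷ S≤ 16 q ∷ S≤ 23 (q * n₁ + n) ∷ S≤ 0 q ∷ S≤ 17 q ∷ S≤ 18 q ∷ S≤ 19 q ∷ S≤ 25 q ∷ S≤ 26 q ∷ []))) S≤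

  exec-fills : Exec N fills S₀ S₃
  exec-fills =
    exec-anc ⨾ᵉ exec-len ⨾ᵉ exec-cnt ⨾ᵉ exec-dep ⨾ᵉ exec-dst ⨾ᵉ exec-sqrt ⨾ᵉ exec-lg ⨾ᵉ exec-cum ⨾ᵉ
    exec-best ⨾ᵉ exec-hop ⨾ᵉ exec-px ⨾ᵉ exec-off ⨾ᵉ exec-row ⨾ᵉ exec-tid ⨾ᵉ exec-tv ⨾ᵉ exec-rv ⨾ᵉ
    exec-cv ⨾ᵉ exec-rel ⨾ᵉ exec-ma ⨾ᵉ exec-ca ⨾ᵉ exec-km ⨾ᵉ exec-le ⨾ᵉ exec-lv ⨾ᵉ exec-out

  S₀≤ : ∀ a j → S₀ a j ≤ V
  S₀≤ 0 j = ≤-trans (par≤ j) n≤V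
  S₀≤ 1 j = ≤-trans (w≤ j) (≤-trans (m≤n*m M n {{>-nonZero 1≤n}}) (≤-trans (n≤1+n _) table≤V))
  S₀≤ 2 j = ≤-trans (C≤ j) table≤V
  S₀≤ (suc (suc (suc _))) j = z≤n

  build-run : ∀ {σ} → Represents σ S₀ → ∃[ k ] ∃[ σ′ ] Run W build σ k σ′ × k ≤ charge build * N ×
    vars σ′ 0 ≡ size * 16 × (∀ {i k} → i < size → k < 16 → arrays σ′ 3 (i * 16 + k) ≡ stream k i) × (∀ j → arrays σ′ 3 j ≤ V)
  build-run rep =
    let (k , σ′ , r , k≤ , (i , j , eq) , cells) =
          run-output (≤-trans (s≤s z≤n) size≤N) exec-fills S₀≤ 0 (sizeᵉ ⊗ lit 16) tt rep
    in k , σ′ , r , k≤ , trans eq (cong (_* 16) (size-at {counting ρ i j} refl)) ,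
       (λ {i} {k} i< k< → trans (proj₁ (cells 3 (i * 16 + k))) (stored-at i k i< k<)) , λ j → proj₂ (cells 3 j)

-- Prefix minima, lists and pivots in the tables

bit-cases : ∀ x y → (x < y × apply less x y ≡ 1) ⊎ (y ≤ x × apply less x y ≡ 0)
bit-cases x y with x <? y
... | yes x<y = inj₁ (x<y , less-true x<y)
... | no  x≮y = inj₂ (≮⇒≥ x≮y , less-false (≮⇒≥ x≮y))

0<1 : ¬ 0 ≡ 1
0<1 ()

pos-1 : ∀ {x} → 1 ≤ x → pos x ≡ 1
pos-1 (s≤s _) = refl

pos-1⁻ : ∀ x → pos x ≡ 1 → 1 ≤ x
pos-1⁻ (suc x) _ = s≤s z≤n

less-1⁻ : ∀ x y → apply less x y ≡ 1 → x < y
less-1⁻ x y eq with bit-cases x y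
... | inj₁ (x<y , _) = x<y
... | inj₂ (_ , eq′) = contradiction (trans (sym eq′) eq) 0<1

*-1⁻ : ∀ x y → x * y ≡ 1 → x ≡ 1 × y ≡ 1
*-1⁻ x y eq = m*n≡1⇒m≡1 x y eq , m*n≡1⇒n≡1 x y eq

bit-01 : ∀ {c} → c ≤ 1 → c ≡ 0 ⊎ c ≡ 1
bit-01 {zero}        _ = inj₁ refl
bit-01 {suc zero}    _ = inj₂ refl
bit-01 {suc (suc _)} (s≤s ())

module TableFacts (n s : ℕ) (par w C : ℕ → ℕ) (1≤n : 1 ≤ n) {M : ℕ} (par≤ : ∀ v → par v ≤ n)
                  (w≤ : ∀ v → w v ≤ M) (C≤ : ∀ i → C i ≤ suc (n * M)) where
  open Tables n s par w C
  open Bounds 1≤n par≤ w≤ C≤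

  record Change (t i : ℕ) : Set where
    field
      relevant : rel t i ≡ 1
      ma-new   : ma t (suc i) ≡ cv t i
      ca-new   : ca t (suc i) ≡ suc (ca t i)
      improves : ma t i ≡ 0 ⊎ cv t i < ma t i

  record Same (t i : ℕ) : Set where
    field
      ma-old : ma t (suc i) ≡ ma t i
      ca-old : ca t (suc i) ≡ ca t i
      enough : rel t i ≡ 1 → 1 ≤ ma t i × ma t i ≤ cv t i

  rel⇒1≤cv : ∀ {t i} → rel t i ≡ 1 → 1 ≤ cv t i
  rel⇒1≤cv {t} {i} eq = pos-1⁻ _ (proj₁ (*-1⁻ (pos (cv t i)) _ (proj₂ (*-1⁻ (apply less (i + hop t) (dep t)) _ eq))))

  better-cases : ∀ t i → (better t i ≡ 1 × (ma t i ≡ 0 ⊎ cv t i < ma t i)) ⊎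
                         (better t i ≡ 0 × 1 ≤ ma t i × ma t i ≤ cv t i)
  better-cases t i with ma t i in eq
  ... | zero  = inj₁ (refl , inj₁ refl)
  ... | suc m with bit-cases (cv t i) (suc m)
  ... | inj₁ (c< , eq′) = inj₁ (cong pos eq′ , inj₂ c<)
  ... | inj₂ (≤c , eq′) = inj₂ (cong pos eq′ , s≤s z≤n , ≤c)

  -- A column either keeps both minimum and counter, or it lowers the one and raises the other; a
  -- first finite value counts as lowering infinity.
  step-cases : ∀ t i → Same t i ⊎ Change t i
  step-cases t i with bit-01 (rel≤1 t i) | better-cases t i
  ... | inj₁ r0 | _ = inj₁ (record
    { ma-old = same ; ca-old = trans (cong (λ b → ca t i + (1 ∸ b)) (equal-true (sym same))) (+-identityʳ _)
    ; enough = λ r1 → contradiction (trans (sym r0) r1) 0<1 })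
    where same = sel-0 {rel t i * better t i} (cv t i) (ma t i) (cong (_* better t i) r0)
  ... | inj₂ r1 | inj₂ (b0 , enough) = inj₁ (record
    { ma-old = same ; ca-old = trans (cong (λ b → ca t i + (1 ∸ b)) (equal-true (sym same))) (+-identityʳ _)
    ; enough = λ _ → enough })
    where same = sel-0 {rel t i * better t i} (cv t i) (ma t i) (cong₂ _*_ r1 b0)
  ... | inj₂ r1 | inj₁ (b1 , improves) = inj₂ (record
    { relevant = r1 ; ma-new = new ; improves = improves
    ; ca-new = trans (cong (λ b → ca t i + (1 ∸ b)) (equal-false (differs improves))) (+-comm (ca t i) 1) })
    where
    new = sel-1 {rel t i * better t i} (cv t i) (ma t i) (cong₂ _*_ r1 b1)
    differs : ma t i ≡ 0 ⊎ cv t i < ma t i → ma t i ≢ ma t (suc i)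
    differs (inj₁ m≡0) eq = contradiction (subst (1 ≤_) (trans (sym new) (trans (sym eq) m≡0)) (rel⇒1≤cv {t} {i} r1)) λ ()
    differs (inj₂ c<m) eq = <-irrefl (trans (sym new) (sym eq)) c<m

  ca-suc : ∀ t i → ca t i ≤ ca t (suc i) × ca t (suc i) ≤ suc (ca t i)
  ca-suc t i with step-cases t i
  ... | inj₁ σ = ≤-reflexive (sym (Same.ca-old σ)) , ≤-trans (≤-reflexive (Same.ca-old σ)) (n≤1+n _)
  ... | inj₂ δ = ≤-trans (n≤1+n _) (≤-reflexive (sym (Change.ca-new δ))) , ≤-reflexive (Change.ca-new δ)

  ca-mono : ∀ t {i j} → i ≤ j → ca t i ≤ ca t j
  ca-mono t {i} {zero}  z≤n = ≤-refl
  ca-mono t {i} {suc j} i≤j with m≤n⇒m<n∨m≡n i≤j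
  ... | inj₁ i<j  = ≤-trans (ca-mono t (≤-pred i<j)) (proj₁ (ca-suc t j))
  ... | inj₂ refl = ≤-refl

  ma-constant : ∀ t {i j} → i ≤ j → ca t i ≡ ca t j → ma t i ≡ ma t j
  ma-constant t {i} {zero}  z≤n _ = refl
  ma-constant t {i} {suc j} i≤j eq with m≤n⇒m<n∨m≡n i≤j
  ... | inj₂ refl = refl
  ... | inj₁ i<j with step-cases t j
  ... | inj₁ σ = trans (ma-constant t (≤-pred i<j) (trans eq (Same.ca-old σ))) (sym (Same.ma-old σ))
  ... | inj₂ δ = contradiction (ca-mono t (≤-pred i<j)) (<⇒≱ (≤-reflexive (sym (trans eq (Change.ca-new δ)))))

  -- The minimum is constant between changes. Hence values can be addressed by the number of
  -- changes: all writes to one cell agree.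
  ma-of-ca : ∀ t {i j} → ca t i ≡ ca t j → ma t i ≡ ma t j
  ma-of-ca t {i} {j} eq with ≤-total i j
  ... | inj₁ i≤j = ma-constant t i≤j eq
  ... | inj₂ j≤i = sym (ma-constant t j≤i (sym eq))

  ca⇒ma : ∀ t i → 1 ≤ ca t i → 1 ≤ ma t i
  ca⇒ma t (suc i) 1≤ with step-cases t i
  ... | inj₁ σ = subst (1 ≤_) (sym (Same.ma-old σ)) (ca⇒ma t i (subst (1 ≤_) (Same.ca-old σ) 1≤))
  ... | inj₂ δ = subst (1 ≤_) (sym (Change.ma-new δ)) (rel⇒1≤cv {t} {i} (Change.relevant δ))

  -- Every change lowers the minimum by at least 1, except the first, which replaces the code 0 of
  -- infinity; hence the counter has to be positive.
  ma-decreases : ∀ t {i j} → i ≤ j → 1 ≤ ca t i → ma t j + ca t j ≤ ma t i + ca t i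
  ma-decreases t {i} {zero}  z≤n _ = ≤-refl
  ma-decreases t {i} {suc j} i≤j 1≤ with m≤n⇒m<n∨m≡n i≤j
  ... | inj₂ refl = ≤-refl
  ... | inj₁ i<j with step-cases t j | ma-decreases t {i} {j} (≤-pred i<j) 1≤
  ... | inj₁ σ | le = subst₂ (λ m c → m + c ≤ ma t i + ca t i) (sym (Same.ma-old σ)) (sym (Same.ca-old σ)) le
  ... | inj₂ δ | le with Change.improves δ
  ... | inj₁ m≡0 = contradiction (subst (1 ≤_) m≡0 (ca⇒ma t j (≤-trans 1≤ (ca-mono t (≤-pred i<j))))) λ ()
  ... | inj₂ c<m = ≤-trans (subst₂ (λ m c → m + c ≤ ma t j + ca t j) (sym (Change.ma-new δ)) (sym (Change.ca-new δ))
                     (subst (_≤ ma t j + ca t j) (sym (+-suc _ (ca t j))) (+-monoˡ-≤ (ca t j) c<m))) le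

  ma-witness : ∀ t i → 1 ≤ ma t i → ∃[ j ] j < i × rel t j ≡ 1 × ma t i ≡ cv t j
  ma-witness t (suc i) 1≤ with step-cases t i
  ... | inj₂ δ = i , ≤-refl , Change.relevant δ , Change.ma-new δ
  ... | inj₁ σ with ma-witness t i (subst (1 ≤_) (Same.ma-old σ) 1≤)
  ... | j , j<i , r , eq = j , m≤n⇒m≤1+n j<i , r , trans (Same.ma-old σ) eq

  ma-relevant : ∀ t i → rel t i ≡ 1 → 1 ≤ ma t (suc i) × ma t (suc i) ≤ cv t i
  ma-relevant t i r with step-cases t i
  ... | inj₁ σ = subst (λ m → 1 ≤ m × m ≤ cv t i) (sym (Same.ma-old σ)) (Same.enough σ r)
  ... | inj₂ δ = subst (1 ≤_) (sym (Change.ma-new δ)) (rel⇒1≤cv {t} {i} r) , ≤-reflexive (Change.ma-new δ)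

  -- The column of the change from c to c + 1 changes; junk unless c < ca t i.
  change : ℕ → ℕ → ℕ → ℕ
  change t c zero    = 0
  change t c (suc i) = if c <ᵇ ca t i then change t c i else i

  change-spec : ∀ t c i → c < ca t i → change t c i < i × ca t (change t c i) ≡ c × ca t (suc (change t c i)) ≡ suc c
  change-spec t c (suc i) c< with c <ᵇ ca t i in eq
  ... | true  = let (<i , eqs) = change-spec t c i (<ᵇ⇒< c _ (subst T (sym eq) tt)) in m≤n⇒m≤1+n <i , eqs
  ... | false = ≤-refl ,
    ≤-antisym ca≤c (≤-pred (≤-trans c< (proj₂ (ca-suc t i)))) ,
    ≤-antisym (≤-trans (proj₂ (ca-suc t i)) (s≤s ca≤c)) c<
    where
    ca≤c : ca t i ≤ c
    ca≤c = ≮⇒≥ λ c<′ → subst T eq (<⇒<ᵇ c<′)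

  changes : ∀ {t i} → ca t (suc i) ≡ suc (ca t i) → Change t i
  changes {t} {i} eq with step-cases t i
  ... | inj₁ σ = contradiction (trans (sym eq) (Same.ca-old σ)) 1+n≢n
  ... | inj₂ δ = δ

  ca<K₁ : ∀ {t i} → t < n → i ≤ n → ca t i < K₁
  ca<K₁ {t} {i} t<n i≤n = subst (suc (ca t i) ≤_) (+-comm 1 (km n)) (s≤s (≤-trans (ca-mono t {i} {n} i≤n) (ca≤km n t<n)))

  <n₁ : ∀ {i} → i ≤ n → i < n₁
  <n₁ {i} i≤n = subst (i <_) (+-comm 1 n) (s≤s i≤n)

  ≤n : ∀ {i} → i < n₁ → i ≤ n
  ≤n {i} i<n₁ = ≤-pred (subst (i <_) (+-comm n 1) i<n₁)

  LE LV RV : ℕ → ℕ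
  LE = scattered (λ t i → t * K₁ + ca t i) (λ _ i → i) n₁ n
  LV = scattered (λ t i → t * K₁ + ca t i) ma n₁ n
  RV = scattered (λ t v → cum r* t * n + v) (λ t v → C (n * t + v)) n n

  LV-at : ∀ {t i} → t < n → i ≤ n → LV (t * K₁ + ca t i) ≡ ma t i
  LV-at {t} {i} t<n i≤n
    with scattered-at {λ t i → t * K₁ + ca t i} {ma} {n₁} {n} t i t<n (<n₁ i≤n)
  ... | t′ , i′ , t′<n , i′< , eq , val , _
    with rowMajor-injective {K₁} {t′} {t} (ca<K₁ t′<n (≤n i′<)) (ca<K₁ t<n i≤n) eq
  ... | refl , eq′ = trans val (ma-of-ca t {i′} {i} eq′)

  -- The columns with counter `c` write to this cell in increasing order, so it keeps the last of
  -- them.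
  LE-at : ∀ {t c} → t < n → c < ca t n → ca t (LE (t * K₁ + c)) ≡ c × (∀ i → i ≤ n → ca t i ≡ c → i ≤ LE (t * K₁ + c))
  LE-at {t} {c} t<n c< with change-spec t c n c<
  ... | i< , eqc , _
    with scattered-at {λ t i → t * K₁ + ca t i} {λ _ i → i} {n₁} {n} t (change t c n) t<n (<n₁ (<⇒≤ i<))
  ... | t′ , i′ , t′<n , i′< , eq , val , last
    with rowMajor-injective {K₁} {t′} {t} (ca<K₁ t′<n (≤n i′<)) (ca<K₁ t<n (<⇒≤ i<)) eq
  ... | refl , eq′ rewrite eqc = trans (cong (ca t) val) eq′ , λ i i≤n eqi →
    subst (i ≤_) (sym val) (case last t i t<n (<n₁ i≤n) (cong (t * K₁ +_) eqi) of λ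
      { (inj₁ t<t) → contradiction t<t (<-irrefl refl) ; (inj₂ (_ , i≤)) → i≤ })

  -- As the counter is monotone, the run with counter `p` has ended before column `i` exactly if the
  -- counter exceeds `p` there. A query recovers `ca t i` by this comparison.
  LE-search : ∀ {t i p} → t < n → i ≤ n → p < ca t n →
              (suc p ≤ ca t i → LE (t * K₁ + p) < i) × (LE (t * K₁ + p) < i → suc p ≤ ca t i)
  LE-search {t} {i} {p} t<n i≤n p< with LE-at t<n p<
  ... | eq , last = (λ p<ca → ≰⇒> λ i≤LE → <⇒≱ p<ca (subst (ca t i ≤_) eq (ca-mono t i≤LE))) ,
    λ LE<i → ≰⇒> λ ca≤p → <⇒≱ LE<i (last i i≤n (≤-antisym ca≤p (subst (_≤ ca t i) eq (ca-mono t (<⇒≤ LE<i)))))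

  cum-mono : ∀ r {t t′} → t ≤ t′ → cum r t ≤ cum r t′
  cum-mono r {t} {zero}   z≤n = ≤-refl
  cum-mono r {t} {suc t′} t≤ with m≤n⇒m<n∨m≡n t≤
  ... | inj₁ t<   = ≤-trans (cum-mono r (≤-pred t<)) (m≤m+n (cum r t′) _)
  ... | inj₂ refl = ≤-refl

  pivot-counted : ∀ {x} → apply mod (dep x) L ≡ r* → cum r* (suc x) ≡ suc (cum r* x)
  pivot-counted {x} eq = trans (cong (cum r* x +_) (equal-true eq)) (+-comm (cum r* x) 1)

  -- The vertices numbered behind one pivot and up to the next write to the same row. The pivot is
  -- the last of them, because `cum r*` grows right behind it.
  RV-at : ∀ {x v} → x < n → v < n → apply mod (dep x) L ≡ r* → RV (cum r* x * n + v) ≡ C (n * x + v)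
  RV-at {x} {v} x<n v<n pivot
    with scattered-at {λ t v → cum r* t * n + v} {λ t v → C (n * t + v)} {n} {n} x v x<n v<n
  ... | x′ , v′ , x′<n , v′<n , eq , val , last
    with rowMajor-injective {n} {cum r* x′} {cum r* x} v′<n v<n eq | last x v x<n v<n refl
  ... | _ , refl  | inj₂ (refl , _) = val
  ... | eq′ , _   | inj₁ x<x′ = contradiction (subst (cum r* (suc x) ≤_) eq′ (cum-mono r* x<x′))
                                  (<⇒≱ (≤-reflexive (sym (pivot-counted pivot))))

  row<pivots : ∀ {x} → x < n → apply mod (dep x) L ≡ r* → cum r* x < pivots
  row<pivots x<n pivot = ≤-trans (≤-reflexive (sym (pivot-counted pivot))) (cum-mono r* x<n)

  best-least : ∀ m {r} → r < m → cum (best m) n ≤ cum r n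
  best-least (suc m) {r} r≤m with bit-cases (cum m n) (cum (best m) n) | m≤n⇒m<n∨m≡n (≤-pred r≤m)
  ... | inj₁ (m< , eq) | inj₁ r<m  = subst (λ b → cum b n ≤ cum r n) (sym (sel-1 m (best m) eq)) (≤-trans (<⇒≤ m<) (best-least m r<m))
  ... | inj₁ (m< , eq) | inj₂ refl = ≤-reflexive (cong (λ b → cum b n) (sel-1 m (best m) eq))
  ... | inj₂ (≤m , eq) | inj₁ r<m  = subst (λ b → cum b n ≤ cum r n) (sym (sel-0 m (best m) eq)) (best-least m r<m)
  ... | inj₂ (≤m , eq) | inj₂ refl = subst (λ b → cum b n ≤ cum m n) (sym (sel-0 m (best m) eq)) ≤m

  below-R : (ℕ → ℕ) → ℕ → ℕ
  below-R f zero    = 0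
  below-R f (suc R) = below-R f R + f R

  below-R-+ : ∀ f g R → below-R (λ r → f r + g r) R ≡ below-R f R + below-R g R
  below-R-+ f g zero    = refl
  below-R-+ f g (suc R) = trans (cong (_+ (f R + g R)) (below-R-+ f g R)) (eq (below-R f R) (below-R g R) (f R) (g R))
    where
    eq : ∀ a b c d → a + b + (c + d) ≡ a + c + (b + d)
    eq = solve-∀

  one-class : ∀ c R → (R ≤ c → below-R (apply equal c) R ≡ 0) × below-R (apply equal c) R ≤ 1
  one-class c zero    = (λ _ → refl) , z≤n
  one-class c (suc R) with c ≟ R | one-class c R
  ... | yes refl | none , _ = (λ R<R → contradiction R<R 1+n≰n) ,
    ≤-reflexive (trans (cong (_+ apply equal c c) (none ≤-refl)) (equal-true {c} refl))
  ... | no c≢R | none , ≤1 =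
    (λ R<c → trans (cong₂ _+_ (none (<⇒≤ R<c)) (equal-false c≢R)) refl) ,
    subst (λ b → below-R (apply equal c) R + b ≤ 1) (sym (equal-false c≢R)) (subst (_≤ 1) (sym (+-identityʳ _)) ≤1)

  classes≤ : ∀ R t → below-R (λ r → cum r t) R ≤ t
  classes≤ R zero = ≤-reflexive (zeros R)
    where
    zeros : ∀ R → below-R (λ _ → 0) R ≡ 0
    zeros zero    = refl
    zeros (suc R) = trans (+-identityʳ _) (zeros R)
  classes≤ R (suc t) = subst₂ _≤_ (sym (below-R-+ (λ r → cum r t) (apply equal (apply mod (dep t) L)) R)) (+-comm t 1)
    (+-mono-≤ (classes≤ R t) (proj₂ (one-class (apply mod (dep t) L) R)))

  -- Averaging: the `L` residue classes are disjoint, so their sizes sum to at most `n`, and the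
  -- chosen class is a smallest one.
  pivots-few : pivots * L ≤ n
  pivots-few = ≤-trans (subst (_≤ below-R (λ r → cum r n) L) (*-comm L pivots) (least L ≤-refl)) (classes≤ L n)
    where
    least : ∀ R → R ≤ L → R * pivots ≤ below-R (λ r → cum r n) R
    least zero    _   = z≤n
    least (suc R) R<L = subst (_≤ below-R (λ r → cum r n) (suc R)) (+-comm (R * pivots) pivots)
      (+-mono-≤ (least R (<⇒≤ R<L)) (best-least L R<L))

-- Distance codes form a tropical semiring in which 0 is infinite.
plus least : ℕ → ℕ → ℕ
plus x o  = pos x * (x + o)
least x y = sel (cap x) y (sel (cap y) x (sel (apply less x y) x y))

-- Two upper bounds, one of them attained, determine the minimum; the premises `1 ≤` make the
-- conditions void for infinite codes, which spares case distinctions at each use.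
least-spec : ∀ {c} a b → (1 ≤ a → 1 ≤ c × c ≤ a) → (1 ≤ b → 1 ≤ c × c ≤ b) →
             (1 ≤ c → (1 ≤ a × a ≤ c) ⊎ (1 ≤ b × b ≤ c)) → least a b ≡ c
least-spec {zero} zero    zero    _ _ _ = refl
least-spec {zero} (suc a) b       la lb _ = contradiction (proj₁ (la (s≤s z≤n))) λ ()
least-spec {zero} zero    (suc b) la lb _ = contradiction (proj₁ (lb (s≤s z≤n))) λ ()
least-spec {suc c} zero zero _ _ att with att (s≤s z≤n)
... | inj₁ (() , _)
... | inj₂ (() , _)
least-spec {suc c} zero (suc b) la lb att with att (s≤s z≤n)
... | inj₁ (() , _)
... | inj₂ (_ , b≤c) = trans (sel-1 {1} (suc b) 0 refl) (≤-antisym b≤c (proj₂ (lb (s≤s z≤n))))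
least-spec {suc c} (suc a) zero la lb att with att (s≤s z≤n)
... | inj₂ (() , _)
... | inj₁ (_ , a≤c) = trans (sel-0 {0} 0 _ refl) (trans (sel-1 {1} (suc a) 0 refl) (≤-antisym a≤c (proj₂ (la (s≤s z≤n)))))
least-spec {suc c} (suc a) (suc b) la lb att =
  trans (sel-0 {0} (suc b) _ refl) (trans (sel-0 {0} (suc a) _ refl) (smaller (bit-cases (suc a) (suc b))))
  where
  c≤a = proj₂ (la (s≤s z≤n))
  c≤b = proj₂ (lb (s≤s z≤n))
  smaller : (suc a < suc b × apply less (suc a) (suc b) ≡ 1) ⊎ (suc b ≤ suc a × apply less (suc a) (suc b) ≡ 0) →
            sel (apply less (suc a) (suc b)) (suc a) (suc b) ≡ suc c
  smaller (inj₁ (a<b , eq)) with att (s≤s z≤n)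
  ... | inj₁ (_ , a≤c) = trans (sel-1 (suc a) (suc b) eq) (≤-antisym a≤c c≤a)
  ... | inj₂ (_ , b≤c) = contradiction (≤-trans b≤c c≤a) (<⇒≱ a<b)
  smaller (inj₂ (b≤a , eq)) with att (s≤s z≤n)
  ... | inj₂ (_ , b≤c) = trans (sel-0 (suc a) (suc b) eq) (≤-antisym b≤c c≤b)
  ... | inj₁ (_ , a≤c) = trans (sel-0 (suc a) (suc b) eq) (≤-antisym (≤-trans b≤a a≤c) c≤b)

-- Going up by the offset of k beyond the class r leads into that class.
pivot-mod : ∀ k L r → r < L → apply mod (k + L ∸ r) L ≤ k → apply mod (k ∸ apply mod (k + L ∸ r) L) L ≡ r
pivot-mod k (suc l) r r<L h≤k = from-quotient (m / L) decompose
  where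
  L = suc l
  m = k + L ∸ r
  h = m % L
  d = k ∸ h
  open ≡-Reasoning
  decompose : d + L ≡ m / L * L + r
  decompose = +-cancelˡ-≡ h _ _ (begin
    h + (d + L)            ≡⟨ sym (+-assoc h d L) ⟩
    h + d + L              ≡⟨ cong (_+ L) (m+[n∸m]≡n h≤k) ⟩
    k + L                  ≡⟨ sym (m∸n+n≡m (≤-trans (<⇒≤ r<L) (m≤n+m L k))) ⟩
    m + r                  ≡⟨ cong (_+ r) (m≡m%n+[m/n]*n m L) ⟩
    h + m / L * L + r      ≡⟨ +-assoc h _ r ⟩
    h + (m / L * L + r)    ∎)
  from-quotient : ∀ q → d + L ≡ q * L + r → d % L ≡ r
  from-quotient zero eq = contradiction (subst (L ≤_) eq (m≤n+m L d)) (<⇒≱ r<L)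
  from-quotient (suc q) eq = begin
    d % L              ≡⟨ cong (_% L) (+-cancelˡ-≡ L _ _ (trans (+-comm L d) (trans eq (+-assoc L (q * L) r)))) ⟩
    (q * L + r) % L    ≡⟨ cong (_% L) (+-comm (q * L) r) ⟩
    (r + q * L) % L    ≡⟨ [m+kn]%n≡m%n r q L ⟩
    r % L              ≡⟨ m<n⇒m%n≡m r<L ⟩
    r                  ∎

-- Correctness of the tabulated answers

module Correctness {n} (G : Graph n) (full : ∀ z → z ∈ vertices G) (s : Fin n) (T : Parents n)
                   (tree : IsShortestPathTree G s T) {H : Fin n → Graph n}
                   (failures : Failures G T H) (C : Fin n → Fin n → ℕ)
                   {M : ℕ} .{{_ : NonZero M}} (range : WeightsInRange M G)
                   (par w cells : ℕ → ℕ)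
                   (par≤ : ∀ v → par v ≤ n) (w≤ : ∀ v → w v ≤ M) (cells≤ : ∀ i → cells i ≤ suc (n * M))
                   (par-at : ∀ v → par (toℕ v) ≡ maybe′ (λ (p , _) → suc (toℕ p)) 0 (T v))
                   (w-at : ∀ v → w (toℕ v) ≡ maybe′ proj₂ 0 (T v))
                   (cell-at : ∀ t v → cells (n * toℕ t + toℕ v) ≡ C t v)
                   -- A column of the edge table that names no tree edge holds 0 throughout, which
                   -- need not be a code. Validity excludes such names, and all vertices of the tree
                   -- have it.
                   (Valid : Fin n → Set)
                   (coded : ∀ {v} → Valid v → ∀ t → IsCode (H v) s t (C t v))
                   (tree-valid : ∀ {v k d} → Up T s v k d → Valid v) where
  open IsShortestPathTree tree
  open Tree G full s T tree
  open Failing failures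
  open Coded C
  open Counting G full s T tree failures C range using (few-relevant)

  1≤n : 1 ≤ n
  1≤n = ≤-trans (s≤s z≤n) (Fin.toℕ<n s)

  open Tables n (toℕ s) par w cells
  open Bounds 1≤n par≤ w≤ cells≤
  open TableFacts n (toℕ s) par w cells 1≤n par≤ w≤ cells≤

  private
    variable
      a b y : Fin n
      d e i j k : ℕ

  par-just : ∀ {v p w₀} → T v ≡ just (p , w₀) → par (toℕ v) ≡ suc (toℕ p)
  par-just {v} eq = trans (par-at v) (cong (maybe′ (λ (p , _) → suc (toℕ p)) 0) eq)

  par-nothing : ∀ {v} → T v ≡ nothing → par (toℕ v) ≡ 0
  par-nothing {v} eq = trans (par-at v) (cong (maybe′ (λ (p , _) → suc (toℕ p)) 0) eq)

  anc-up : Up T a t j d → anc j (toℕ t) ≡ suc (toℕ a) × len j (toℕ t) ≡ d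
  anc-up stop = +-comm _ 1 , refl
  anc-up {t = t} (up {a = a} {w = w₀} {j = j} {d = d} eq U) with anc j (toℕ t) | anc-up U
  ... | _ | refl , l =
    trans (+-identityʳ _) (par-just eq) ,
    trans (cong₂ _+_ l (trans (+-identityʳ _) (trans (w-at a) (cong (maybe′ proj₂ 0) eq)))) (+-comm d w₀)

  anc-view : ∀ j t → (∃[ a ] ∃[ d ] Up T a t j d) ⊎ anc j (toℕ t) ≡ 0
  anc-view zero    t = inj₁ (t , 0 , stop)
  anc-view (suc j) t with anc-view j t
  ... | inj₂ eq = inj₂ (cong (λ a → pos a * par (a ∸ 1)) eq)
  ... | inj₁ (a , d , U) with T a in eq
  ... | just (p , w₀) = inj₁ (p , w₀ + d , up eq U)
  ... | nothing = inj₂ (trans (cong (λ a → pos a * par (a ∸ 1)) (proj₁ (anc-up U)))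
                    (trans (+-identityʳ _) (par-nothing eq)))

  above-root : Up T s t k d → ∀ i → anc (suc (k + i)) (toℕ t) ≡ 0
  above-root {t = t} {k = k} S i with anc-view (suc (k + i)) t
  ... | inj₂ eq = eq
  ... | inj₁ (a , d , U) = contradiction (up-≤ S U) (<⇒≱ (s≤s (m≤m+n k i)))

  -- The ancestors at the heights 0 to `k` are distinct by `height-unique`.
  depth<n : Up T s t k d → k < n
  depth<n {t = t} {k = k} {d = d} S = Fin.injective⇒≤ {f = λ i → proj₁ (at i)} injective
    where
    at : (i : Fin (suc k)) → ∃[ a ] ∃[ e ] Up T a t (toℕ i) e
    at i = let (a , _ , e , _ , U , _) = up-split (k ∸ toℕ i) (subst (λ k → Up T s t k d) (sym (m∸n+n≡m (≤-pred (Fin.toℕ<n i)))) S)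
           in a , e , U
    injective : ∀ {i j} → proj₁ (at i) ≡ proj₁ (at j) → i ≡ j
    injective {i} {j} eq = Fin.toℕ-injective
      (proj₁ (height-unique S (proj₂ (proj₂ (at i)))
        (subst (λ a → Up T a t (toℕ j) (proj₁ (proj₂ (at j)))) (sym eq) (proj₂ (proj₂ (at j))))))

  ancestor : Up T s t k d → i ≤ k → ∃[ a ] ∃[ e ] Up T a t i e
  ancestor {k = k} {i = i} S i≤k =
    let (a , _ , e , _ , U , _) = up-split (k ∸ i) (subst (λ k → Up T s _ k _) (sym (m∸n+n≡m i≤k)) S) in a , e , U

  cnt-below : Up T s t k d → ∀ j → j ≤ k → cnt j (toℕ t) ≡ j
  cnt-below S zero    _   = refl
  cnt-below S (suc j) j<k =
    let (_ , _ , U) = ancestor S j<k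
    in trans (cong₂ (λ c a → c + pos a) (cnt-below S j (<⇒≤ j<k)) (proj₁ (anc-up U))) (+-comm j 1)

  cnt-above : Up T s t k d → ∀ i → cnt (k + i) (toℕ t) ≡ k
  cnt-above {k = k} S zero = trans (cong (λ j → cnt j _) (+-identityʳ k)) (cnt-below S k ≤-refl)
  cnt-above {t = t} {k = k} S (suc i) = trans (cong (λ j → cnt j (toℕ t)) (+-suc k i))
    (trans (cong₂ (λ c a → c + pos a) (cnt-above S i) (above-root S i)) (+-identityʳ k))

  dep-tree : Up T s t k d → dep (toℕ t) ≡ k
  dep-tree {t = t} {k = k} S = trans (cong (λ j → cnt j (toℕ t)) (sym (m+[n∸m]≡n (<⇒≤ (depth<n S))))) (cnt-above S (n ∸ k))

  len-above : Up T s t k d → ∀ i → len (k + i) (toℕ t) ≡ d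
  len-above {t = t} {k = k} S zero = trans (cong (λ j → len j (toℕ t)) (+-identityʳ k)) (proj₂ (anc-up S))
  len-above {t = t} {k = k} {d = d} S (suc i) = trans (cong (λ j → len j (toℕ t)) (+-suc k i))
    (trans (cong₂ _+_ (len-above S i) (stays i)) (+-identityʳ d))
    where
    stays : ∀ i → pos (anc (k + i) (toℕ t)) * w (anc (k + i) (toℕ t) ∸ 1) ≡ 0
    -- The root itself is still counted as an ancestor, but no edge lies above it, so its weight
    -- cell holds 0.
    stays zero = trans (cong (λ a → pos a * w (a ∸ 1)) (trans (cong (λ j → anc j (toℕ t)) (+-identityʳ k)) (proj₁ (anc-up S))))
      (trans (+-identityʳ _) (trans (w-at s) (cong (maybe′ proj₂ 0) rootless)))
    stays (suc i) = cong (λ a → pos a * w (a ∸ 1)) (trans (cong (λ j → anc j (toℕ t)) (+-suc k i)) (above-root S i))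

  has-parent : Up T a t (suc j) d → ∃[ p ] ∃[ w₀ ] T t ≡ just (p , w₀)
  has-parent (up eq stop)        = _ , _ , eq
  has-parent (up eq U@(up _ _)) = has-parent U

  dst-tree : Up T s t k d → dst (toℕ t) ≡ suc d
  dst-tree {t = t} {k = k} S = trans (cong₂ (λ b l → b * suc l) (inside S) total) (+-identityʳ _)
    where
    total = trans (cong (λ j → len j (toℕ t)) (sym (m+[n∸m]≡n (<⇒≤ (depth<n S))))) (len-above S (n ∸ k))
    inside : Up T s t j e → pos (apply equal (toℕ t) (toℕ s) + par (toℕ t)) ≡ 1
    inside stop = pos-1 (subst (λ b → 1 ≤ b + par (toℕ s)) (sym (equal-true {toℕ s} refl)) (s≤s z≤n))
    inside S@(up _ _) = let (_ , _ , eq) = has-parent S in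
      pos-1 (subst (λ p → 1 ≤ apply equal (toℕ t) (toℕ s) + p) (sym (par-just eq)) (subst (1 ≤_) (sym (+-suc _ _)) (s≤s z≤n)))

  data Reach (t : Fin n) : Set where
    inside  : ∀ {k d} → Up T s t k d → Reach t
    outside : dst (toℕ t) ≡ 0 → dep (toℕ t) ≡ 0 → (∀ {ℓ} → ¬ Walk G s t ℓ) → Reach t

  reach : ∀ t → Reach t
  reach t with t Fin.≟ s | T t in eq
  ... | yes refl | _ = inside stop
  ... | no _ | just _ = let (_ , B) = rooted eq in inside (proj₂ (Branch⇒Up B))
  ... | no t≢s | nothing = outside
      (cong (λ b → pos b * suc (len n (toℕ t))) (cong₂ _+_ (equal-false (t≢s ∘ Fin.toℕ-injective)) (par-nothing eq)))
      (none n)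
      (λ p → unreachable (proj₂ (proj₂ (reachable p))))
    where
    unreachable : ¬ Up T s t k d
    unreachable stop = t≢s refl
    unreachable S@(up _ _) with trans (sym eq) (proj₂ (proj₂ (has-parent S)))
    ... | ()
    anc-none : ∀ j → anc (suc j) (toℕ t) ≡ 0
    anc-none j with anc-view (suc j) t
    ... | inj₂ eq₀ = eq₀
    ... | inj₁ (_ , _ , U) with trans (sym eq) (proj₂ (proj₂ (has-parent U)))
    ... | ()
    none : ∀ j → cnt j (toℕ t) ≡ 0
    none zero    = refl
    none (suc j) = cong₂ (λ c a → c + pos a) (none j) (anc-none j)

  fail : (t i : ℕ) → t < n → Fin n
  fail t i t<n = fromℕ< (anc-1< (dep t ∸ i) t<n)

  toℕ-pred : ∀ {c} (a : Fin n) → c ≡ suc (toℕ a) → c ∸ 1 ≡ toℕ a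
  toℕ-pred a eq = cong (_∸ 1) eq

  module Listed {t x : Fin n} {k ℓ off₀} (S : Up T s t k ℓ) (U : Up T x t (hop (toℕ t)) off₀) where

    τ h : ℕ
    τ = toℕ t
    h = hop τ

    px-eq : px τ ∸ 1 ≡ toℕ x
    px-eq = toℕ-pred x (proj₁ (anc-up U))

    off-eq : off τ ≡ off₀
    off-eq = proj₂ (anc-up U)

    at-depth : ∀ i {v e} → Up T v t (k ∸ i) e → anc (dep τ ∸ i) τ ∸ 1 ≡ toℕ v
    at-depth i {v} V = toℕ-pred v (trans (cong (λ d → anc (d ∸ i) τ) (dep-tree S)) (proj₁ (anc-up V)))

    cv-eq : ∀ i {v e} → Up T v t (k ∸ i) e → cv τ i ≡ C t v
    cv-eq i {v} V = trans (cong (λ a → cells (n * τ + a)) (at-depth i V)) (cell-at t v)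

    cx-eq : ∀ i {v e} → Up T v t (k ∸ i) e → cx τ i ≡ C x v
    cx-eq i {v} V = trans (cong₂ (λ p a → cells (n * p + a)) px-eq (at-depth i V)) (cell-at x v)

    rel-sound : ∀ i → rel τ i ≡ 1 → i + h < k × (∀ {v e} → Up T v t (k ∸ i) e → Relevant t x v off₀)
    rel-sound i r with *-1⁻ (apply less (i + h) (dep τ)) _ r
    ... | deep , r′ with *-1⁻ (pos (cv τ i)) _ r′
    ... | positive , r″ = subst (i + h <_) (dep-tree S) (less-1⁻ (i + h) (dep τ) deep) , λ {v} V →
      subst (1 ≤_) (cv-eq i V) (pos-1⁻ (cv τ i) positive) , detours V (pos-1⁻ _ r″)
      where
      detours : ∀ {v e} → Up T v t (k ∸ i) e → 1 ≤ cap (cx τ i) + apply less (cv τ i) (cx τ i + off τ) →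
                C x v ≡ 0 ⊎ C t v < C x v + off₀
      detours V 1≤ with cx τ i ≟ 0 | bit-cases (cv τ i) (cx τ i + off τ)
      ... | yes eq | _ = inj₁ (trans (sym (cx-eq i V)) eq)
      ... | no _   | inj₁ (c< , _) = inj₂ (subst₂ _<_ (cv-eq i V) (cong₂ _+_ (cx-eq i V) off-eq) c<)
      ... | no ≢0  | inj₂ (_ , eq) = contradiction (subst (1 ≤_) (cong₂ _+_ (equal-false ≢0) eq) 1≤) λ ()

    rel-complete : ∀ i {v e} → i + h < k → Up T v t (k ∸ i) e → Relevant t x v off₀ → rel τ i ≡ 1
    rel-complete i {v} i+h<k V (1≤C , detours) =
      cong₂ _*_ (less-true (subst (i + h <_) (sym (dep-tree S)) i+h<k))
        (cong₂ _*_ (pos-1 (subst (1 ≤_) (sym (cv-eq i V)) 1≤C)) (pos-1 (positive detours)))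
      where
      positive : C x v ≡ 0 ⊎ C t v < C x v + off₀ → 1 ≤ cap (cx τ i) + apply less (cv τ i) (cx τ i + off τ)
      positive (inj₁ eq) = ≤-trans (≤-reflexive (sym (equal-true (trans (cx-eq i V) eq)))) (m≤m+n _ _)
      positive (inj₂ c<) = ≤-trans (≤-reflexive (sym (less-true {cv τ i} {cx τ i + off τ}
        (subst₂ _<_ (sym (cv-eq i V)) (sym (cong₂ _+_ (cx-eq i V) off-eq)) c<)))) (m≤n+m _ (cap (cx τ i)))

    -- The height is `k - i - h`, written as a successor because it is positive; comparisons of
    -- heights then reduce to monotonicity of truncated subtraction.
    above-x : ∀ {i v e} → i + h < k → Up T v t (k ∸ i) e → ∃[ e′ ] Up T v x (suc (k ∸ suc (i + h))) e′
    above-x {i} {v} i+h<k V =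
      let (e′ , W , _) = up-rest V U (≤-trans (≤-reflexive (sym (m+n∸m≡n i h))) (∸-monoˡ-≤ i (<⇒≤ i+h<k)))
      in e′ , subst (λ j → Up T v x j e′) (trans (∸-+-assoc k i h) (+-∸-assoc 1 i+h<k)) W

    distance≤code : ∀ {v} → Valid v → 1 ≤ C t v → suc ℓ ≤ C t v
    distance≤code {v} valid 1≤C = from-code (C t v) refl
      where
      from-code : ∀ c → C t v ≡ c → suc ℓ ≤ C t v
      from-code zero    eq = contradiction (subst (1 ≤_) eq 1≤C) 1+n≰n
      from-code (suc d) eq = subst (suc ℓ ≤_) (sym eq) (s≤s (tree-shortest S (toG (attained (coded valid t) eq))))

    valid-above : ∀ {v j e} → Up T v t j e → Valid v
    valid-above V = let (_ , _ , W , _) = depth-split S V in tree-valid W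

    few-changes : ca τ n * ca τ n ≤ 16 * (M * n)
    few-changes = from-count (ca τ n) refl
      where
      from-count : ∀ K → ca τ n ≡ K → ca τ n * ca τ n ≤ 16 * (M * n)
      from-count zero eq = subst (λ K → K * K ≤ 16 * (M * n)) (sym eq) z≤n
      from-count (suc m) eq = subst (λ K → K * K ≤ 16 * (M * n)) (sym eq)
        (few-relevant S U m vertex (λ c → suc (k ∸ suc (index c + h))) (λ c → len (suc (k ∸ suc (index c + h))) (toℕ x))
          above (λ c≤m → coded (valid c≤m)) (λ c≤m → proj₂ (sound c≤m) (V c≤m)) descends drops)
        where
        index : ℕ → ℕ
        index c = change τ c n
        spec : ∀ {c} → c ≤ m → index c < n × ca τ (index c) ≡ c × ca τ (suc (index c)) ≡ suc c
        spec {c} c≤m = change-spec τ c n (subst (c <_) (sym eq) (s≤s c≤m))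
        changed : ∀ {c} → c ≤ m → Change τ (index c)
        changed c≤m = let (_ , eq₁ , eq₂) = spec c≤m in changes (trans eq₂ (cong suc (sym eq₁)))
        sound : ∀ {c} → c ≤ m → index c + h < k × (∀ {v e} → Up T v t (k ∸ index c) e → Relevant t x v off₀)
        sound {c} c≤m = rel-sound (index c) (Change.relevant (changed c≤m))
        vertex : ℕ → Fin n
        vertex c = fail τ (index c) (Fin.toℕ<n t)
        V′ : ∀ {c} → c ≤ m → ∃[ a ] ∃[ e ] Up T a t (k ∸ index c) e × a ≡ vertex c
        V′ {c} c≤m =
          let (a , e , W) = ancestor S (m∸n≤m k (index c))
          in a , e , W , Fin.toℕ-injective (trans (sym (at-depth (index c) W)) (sym (Fin.toℕ-fromℕ< _)))
        V : ∀ {c} (c≤m : c ≤ m) → Up T (vertex c) t (k ∸ index c) (proj₁ (proj₂ (V′ c≤m)))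
        V {c} c≤m = let (_ , e , W , eq) = V′ c≤m in subst (λ a → Up T a t (k ∸ index c) e) eq W
        valid : ∀ {c} → c ≤ m → Valid (vertex c)
        valid c≤m = valid-above (V c≤m)
        above : ∀ {c} → c ≤ m → Up T (vertex c) x (suc (k ∸ suc (index c + h))) (len (suc (k ∸ suc (index c + h))) (toℕ x))
        above {c} c≤m =
          let (e , W) = above-x (proj₁ (sound c≤m)) (V c≤m)
          in subst (Up T (vertex c) x _) (sym (proj₂ (anc-up W))) W
        index-mono : ∀ {b c} → b < c → c ≤ m → index b < index c
        index-mono {b} {c} b<c c≤m = ≰⇒> λ ic≤ib → <⇒≱ b<c
          (subst₂ _≤_ (proj₁ (proj₂ (spec c≤m))) (proj₁ (proj₂ (spec (≤-trans (<⇒≤ b<c) c≤m)))) (ca-mono τ ic≤ib))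
        descends : ∀ {b c} → b < c → c ≤ m → suc (k ∸ suc (index c + h)) < suc (k ∸ suc (index b + h))
        descends b<c c≤m = s≤s (∸-monoʳ-< (s≤s (+-monoˡ-< h (index-mono b<c c≤m))) (proj₁ (sound c≤m)))
        value : ∀ {c} (c≤m : c ≤ m) → C t (vertex c) + suc c ≡ ma τ (suc (index c)) + ca τ (suc (index c))
        value {c} c≤m = cong₂ _+_ (trans (sym (cv-eq (index c) (V c≤m))) (sym (Change.ma-new (changed c≤m)))) (sym (proj₂ (proj₂ (spec c≤m))))
        -- Both sides are read off just behind the changes, where the counter is already positive,
        -- so `ma-decreases` covers the first change too.
        drops : ∀ {b c} → b ≤ c → c ≤ m → C t (vertex c) + c ≤ C t (vertex b) + b
        drops {b} {c} b≤c c≤m with m≤n⇒m<n∨m≡n b≤c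
        ... | inj₂ refl = ≤-refl
        ... | inj₁ b<c  = ≤-pred (subst₂ _≤_ (trans (sym (value c≤m)) (+-suc _ c)) (trans (sym (value b≤m)) (+-suc _ b))
          (ma-decreases τ (s≤s (<⇒≤ (index-mono b<c c≤m))) (subst (1 ≤_) (sym (proj₂ (proj₂ (spec b≤m)))) (s≤s z≤n))))
          where b≤m = ≤-trans b≤c c≤m

    -- The minimum is the replacement distance for some relevant failure at or above `v`, and
    -- `relevant-lower` transfers it to `v`.
    list-lower : ∀ {i v e} → i + h < k → Up T v t (k ∸ i) e → 1 ≤ ma τ (suc i) → 1 ≤ C t v × C t v ≤ ma τ (suc i)
    list-lower {i} i+h<k V 1≤ =
      let (j , j≤i , r , eq)  = ma-witness τ (suc i) 1≤
          (j+h<k , rel′)      = rel-sound j r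
          (v′ , e′ , V′)      = ancestor S (m∸n≤m k j)
          (1≤C , C≤) = relevant-lower (coded (valid-above V)) (coded (valid-above V′)) S U
            (proj₂ (above-x j+h<k V′)) (proj₂ (above-x i+h<k V))
            (s≤s (∸-monoʳ-≤ k (+-monoˡ-≤ h j≤i))) (rel′ V′)
      in 1≤C , ≤-trans C≤ (≤-reflexive (sym (trans eq (cv-eq j V′))))

    outside-code : ∀ {v y j d} → Up T s y j d → (∀ {i e} → ¬ Up T v y i e) → IsCode (H v) s y (suc d)
    outside-code Y ¬V = record
      { lower    = λ p → s≤s z≤n , s≤s (tree-shortest Y (toG p))
      ; attained = λ { refl → avoiding Y λ { W _ refl → ¬V W } } }

    -- The candidate through `x` is realised by a walk, and `listed` vouches for the other one. If
    -- going through `x` is not optimal, `v` is relevant and the list has the value.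
    inside-code : ∀ {v i e F} → Valid v → h < i → Up T v t i e → (1 ≤ F → 1 ≤ C t v × C t v ≤ F) →
                  (Relevant t x v off₀ → 1 ≤ F × F ≤ C t v) → least (plus (C x v) off₀) F ≡ C t v
    inside-code {v} {i} {e} {F} valid h<i V listed from-relevant = least-spec _ _ through-x listed attains
      where
      through-x : 1 ≤ plus (C x v) off₀ → 1 ≤ C t v × C t v ≤ plus (C x v) off₀
      through-x = from-code (C x v) refl
        where
        from-code : ∀ c → C x v ≡ c → 1 ≤ plus c off₀ → 1 ≤ C t v × C t v ≤ plus (C x v) off₀
        from-code (suc d) eq _ = subst (λ c → 1 ≤ C t v × C t v ≤ plus c off₀) (sym eq)
          (subst (λ c → 1 ≤ C t v × C t v ≤ c) (sym (+-identityʳ _))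
            (lower (coded valid t) (attained (coded valid x) eq ++ʷ
              avoiding U λ { W j≤h refl → <⇒≱ h<i (subst (_≤ h) (proj₁ (height-unique S W V)) j≤h) })))
      attains : 1 ≤ C t v → (1 ≤ plus (C x v) off₀ × plus (C x v) off₀ ≤ C t v) ⊎ (1 ≤ F × F ≤ C t v)
      attains 1≤C = from-code (C x v) refl
        where
        from-code : ∀ c → C x v ≡ c → (1 ≤ plus (C x v) off₀ × plus (C x v) off₀ ≤ C t v) ⊎ (1 ≤ F × F ≤ C t v)
        from-code zero    eq = inj₂ (from-relevant (1≤C , inj₁ eq))
        from-code (suc d) eq with ≤-<-connex (suc d + off₀) (C t v)
        ... | inj₁ ≤C = inj₁ (subst (λ c → 1 ≤ plus c off₀ × plus c off₀ ≤ C t v) (sym eq)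
                          (s≤s z≤n , subst (_≤ C t v) (sym (+-identityʳ _)) ≤C))
        ... | inj₂ C< = inj₂ (from-relevant (1≤C , inj₂ (subst (λ c → C t v < c + off₀) (sym eq) C<)))

    code-unique : ∀ {v y c c′} → IsCode (H v) s y c → IsCode (H v) s y (suc c′) → c ≡ suc c′
    code-unique {c = zero}  γ γ′ = contradiction (proj₁ (lower γ (attained γ′ refl))) λ ()
    code-unique {c = suc c} γ γ′ = ≤-antisym (proj₂ (lower γ (attained γ′ refl))) (proj₂ (lower γ′ (attained γ refl)))

    -- A query for a failure in this range compares depths only and does not test whether `v` is an
    -- ancestor of `t`. If it is not, it is no ancestor of `x` either; the candidate through `x` is
    -- the tree distance, and no listed value is smaller.
    outside-least : ∀ {v F} → Valid v → (∀ {i e} → ¬ Up T v t i e) → (1 ≤ F → suc ℓ ≤ F) →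
                    least (plus (C x v) off₀) F ≡ suc ℓ
    outside-least {v} {F} valid ¬V listed = least-spec _ F
      (λ _ → s≤s z≤n , ≤-reflexive (sym plus≡)) (λ 1≤ → s≤s z≤n , listed 1≤)
      (λ _ → inj₁ (≤-trans (s≤s z≤n) (≤-reflexive (sym plus≡)) , ≤-reflexive plus≡))
      where
      plus≡ : plus (C x v) off₀ ≡ suc ℓ
      plus≡ = let (_ , δ , X , _ , eq) = depth-split S U in
        trans (cong (λ c → plus c off₀) (code-unique (coded valid x) (outside-code X λ V → ¬V (up-++ V U))))
              (trans (+-identityʳ _) (cong suc (sym eq)))

    -- The minimum is read at `suc` of the depth of `v`, so that the failure at this very depth
    -- takes part.
    long : ∀ {v} → Valid v → dep (toℕ v) + h < k →
           IsCode (H v) s t (least (plus (C x v) off₀) (ma τ (suc (dep (toℕ v)))))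
    long {v} valid deep = from-position (up? S v)
      where
      ν = dep (toℕ v)
      from-position : Dec (∃[ i ] ∃[ e ] i ≤ k × Up T v t i e) → IsCode (H v) s t (least (plus (C x v) off₀) (ma τ (suc ν)))
      from-position (yes (i , e , i≤k , V)) = subst (IsCode (H v) s t)
        (sym (inside-code valid h<i V′ (list-lower deep V′)
          (λ relevant → subst (λ c → 1 ≤ ma τ (suc ν) × ma τ (suc ν) ≤ c) (cv-eq ν V′)
            (ma-relevant τ ν (rel-complete ν deep V′ relevant))))) (coded valid t)
        where
        k∸ν≡i : k ∸ ν ≡ i
        k∸ν≡i = let (i₀ , _ , W , eq , _) = depth-split S V in trans (cong₂ _∸_ eq (dep-tree W)) (m+n∸m≡n i₀ i)
        V′ : Up T v t (k ∸ ν) e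
        V′ = subst (λ i → Up T v t i e) (sym k∸ν≡i) V
        h<i : h < k ∸ ν
        h<i = ≤-trans (≤-reflexive (sym (m+n∸m≡n ν (suc h)))) (∸-monoˡ-≤ ν (subst (_≤ k) (sym (+-suc ν h)) deep))
      from-position (no ¬anc) = subst (IsCode (H v) s t) (sym (outside-least valid ¬V listed)) (outside-code S ¬V)
        where
        ¬V : ∀ {i e} → ¬ Up T v t i e
        ¬V V = ¬anc (_ , _ , up-≤ S V , V)
        listed : 1 ≤ ma τ (suc ν) → suc ℓ ≤ ma τ (suc ν)
        listed 1≤ =
          let (j , _ , r , eq) = ma-witness τ (suc ν) 1≤
              (v′ , e′ , V′)   = ancestor S (m∸n≤m k j)
          in ≤-trans (distance≤code (valid-above V′) (proj₁ (proj₂ (rel-sound j r) V′)))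
                     (≤-reflexive (sym (trans eq (cv-eq j V′))))

  module _ (t : Fin n) where
    private τ = toℕ t

    -- The inequality also shows that `t` is in the tree, since vertices outside have depth 0.
    deep-pivot : hop τ < dep τ → ∃[ k ] ∃[ ℓ ] Up T s t k ℓ × dep τ ≡ k × ∃[ x ] ∃[ o ] Up T x t (hop τ) o × apply mod (dep (toℕ x)) L ≡ r*
    deep-pivot h<dep = from-reach (reach t)
      where
      from-reach : Reach t → ∃[ k ] ∃[ ℓ ] Up T s t k ℓ × dep τ ≡ k × ∃[ x ] ∃[ o ] Up T x t (hop τ) o × apply mod (dep (toℕ x)) L ≡ r*
      from-reach (outside _ eq _) = contradiction (subst (hop τ <_) eq h<dep) λ ()
      from-reach (inside {k} {ℓ} S) =
        let (x , o , U) = ancestor S (<⇒≤ (subst (hop τ <_) (dep-tree S) h<dep))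
            (i , _ , X , eq , _) = depth-split S U
        in k , ℓ , S , dep-tree S , x , o , U ,
          trans (cong (λ d → apply mod d L) (trans (dep-tree X) (trans (sym (m+n∸n≡m i (hop τ))) (cong (_∸ hop τ) (trans (sym eq) (sym (dep-tree S)))))))
                (pivot-mod (dep τ) L r* r*<L (<⇒≤ h<dep))

    few-changes : ca τ n * ca τ n ≤ 16 * (M * n)
    few-changes = from-count (ca τ n) refl
      where
      from-count : ∀ c → ca τ n ≡ c → ca τ n * ca τ n ≤ 16 * (M * n)
      from-count zero    eq = subst (λ c → c * c ≤ 16 * (M * n)) (sym eq) z≤n
      from-count (suc c) eq =
        let (j , _ , r , _) = ma-witness τ n (ca⇒ma τ n (subst (1 ≤_) (sym eq) (s≤s z≤n)))
            (k , ℓ , S , _ , x , o , U , _) = deep-pivot (≤-<-trans (m≤n+m (hop τ) j) (less-1⁻ (j + hop τ) (dep τ) (proj₁ (*-1⁻ _ _ r))))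
        in Listed.few-changes S U

    -- Only the ancestor of `t` at the depth of `v` can be `v`. If `v` is deeper than `t`, the
    -- difference is truncated to 0 and the test compares `v` with `t`, which rightly fails.
    near : ∀ {v} → Valid v → dep τ ∸ dep (toℕ v) ≤ hop τ → let j = dep τ ∸ dep (toℕ v) in
           IsCode (H v) s t (sel (apply equal (tid τ j) (toℕ v + 1)) (tv τ j) (dst τ))
    near {v} valid j≤h = from-test (tid τ (dep τ ∸ dep (toℕ v)) ≟ toℕ v + 1)
      where
      from-test : Dec (tid τ (dep τ ∸ dep (toℕ v)) ≡ toℕ v + 1) →
        IsCode (H v) s t (sel (apply equal (tid τ (dep τ ∸ dep (toℕ v))) (toℕ v + 1)) (tv τ (dep τ ∸ dep (toℕ v))) (dst τ))
      from-test (yes eq) = subst (IsCode (H v) s t)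
        (sym (trans (sel-1 (tv τ (dep τ ∸ dep (toℕ v))) (dst τ) (equal-true eq))
          (trans (cong (λ a → cells (n * τ + (a ∸ 1))) (trans eq (+-comm (toℕ v) 1))) (cell-at t v)))) (coded valid t)
      from-test (no ≢v) = subst (IsCode (H v) s t)
        (sym (sel-0 (tv τ (dep τ ∸ dep (toℕ v))) (dst τ) (equal-false ≢v))) (from-reach (reach t))
        where
        from-reach : Reach t → IsCode (H v) s t (dst τ)
        from-reach (outside eq _ none) = subst (IsCode (H v) s t) (sym eq) record
          { lower = λ p → contradiction (toG p) none ; attained = λ () }
        from-reach (inside S) = subst (IsCode (H v) s t) (sym (dst-tree S)) record
          { lower    = λ p → s≤s z≤n , s≤s (tree-shortest S (toG p))
          ; attained = λ { refl → avoiding S λ { V _ refl → ¬V V } } }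
          where
          ¬V : ∀ {i e} → ¬ Up T v t i e
          ¬V {i} V with depth-split S V
          ... | i₀ , _ , W , eq , _ = ≢v (trans (cong (λ j → anc j τ)
            (trans (cong₂ _∸_ (trans (dep-tree S) eq) (dep-tree W)) (m+n∸m≡n i₀ i)))
            (trans (proj₁ (anc-up V)) (+-comm 1 (toℕ v))))

    far : ∀ {v} → Valid v → hop τ < dep τ ∸ dep (toℕ v) →
          IsCode (H v) s t (least (plus (cells (n * (px τ ∸ 1) + toℕ v)) (off τ)) (ma τ (suc (dep (toℕ v)))))
    far {v} valid h<j =
      let (k , ℓ , S , eq , x , o , U , _) = deep-pivot (≤-trans h<j (m∸n≤m (dep τ) (dep (toℕ v))))
      in subst₂ (λ c o → IsCode (H v) s t (least (plus c o) (ma τ (suc (dep (toℕ v))))))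
        (sym (trans (cong (λ p → cells (n * p + toℕ v)) (Listed.px-eq S U)) (cell-at x v))) (sym (Listed.off-eq S U))
        (Listed.long S U valid (subst (dep (toℕ v) + hop τ <_) eq
          (≤-trans (≤-reflexive (sym (+-suc (dep (toℕ v)) (hop τ))))
            (≤-trans (+-monoʳ-≤ (dep (toℕ v)) h<j)
              (≤-reflexive (m+[n∸m]≡n {dep (toℕ v)} {dep τ} (<⇒≤ (m<n∸o⇒o<m {c = dep (toℕ v)} h<j))))))))
      where
      m<n∸o⇒o<m : ∀ {a b c} → a < b ∸ c → c < b
      m<n∸o⇒o<m {a} {b} {c} a< = ≰⇒> λ b≤c → contradiction (subst (a <_) (m≤n⇒m∸n≡0 b≤c) a<) λ ()

    far-pivot : ∀ {v : Fin n} → hop τ < dep τ ∸ dep (toℕ v) → px τ ∸ 1 < n × apply mod (dep (px τ ∸ 1)) L ≡ r*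
    far-pivot {v} h<j =
      let (_ , _ , S , _ , x , _ , U , class) = deep-pivot (≤-trans h<j (m∸n≤m (dep τ) (dep (toℕ v))))
      in subst (λ p → p < n × apply mod (dep p) L ≡ r*) (sym (Listed.px-eq S U)) (Fin.toℕ<n x , class)

  km-attained : ∀ t → km t ≡ 0 ⊎ (∃[ t′ ] t′ < t × km t ≡ ca t′ n)
  km-attained zero    = inj₁ refl
  km-attained (suc t) with bit-cases (km t) (ca t n) | km-attained t
  ... | inj₁ (_ , eq) | _ = inj₂ (t , ≤-refl , sel-1 (ca t n) (km t) eq)
  ... | inj₂ (_ , eq) | inj₁ eq′ = inj₁ (trans (sel-0 (ca t n) (km t) eq) eq′)
  ... | inj₂ (_ , eq) | inj₂ (t′ , t′<t , eq′) = inj₂ (t′ , m≤n⇒m≤1+n t′<t , trans (sel-0 (ca t n) (km t) eq) eq′)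

  km-few : km n * km n ≤ 16 * (M * n)
  km-few = from-cases (km-attained n)
    where
    from-cases : km n ≡ 0 ⊎ (∃[ t ] t < n × km n ≡ ca t n) → km n * km n ≤ 16 * (M * n)
    from-cases (inj₁ eq) = subst (λ K → K * K ≤ 16 * (M * n)) (sym eq) z≤n
    from-cases (inj₂ (t , t<n , eq)) = subst (λ K → K * K ≤ 16 * (M * n)) (sym eq)
      (subst (λ t → ca t n * ca t n ≤ 16 * (M * n)) (Fin.toℕ-fromℕ< t<n) (few-changes (fromℕ< t<n)))

-- The query program

stream-cell : ℕ → Expr → Expr
stream-cell k i = get 0 (i ⊗ lit 16 ⊕ lit k)

plusᵉ leastᵉ : Expr → Expr → Expr
plusᵉ x o  = posᵉ x ⊗ (x ⊕ o)
leastᵉ x y = ite (x ≈ᵉ lit 0) y (ite (y ≈ᵉ lit 0) x (ite (x ≺ y) x y))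

-- A fill writes no register that later expressions could read as a result, so the intermediate
-- results of a query are passed on in arrays of length one.
tᵉ vᵉ flagᵉ jᵉ logᵉ stepᵉ : Expr
tᵉ    = var 0
vᵉ    = get 1 (lit 0)
flagᵉ = get 2 (lit 0)
jᵉ    = get 3 (lit 0)
logᵉ  = stream-cell 3 (lit 0)
stepᵉ = stream-cell 2 (lit 0)

gapᵉ powerᵉ searchᵉ listedᵉ resultᵉ : Expr
gapᵉ    = stream-cell 4 tᵉ ⊖ stream-cell 4 vᵉ
powerᵉ  = ite (var 9 ≺ lit 1) (lit 1) (lit 2 ⊗ get 4 (var 9 ⊖ lit 1))
searchᵉ = posᵉ (var 9) ⊗ (p ⊕ h ⊗ ((p ⊕ h ≺ stream-cell 9 tᵉ ⊕ lit 1) ⊗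
            (stream-cell 14 (tᵉ ⊗ stepᵉ ⊕ (p ⊕ h ⊖ lit 1)) ≺ stream-cell 4 vᵉ ⊕ lit 1)))
  where
  p = get 5 (var 9 ⊖ lit 1)
  h = get 4 (logᵉ ⊖ (var 9 ⊖ lit 1))
listedᵉ = stream-cell 15 (tᵉ ⊗ stepᵉ ⊕ get 5 (logᵉ ⊕ lit 1))
resultᵉ = ite flagᵉ
  (ite (jᵉ ≺ stream-cell 6 tᵉ ⊕ lit 1)
    (ite (stream-cell 11 tail ≈ᵉ vᵉ ⊕ lit 1) (stream-cell 12 tail) (stream-cell 5 tᵉ))
    (leastᵉ (plusᵉ (stream-cell 13 (stream-cell 8 tᵉ ⊗ stream-cell 0 (lit 0) ⊕ vᵉ)) (stream-cell 7 tᵉ)) (get 6 (lit 0))))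
  (stream-cell 5 tᵉ)
  where tail = tᵉ ⊗ stream-cell 1 (lit 0) ⊕ jᵉ

lookups : Expr → Expr → Program
lookups target flag =
  fill₁ 1 (lit 1) target ⨾ fill₁ 2 (lit 1) flag ⨾ fill₁ 3 (lit 1) gapᵉ ⨾
  fill₁ 4 (logᵉ ⊕ lit 1) powerᵉ ⨾ fill₁ 5 (logᵉ ⊕ lit 2) searchᵉ ⨾ fill₁ 6 (lit 1) listedᵉ

query : Expr → Expr → Program
query target flag = lookups target flag ⨾ set 0 resultᵉ

-- Binary search for the largest p with p ≤ answer, from the high bit down.
search : ℕ → (ℕ → ℕ) → ℕ → ℕ
search top test zero    = 0
search top test (suc m) = search top test m + 2 ^ (top ∸ m) * test (search top test m + 2 ^ (top ∸ m))

search-correct : ∀ top test answer → answer < 2 ^ suc top →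
  (∀ p → 1 ≤ p → p ≤ answer → test p ≡ 1) → (∀ p → answer < p → test p ≡ 0) →
  search top test (top + 1) ≡ answer
search-correct top test answer answer< hit miss =
  let (low , high) = invariant (top + 1) (≤-reflexive (+-comm top 1))
  in ≤-antisym low (≤-pred (subst (answer <_) (trans (cong (λ e → search top test (top + 1) + 2 ^ e)
       (trans (cong (suc top ∸_) (+-comm top 1)) (n∸n≡0 (suc top)))) (+-comm _ 1)) high))
  where
  P = search top test
  invariant : ∀ m → m ≤ suc top → P m ≤ answer × answer < P m + 2 ^ (suc top ∸ m)
  invariant zero    _     = z≤n , answer<
  invariant (suc m) m<top = choice (≤-<-connex (P m + H) answer)
    where
    H = 2 ^ (top ∸ m)
    H≥1 : 1 ≤ P m + H
    H≥1 = ≤-trans (m^n>0 2 (top ∸ m)) (m≤n+m H (P m))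
    previous = invariant m (<⇒≤ m<top)
    double : P m + 2 ^ (suc top ∸ m) ≡ P m + H + H
    double = trans (cong (λ e → P m + 2 ^ e) (+-∸-assoc 1 (≤-pred m<top)))
      (trans (cong (λ x → P m + (H + x)) (+-identityʳ H)) (sym (+-assoc (P m) H H)))
    choice : P m + H ≤ answer ⊎ answer < P m + H → P (suc m) ≤ answer × answer < P (suc m) + H
    choice (inj₁ ≤answer) = subst (λ b → P m + H * b ≤ answer × answer < P m + H * b + H) (sym (hit _ H≥1 ≤answer))
      (subst (λ h → P m + h ≤ answer × answer < P m + h + H) (sym (*-identityʳ H))
        (≤answer , subst (answer <_) double (proj₂ previous)))
    choice (inj₂ <P) = subst (λ b → P m + H * b ≤ answer × answer < P m + H * b + H) (sym (miss _ <P))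
      (subst (λ h → P m + h ≤ answer × answer < P m + h + H) (sym (*-zeroʳ H))
        (subst (λ p → p ≤ answer × answer < p + H) (sym (+-identityʳ (P m))) (proj₁ previous , <P)))

-- Only accepted probes raise the position. The word bound of a run rests on this, as it has to hold
-- before the meaning of the oracle's words is known.
search-bound : ∀ top test limit → (∀ p → test p ≤ 1) → (∀ p → test p ≡ 1 → p ≤ limit) → ∀ m → search top test m ≤ limit
search-bound top test limit bit bounded zero    = z≤n
search-bound top test limit bit bounded (suc m) = choice (bit-01 (bit (P m + H)))
  where
  P = search top test
  H = 2 ^ (top ∸ m)
  choice : test (P m + H) ≡ 0 ⊎ test (P m + H) ≡ 1 → P (suc m) ≤ limit
  choice (inj₁ eq) = subst (_≤ limit) (sym (trans (cong (λ b → P m + H * b) eq) (trans (cong (P m +_) (*-zeroʳ H)) (+-identityʳ (P m)))))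
    (search-bound top test limit bit bounded m)
  choice (inj₂ eq) = subst (_≤ limit) (sym (trans (cong (λ b → P m + H * b) eq) (cong (P m +_) (*-identityʳ H)))) (bounded _ eq)

module Lookup (O : ℕ → ℕ) (t v : ℕ) where

  gap : ℕ
  gap = O (t * 16 + 4) ∸ O (v * 16 + 4)

  -- Probes whether at least `p` changes occur in the columns up to the depth of `v`, that is,
  -- whether the run before the `p`-th change has ended there. The first factor rejects probes
  -- beyond the list of `t`, whose cells mean something else.
  test : ℕ → ℕ
  test p = apply less p (O (t * 16 + 9) + 1) * apply less (O ((t * O 2 + (p ∸ 1)) * 16 + 14)) (O (v * 16 + 4) + 1)

  listed through-pivot in-tail answer : ℕ
  listed = O ((t * O 2 + search (O 3) test (O 3 + 1)) * 16 + 15)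
  through-pivot = plus (O ((O (t * 16 + 8) * O 0 + v) * 16 + 13)) (O (t * 16 + 7))
  in-tail = sel (apply equal (O ((t * O 1 + gap) * 16 + 11)) (v + 1)) (O ((t * O 1 + gap) * 16 + 12)) (O (t * 16 + 5))
  answer = sel (apply less gap (O (t * 16 + 6) + 1)) in-tail (least through-pivot listed)

module QueryRun {V W : ℕ} (17≤V : 17 ≤ V) (room : ∀ k → T (k <ᵇ 4096) → V ^ k < W)
                (ρ O : ℕ → ℕ) (O≤V : ∀ i → O i ≤ V) (power≤V : 2 ^ O 3 ≤ V)
                {N : ℕ} (N≤V : N ≤ V) (search≤N : 2 * suc (O 3 + 2) ≤ N)
                (target flag : Expr) (v f : ℕ) (v≤V : v ≤ V) (f≤1 : f ≤ 1) where
  open Machine 17≤V room ρ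
  open Fills 17≤V room ρ N≤V
  open Lookup O (ρ 0) v

  S₀ S₁ S₂ S₃ S₄ S₅ S₆ : ℕ → ℕ → ℕ
  S₀ 0 = O
  S₀ _ = λ _ → 0
  S₁ = S₀ [ 1 ↦ stored (λ _ _ → v) 1 1 ]
  S₂ = S₁ [ 2 ↦ stored (λ _ _ → f) 1 1 ]
  S₃ = S₂ [ 3 ↦ stored (λ _ _ → gap) 1 1 ]
  S₄ = S₃ [ 4 ↦ stored (λ _ i → 2 ^ i) (O 3 + 1) 1 ]
  S₅ = S₄ [ 5 ↦ stored (λ _ → search (O 3) test) (O 3 + 2) 1 ]
  S₆ = S₅ [ 6 ↦ stored (λ _ _ → listed) 1 1 ]

  v-at : stored (λ _ _ → v) 1 1 0 ≡ v
  v-at = stored-at₁ {λ _ → v} 0 ≤-refl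

  power-at : ∀ i → i ≤ O 3 → stored (λ _ i → 2 ^ i) (O 3 + 1) 1 i ≡ 2 ^ i
  power-at i i≤ = stored-at₁ {λ i → 2 ^ i} i (subst (i <_) (+-comm 1 (O 3)) (s≤s i≤))

  few : ∀ {m} → m ≤ O 3 + 2 → 2 * suc m ≤ N
  few m≤ = ≤-trans (*-monoʳ-≤ 2 (s≤s m≤)) search≤N

  one : 1 ≤ O 3 + 2
  one = ≤-trans (s≤s z≤n) (m≤n+m 2 (O 3))

  exec-gap : Exec N (fill₁ 3 (lit 1) gapᵉ) S₂ S₃
  exec-gap = exec₁ 3 1 (lit 1) gapᵉ (λ _ → gap) tt (few one) (λ _ _ → refl) refl λ r X r< left →
    cong (λ v → O (ρ 0 * 16 + 4) ∸ O (v * 16 + 4)) v-at , ≤-trans (m∸n≤m _ (O (v * 16 + 4))) (O≤V _)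

  exec-power : Exec N (fill₁ 4 (logᵉ ⊕ lit 1) powerᵉ) S₃ S₄
  exec-power = exec₁ 4 (O 3 + 1) (logᵉ ⊕ lit 1) powerᵉ (2 ^_) tt (few (+-monoʳ-≤ (O 3) (s≤s z≤n))) (λ _ _ → refl) refl λ where
    zero    X r< left → sel-1 1 (2 * X 0) refl , ≤-trans (m^n>0 2 (O 3)) power≤V
    (suc r) X r< left → trans (sel-0 1 (2 * X r) refl) (cong (2 *_) (left r ≤-refl)) ,
      ≤-trans (^-monoʳ-≤ 2 {suc r} {O 3} (≤-pred (subst (suc (suc r) ≤_) (+-comm (O 3) 1) r<))) power≤V

  probe : (p h v : ℕ) → ℕ
  probe p h v = p + h * (apply less (p + h) (O (ρ 0 * 16 + 9) + 1) *
                         apply less (O ((ρ 0 * O 2 + (p + h ∸ 1)) * 16 + 14)) (O (v * 16 + 4) + 1))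

  probe-cong : ∀ {p p′ h h′ v v′} → p ≡ p′ → h ≡ h′ → v ≡ v′ → probe p h v ≡ probe p′ h′ v′
  probe-cong refl refl refl = refl

  test≤1 : ∀ p → test p ≤ 1
  test≤1 p = bit*≤ (apply less p (O (ρ 0 * 16 + 9) + 1)) (less≤1 p (O (ρ 0 * 16 + 9) + 1))
    (less≤1 (O ((ρ 0 * O 2 + (p ∸ 1)) * 16 + 14)) (O (v * 16 + 4) + 1))

  test-bounded : ∀ p → test p ≡ 1 → p ≤ O (ρ 0 * 16 + 9)
  test-bounded p eq = ≤-pred (subst (p <_) (+-comm (O (ρ 0 * 16 + 9)) 1)
    (less-1⁻ p (O (ρ 0 * 16 + 9) + 1) (proj₁ (*-1⁻ (apply less p (O (ρ 0 * 16 + 9) + 1)) _ eq))))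

  exec-search : Exec N (fill₁ 5 (logᵉ ⊕ lit 2) searchᵉ) S₄ S₅
  exec-search = exec₁ 5 (O 3 + 2) (logᵉ ⊕ lit 2) searchᵉ (search (O 3) test) tt (few ≤-refl) (λ _ _ → refl) refl λ where
    zero    X r< left → refl , z≤n
    (suc r) X r< left →
      trans (+-identityʳ _) (probe-cong (left r ≤-refl) (power-at (O 3 ∸ r) (m∸n≤m (O 3) r)) v-at) ,
      ≤-trans (search-bound (O 3) test (O (ρ 0 * 16 + 9)) test≤1 test-bounded (suc r)) (O≤V _)

  exec-listed : Exec N (fill₁ 6 (lit 1) listedᵉ) S₅ S₆
  exec-listed = exec₁ 6 1 (lit 1) listedᵉ (λ _ → listed) tt (few one) (λ _ _ → refl) refl λ r X r< left →
    cong (λ p → O ((ρ 0 * O 2 + p) * 16 + 15)) (stored-at₁ {search (O 3) test} (O 3 + 1) (+-monoʳ-< (O 3) (s≤s (s≤s z≤n)))) , O≤V _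

  result : (v f j F : ℕ) → ℕ
  result v f j F = sel f (sel (apply less j (O (ρ 0 * 16 + 6) + 1))
      (sel (apply equal (O ((ρ 0 * O 1 + j) * 16 + 11)) (v + 1)) (O ((ρ 0 * O 1 + j) * 16 + 12)) (O (ρ 0 * 16 + 5)))
      (least (plus (O ((O (ρ 0 * 16 + 8) * O 0 + v) * 16 + 13)) (O (ρ 0 * 16 + 7))) F)) (O (ρ 0 * 16 + 5))

  result-cong : ∀ {v v′ f f′ j j′ F F′} → v ≡ v′ → f ≡ f′ → j ≡ j′ → F ≡ F′ → result v f j F ≡ result v′ f′ j′ F′
  result-cong refl refl refl refl = refl

  query-run : T (fitting target) → T (fitting flag) →
    (∀ r X → ⟦ target ⟧ (state (counting ρ 0 r) (S₀ [ 1 ↦ X ])) ≡ v) →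
    (∀ r X → ⟦ flag ⟧ (state (counting ρ 0 r) (S₁ [ 2 ↦ X ])) ≡ f) →
    ∀ {σ} → Represents σ S₀ → ∃[ k ] ∃[ σ′ ] Run W (query target flag) σ k σ′ ×
      k ≤ charge (query target flag) * N × vars σ′ 0 ≡ sel f answer (O (ρ 0 * 16 + 5))
  query-run okt okf target≡ flag≡ rep =
    let (k , σ′ , r , k≤ , (i , j , eq) , _) = run-output (≤-trans (s≤s z≤n) search≤N)
          (exec-target ⨾ᵉ exec-flag ⨾ᵉ exec-gap ⨾ᵉ exec-power ⨾ᵉ exec-search ⨾ᵉ exec-listed) S₀≤ 0 resultᵉ tt rep
    in k , σ′ , r , k≤ , trans eq (result-cong v-at (stored-at₁ {λ _ → f} 0 ≤-refl)
         (stored-at₁ {λ _ → gap} 0 ≤-refl) (stored-at₁ {λ _ → listed} 0 ≤-refl))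
    where
    S₀≤ : ∀ a j → S₀ a j ≤ V
    S₀≤ zero    j = O≤V j
    S₀≤ (suc a) j = z≤n
    exec-target : Exec N (fill₁ 1 (lit 1) target) S₀ S₁
    exec-target = exec₁ 1 1 (lit 1) target (λ _ → v) okt (few one) (λ _ _ → refl) refl λ r X r< left → target≡ r X , v≤V
    exec-flag : Exec N (fill₁ 2 (lit 1) flag) S₁ S₂
    exec-flag = exec₁ 2 1 (lit 1) flag (λ _ → f) okf (few one) (λ _ _ → refl) refl λ r X r< left →
      flag≡ r X , ≤-trans f≤1 (≤-trans (s≤s z≤n) 17≤V)

-- From the words of the oracle to the answers

choose-nth : ∀ {σ} k es (i : Fin (length es)) → vars σ 9 ≡ k + toℕ i → ⟦ choose k es ⟧ σ ≡ ⟦ lookup es i ⟧ σ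
choose-nth {σ} k (e ∷ es) fzero    eq = sel-1 (⟦ e ⟧ σ) (⟦ choose (suc k) es ⟧ σ) (equal-true (trans eq (+-identityʳ k)))
choose-nth {σ} k (e ∷ es) (fsuc i) eq = trans
  (sel-0 (⟦ e ⟧ σ) (⟦ choose (suc k) es ⟧ σ) (equal-false λ 9≡k → m+1+n≢m k (trans (sym eq) 9≡k)))
  (choose-nth (suc k) es i (trans eq (+-suc k (toℕ i))))

contents-applyUpTo : ∀ f m {i} → i < m → contents (applyUpTo f m) i ≡ f i
contents-applyUpTo f (suc m) {zero}  _   = refl
contents-applyUpTo f (suc m) {suc i} i<m = contents-applyUpTo (f ∘ suc) m (≤-pred i<m)

contents≤ : ∀ f m {V} → (∀ j → f j ≤ V) → ∀ i → contents (applyUpTo f m) i ≤ V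
contents≤ f zero    f≤ i       = z≤n
contents≤ f (suc m) f≤ zero    = f≤ 0
contents≤ f (suc m) f≤ (suc i) = contents≤ (f ∘ suc) m (f≤ ∘ suc) i

module Serving (n s : ℕ) (par w C : ℕ → ℕ) (1≤n : 1 ≤ n) {M : ℕ} (par≤ : ∀ v → par v ≤ n)
               (w≤ : ∀ v → w v ≤ M) (C≤ : ∀ i → C i ≤ suc (n * M)) where
  open Tables n s par w C
  open Bounds 1≤n par≤ w≤ C≤
  open TableFacts n s par w C 1≤n par≤ w≤ C≤

  record Serves (O : ℕ → ℕ) : Set where
    field
      n-at    : O 0 ≡ n
      L-at    : O 1 ≡ L
      K-at    : O 2 ≡ K₁
      log-at  : O 3 ≡ ⌊log₂ n ⌋
      dep-at  : ∀ {t} → t < n → O (t * 16 + 4) ≡ dep t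
      dst-at  : ∀ {t} → t < n → O (t * 16 + 5) ≡ dst t
      hop-at  : ∀ {t} → t < n → O (t * 16 + 6) ≡ hop t
      off-at  : ∀ {t} → t < n → O (t * 16 + 7) ≡ off t
      row-at  : ∀ {t} → t < n → O (t * 16 + 8) ≡ row t
      ca-at   : ∀ {t} → t < n → O (t * 16 + 9) ≡ ca t n
      par-at  : ∀ {t} → t < n → O (t * 16 + 10) ≡ par t
      tid-at  : ∀ {t j} → t < n → j < L → O ((t * L + j) * 16 + 11) ≡ tid t j
      tv-at   : ∀ {t j} → t < n → j < L → O ((t * L + j) * 16 + 12) ≡ tv t j
      rv-at   : ∀ {i v} → i < pivots → v < n → O ((i * n + v) * 16 + 13) ≡ RV (i * n + v)
      le-at   : ∀ {t c} → t < n → c < K₁ → O ((t * K₁ + c) * 16 + 14) ≡ LE (t * K₁ + c)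
      lv-at   : ∀ {t c} → t < n → c < K₁ → O ((t * K₁ + c) * 16 + 15) ≡ LV (t * K₁ + c)

  module Build-serves {V W : ℕ} (17≤V : 17 ≤ V) (room : ∀ k → T (k <ᵇ 4096) → V ^ k < W)
    {N : ℕ} (N≤V : N ≤ V) (table≤V : suc (n * M) ≤ V) (square≤N : suc (n + 1) * suc (n + 1) ≤ N)
    (size≤N : suc size * 17 ≤ N) where
    open Build 17≤V room N≤V n M s par w C 1≤n par≤ w≤ C≤ table≤V square≤N size≤N
      using (stream; S₂₆; ρ; n<n₁; anc-at; K-at; L-at; r*-at)

    in-rows : ∀ {q r R m} → q < R → r < m → q * m + r < R * m
    in-rows {q} {r} {R} {m} q<R r<m = subst (q * m + r <_) (+-identityʳ (R * m)) (rowMajor-< q<R r<m 0)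

    size₁ : ∀ {i} → i < n → i < size
    size₁ i< = ≤-trans i< (≤-trans (m≤m+n n (n * L)) (≤-trans (m≤m+n _ (pivots * n)) (m≤m+n _ (n * K₁))))

    size₂ : ∀ {t j} → t < n → j < L → t * L + j < size
    size₂ t< j< = ≤-trans (in-rows t< j<) (≤-trans (m≤n+m (n * L) n) (≤-trans (m≤m+n _ (pivots * n)) (m≤m+n _ (n * K₁))))

    size₃ : ∀ {i v} → i < pivots → v < n → i * n + v < size
    size₃ i< v< = ≤-trans (in-rows i< v<) (≤-trans (m≤n+m (pivots * n) (n + n * L)) (m≤m+n _ (n * K₁)))

    size₄ : ∀ {t c} → t < n → c < K₁ → t * K₁ + c < size
    size₄ t< c< = ≤-trans (in-rows t< c<) (m≤n+m (n * K₁) (n + n * L + pivots * n))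

    module _ {O : ℕ → ℕ} (cells : ∀ {i k} → i < size → k < 16 → O (i * 16 + k) ≡ stream k i) where

      cell : ∀ {i} (k : Fin 16) → i < size → O (i * 16 + toℕ k) ≡ ⟦ lookup streamᵉ k ⟧ (state (counting ρ i (toℕ k)) S₂₆)
      cell {i} k i< = trans (cells i< (Fin.toℕ<n k)) (choose-nth {state (counting ρ i (toℕ k)) S₂₆} 0 streamᵉ k refl)

      serves : Serves O
      serves = record
        { n-at   = cell (F.# 0) (size₁ 1≤n)
        ; L-at   = trans (cell (F.# 1) (size₁ 1≤n)) L-at
        ; K-at   = trans (cell (F.# 2) (size₁ 1≤n)) (cong (_+ 1) K-at)
        ; log-at = trans (cell (F.# 3) (size₁ 1≤n)) (stored-at₁ {⌊log₂_⌋} n n<n₁)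
        ; dep-at = λ t< → trans (cell (F.# 4) (size₁ t<)) (stored-at₁ {dep} _ t<)
        ; dst-at = λ t< → trans (cell (F.# 5) (size₁ t<)) (stored-at₁ {dst} _ t<)
        ; hop-at = λ t< → trans (cell (F.# 6) (size₁ t<)) (stored-at₁ {hop} _ t<)
        ; off-at = λ t< → trans (cell (F.# 7) (size₁ t<)) (stored-at₁ {off} _ t<)
        ; row-at = λ t< → trans (cell (F.# 8) (size₁ t<)) (stored-at₁ {row} _ t<)
        ; ca-at  = λ t< → trans (cell (F.# 9) (size₁ t<)) (stored-at {ca} _ n t< n<n₁)
        ; par-at = λ t< → cell (F.# 10) (size₁ t<)
        ; tid-at = λ t< j< → trans (cell (F.# 11) (size₂ t< j<)) (stored-at {tid} _ _ t< j<)
        ; tv-at  = λ t< j< → trans (cell (F.# 12) (size₂ t< j<)) (stored-at {tv} _ _ t< j<)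
        ; rv-at  = λ i< v< → cell (F.# 13) (size₃ i< v<)
        ; le-at  = λ t< c< → cell (F.# 14) (size₄ t< c<)
        ; lv-at  = λ t< c< → cell (F.# 15) (size₄ t< c<)
        }

  module Answers {O : ℕ → ℕ} (serves : Serves O) {t v : ℕ} (t<n : t < n) (v<n : v < n) where
    open Serves serves
    open Lookup O t v

    gap-eq : gap ≡ dep t ∸ dep v
    gap-eq = cong₂ _∸_ (dep-at t<n) (dep-at v<n)

    answer-near : dep t ∸ dep v ≤ hop t → answer ≡ sel (apply equal (tid t (dep t ∸ dep v)) (v + 1)) (tv t (dep t ∸ dep v)) (dst t)
    answer-near j≤h = trans (sel-1 in-tail (least through-pivot listed)
        (less-true (subst₂ _<_ (sym gap-eq) (sym (trans (cong (_+ 1) (hop-at t<n)) (+-comm (hop t) 1))) (s≤s j≤h))))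
      (sel-cong (cong (λ x → apply equal x (v + 1)) (trans (tail 11) (tid-at t<n j<L)))
                (trans (tail 12) (tv-at t<n j<L)) (dst-at t<n))
      where
      j<L : dep t ∸ dep v < L
      j<L = ≤-<-trans j≤h (hop<L t)
      tail : ∀ k → O ((t * O 1 + gap) * 16 + k) ≡ O ((t * L + (dep t ∸ dep v)) * 16 + k)
      tail k = cong₂ (λ l j → O ((t * l + j) * 16 + k)) L-at gap-eq
      sel-cong : ∀ {c c′ a a′ b b′} → c ≡ c′ → a ≡ a′ → b ≡ b′ → sel c a b ≡ sel c′ a′ b′
      sel-cong refl refl refl = refl

    -- The entries below depth dep v are found by their number of changes.
    search-eq : dep v < n → search (O 3) test (O 3 + 1) ≡ ca t (suc (dep v))
    search-eq v<n′ = trans (cong (λ l → search l test (l + 1)) log-at)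
      (search-correct ⌊log₂ n ⌋ test (ca t i) (≤-<-trans (≤-trans (ca≤ t i) v<n′) (n<2^[1+log] n)) hit miss)
      where
      i = suc (dep v)
      le : ∀ {p} → p < ca t n → O ((t * O 2 + p) * 16 + 14) ≡ LE (t * K₁ + p)
      le {p} p< = trans (cong (λ k → O ((t * k + p) * 16 + 14)) K-at) (le-at t<n (<-trans p< (ca<K₁ t<n ≤-refl)))
      limit : O (v * 16 + 4) + 1 ≡ i
      limit = trans (cong (_+ 1) (dep-at v<n)) (+-comm (dep v) 1)
      hit : ∀ p → 1 ≤ p → p ≤ ca t i → test p ≡ 1
      hit (suc p) _ p≤ = cong₂ _*_
        (less-true (subst (suc p <_) (sym (trans (cong (_+ 1) (ca-at t<n)) (+-comm (ca t n) 1))) (s≤s p≤n)))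
        (less-true (subst₂ _<_ (sym (le p≤n)) (sym limit) (proj₁ (LE-search t<n v<n′ p≤n) p≤)))
        where
        p≤n : suc p ≤ ca t n
        p≤n = ≤-trans p≤ (ca-mono t v<n′)
      miss : ∀ p → ca t i < p → test p ≡ 0
      miss (suc p) ca<p = choice (≤-<-connex (suc p) (ca t n))
        where
        choice : suc p ≤ ca t n ⊎ ca t n < suc p → test (suc p) ≡ 0
        choice (inj₁ p≤n) = trans (cong (apply less (suc p) (O (t * 16 + 9) + 1) *_)
            (less-false (subst₂ _≤_ (sym limit) (sym (le p≤n))
              (≮⇒≥ λ LE<i → <⇒≱ ca<p (proj₂ (LE-search t<n v<n′ p≤n) LE<i)))))
          (*-zeroʳ (apply less (suc p) (O (t * 16 + 9) + 1)))
        choice (inj₂ n<p) = cong (_* apply less (O ((t * O 2 + p) * 16 + 14)) (O (v * 16 + 4) + 1))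
          (less-false (subst (_≤ suc p) (sym (trans (cong (_+ 1) (ca-at t<n)) (+-comm (ca t n) 1))) n<p))

    answer-far : hop t < dep t ∸ dep v → px t ∸ 1 < n → apply mod (dep (px t ∸ 1)) L ≡ r* →
                 answer ≡ least (plus (C (n * (px t ∸ 1) + v)) (off t)) (ma t (suc (dep v)))
    answer-far h<j x<n pivot = trans (sel-0 in-tail (least through-pivot listed)
        (less-false (subst₂ _≤_ (sym (trans (cong (_+ 1) (hop-at t<n)) (+-comm (hop t) 1))) (sym gap-eq) h<j)))
      (cong₂ least (cong₂ plus cell (off-at t<n)) entry)
      where
      v<n′ : dep v < n
      v<n′ = ≤-trans (≰⇒> λ t≤v → contradiction (subst (hop t <_) (m≤n⇒m∸n≡0 t≤v) h<j) λ ()) (dep≤ t)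
      cell : O ((O (t * 16 + 8) * O 0 + v) * 16 + 13) ≡ C (n * (px t ∸ 1) + v)
      cell = trans (cong₂ (λ r m → O ((r * m + v) * 16 + 13)) (row-at t<n) n-at)
        (trans (rv-at (row<pivots x<n pivot) v<n) (RV-at x<n v<n pivot))
      entry : listed ≡ ma t (suc (dep v))
      entry = trans (cong₂ (λ k c → O ((t * k + c) * 16 + 15)) K-at (search-eq v<n′))
        (trans (lv-at t<n (ca<K₁ t<n v<n′)) (LV-at t<n v<n′))

-- Edge and vertex failures

-- Deleting a member makes the set smaller, but deleting `x` a second time changes nothing.
removed : ∀ {n} (p : Subset n) x → ¬ x ∈ p - x
removed p x x∈ = <-irrefl (cong ∣_∣ (p─q─q≡p─q p ⁅ x ⁆)) (x∈p⇒∣p-x∣<∣p∣ x∈)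

unless-no : ∀ {P : Set} (d : Dec P) {x} → ¬ P → unless d x ≡ x
unless-no (yes p) ¬p = contradiction p ¬p
unless-no (no _)  ¬p = refl

walk-map : ∀ {n} {A B : Graph n} → (∀ {z} → z ∈ vertices A → z ∈ vertices B) →
           (∀ {a b w} → weight A a b ≡ just w → weight B a b ≡ just w) →
           ∀ {u t ℓ} → Walk A u t ℓ → Walk B u t ℓ
walk-map ∈⇒ e⇒ (here u∈)   = here (∈⇒ u∈)
walk-map ∈⇒ e⇒ (step e p) = step (e⇒ e) (walk-map ∈⇒ e⇒ p)

edge-swap : ∀ {n} {G : Graph n} {x y a b w} → weight (G −edge (x , y)) a b ≡ just w → weight (G −edge (y , x)) a b ≡ just w
edge-swap {x = x} {y} {a} {b} eq = let (¬same , eq′) = unless-just (sameEdge? (x , y) a b) eq in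
  trans (unless-no (sameEdge? (y , x) a b) λ { (inj₁ same) → ¬same (inj₂ same) ; (inj₂ same) → ¬same (inj₁ same) }) eq′

code-swap : ∀ {n} {G : Graph n} {s t x y c} → IsCode (G −edge (x , y)) s t c → IsCode (G −edge (y , x)) s t c
code-swap {G = G} γ = record
  { lower    = λ p → lower γ (walk-map (λ z∈ → z∈) (edge-swap {G = G}) p)
  ; attained = λ eq → walk-map (λ z∈ → z∈) (edge-swap {G = G}) (attained γ eq) }

module _ {n} {G : Graph n} (full : ∀ z → z ∈ vertices G) {s : Fin n} {T : Parents n}
         (tree : IsShortestPathTree G s T) where
  open IsShortestPathTree tree
  open Tree G full s T tree

  vertex-failures : Failures G T (G −vertex_)
  vertex-failures = record
    { keep   = λ {v} {a} {b} eq a≢v b≢v → trans (unless-no (touches? v a b) λ { (inj₁ a≡v) → a≢v a≡v ; (inj₂ b≡v) → b≢v b≡v }) eq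
    ; sound  = λ {v} {a} {b} eq → proj₂ (unless-just (touches? v a b) eq)
    ; member = λ z≢v → x∈p∧x≢y⇒x∈p-y (full _) z≢v
    ; below  = λ {v} v∈ _ → contradiction v∈ (removed (vertices G) v)
    }

  failure-named : Fin n → Maybe (Fin n × ℕ) → Graph n
  failure-named v = maybe′ (λ (p , _) → G −edge (p , v)) (G −vertex v)

  -- The edge above v fails; a vertex without such an edge fails itself.
  edge-failure : Fin n → Graph n
  edge-failure v = failure-named v (T v)

  parent-height : ∀ {v p w} → T v ≡ just (p , w) → ∃[ k ] ∃[ d ] Up T s v k d
  parent-height eq = let (_ , B) = rooted eq ; (k , U) = Branch⇒Up B in k , _ , U

  no-loop : ∀ {v k d j e} → Up T s v k d → ¬ Up T v v (suc j) e
  no-loop S U with proj₁ (height-unique S U stop)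
  ... | ()

  edge-failures : Failures G T edge-failure
  edge-failures = record
    { keep   = λ {v} eq a≢v b≢v → keep′ v (T v) eq a≢v b≢v
    ; sound  = λ {v} eq → sound′ v (T v) eq
    ; member = λ {v} z≢v → member′ v (T v) z≢v
    ; below  = λ {v} v∈ eq → below′ v (T v) refl v∈ eq
    }
    where
    module V = Failures vertex-failures
    keep′ : ∀ v m {a b w} → weight G a b ≡ just w → a ≢ v → b ≢ v → weight (failure-named v m) a b ≡ just w
    keep′ v nothing             eq a≢v b≢v = V.keep {v} eq a≢v b≢v
    keep′ v (just (p , _)) {a} {b} eq a≢v b≢v = trans
      (unless-no (sameEdge? (p , v) a b) λ { (inj₁ (_ , b≡v)) → b≢v b≡v ; (inj₂ (a≡v , _)) → a≢v a≡v }) eq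
    sound′ : ∀ v m {a b w} → weight (failure-named v m) a b ≡ just w → weight G a b ≡ just w
    sound′ v nothing                eq = V.sound {v} eq
    sound′ v (just (p , _)) {a} {b} eq = proj₂ (unless-just (sameEdge? (p , v) a b) eq)
    member′ : ∀ v m {z} → z ≢ v → z ∈ vertices (failure-named v m)
    member′ v nothing  z≢v = V.member z≢v
    member′ v (just _) z≢v = full _
    below′ : ∀ v m → T v ≡ m → ∀ {b w} → v ∈ vertices (failure-named v m) → T b ≡ just (v , w) →
             weight (failure-named v m) v b ≡ just w
    below′ v nothing        Tv v∈ eq = V.below v∈ eq
    below′ v (just (p , _)) Tv {b} v∈ eq = trans (unless-no (sameEdge? (p , v) v b) λ where
      -- If the edge to the child were the failing one, `b` would be its own parent, or `b` and `v`
      -- would be parents of each other.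
      (inj₁ (_ , refl)) → no-loop (proj₂ (proj₂ (parent-height eq))) (up eq stop)
      (inj₂ (_ , refl)) → no-loop (proj₂ (proj₂ (parent-height Tv))) (up eq (up Tv stop))) (subgraph eq)

  -- No edge lies above `s`, so the name `s` stands for the deletion of `s`. The column of zeros is
  -- correct for it, and every vertex of the tree becomes a valid name.
  Named : Fin n → Set
  Named v = (∃[ p ] T v ≡ just p) ⊎ v ≡ s

  tree-named : ∀ {v k d} → Up T s v k d → Named v
  tree-named U with Up⇒Branch U
  ... | root      = inj₂ refl
  ... | down eq _ = inj₁ (_ , eq)

  edge-coded : ∀ {D : Fin n → Fin n → Maybe ℕ} →
    (∀ t {v p w} → T v ≡ just (p , w) → IsDist (G −edge (p , v)) s t (D t v)) →
    ∀ {v} → Named v → ∀ t → IsCode (edge-failure v) s t (edgeTable T D t v)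
  edge-coded {D} dist {v} named t with T v in eq | named
  ... | just _  | _               = IsDist⇒IsCode (dist t eq)
  ... | nothing | inj₁ (_ , ())
  ... | nothing | inj₂ refl       = record
    { lower = λ p → contradiction (start∈ p) (removed (vertices G) s) ; attained = λ () }

  spared : ∀ {x y} → (∀ {w} → T x ≢ just (y , w)) → (∀ {w} → T y ≢ just (x , w)) →
           ∀ {a t j d} → Up T a t j d → Walk (G −edge (x , y)) a t d
  spared x↛y y↛x stop = here (full _)
  spared {x} {y} x↛y y↛x (up {a = a} {p = p} eq U) = step
    (trans (unless-no (sameEdge? (x , y) p a) λ { (inj₁ (refl , refl)) → y↛x eq ; (inj₂ (refl , refl)) → x↛y eq }) (subgraph eq))
    (spared x↛y y↛x U)

tabulated-at : ∀ {m} (f : Fin m → ℕ) i → tabulated f (toℕ i) ≡ f i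
tabulated-at {m} f i with toℕ i <? m
... | yes i<m = cong f (Fin.fromℕ<-toℕ i i<m)
... | no  i≮m = contradiction (Fin.toℕ<n i) i≮m

tabulated≤ : ∀ {m} (f : Fin m → ℕ) {V} → (∀ i → f i ≤ V) → ∀ i → tabulated f i ≤ V
tabulated≤ {m} f f≤ i with i <? m
... | yes _ = f≤ _
... | no  _ = z≤n

table-at : ∀ {n} (f : Fin n → Fin n → ℕ) t v → table f (n * toℕ t + toℕ v) ≡ f t v
table-at {n} f t v = trans (cong (table f) (sym (Fin.toℕ-combine t v)))
  (trans (tabulated-at (λ i → f (proj₁ (F.remQuot {n} n i)) (proj₂ (F.remQuot {n} n i))) (F.combine t v))
         (cong (λ (t , v) → f t v) (Fin.remQuot-combine t v)))

code≤ : ∀ {n} {A : Graph n} {s t M d} → WeightsInRange M A → IsDist A s t d → codeDist d ≤ suc (n * M)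
code≤ {d = just _}  range (p , _) = s≤s (path-bound range p)
code≤ {d = nothing} range _       = z≤n

-- Numerical bounds

-- The two sides differ by the square of `a - b`.
square-+ : ∀ a b → (a + b) * (a + b) ≤ 2 * (a * a + b * b)
square-+ a b = choice (≤-total a b)
  where
  expand : ∀ a d → (a + (a + d)) * (a + (a + d)) + d * d ≡ 2 * (a * a + (a + d) * (a + d))
  expand = solve-∀
  ordered : ∀ a d → (a + (a + d)) * (a + (a + d)) ≤ 2 * (a * a + (a + d) * (a + d))
  ordered a d = subst ((a + (a + d)) * (a + (a + d)) ≤_) (expand a d) (m≤m+n _ (d * d))
  choice : a ≤ b ⊎ b ≤ a → (a + b) * (a + b) ≤ 2 * (a * a + b * b)
  choice (inj₁ a≤b) = subst (λ b → (a + b) * (a + b) ≤ 2 * (a * a + b * b)) (m+[n∸m]≡n a≤b) (ordered a (b ∸ a))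
  choice (inj₂ b≤a) = subst₂ (λ x y → x * x ≤ 2 * y) (+-comm b a) (+-comm (b * b) (a * a))
    (subst (λ a → (b + a) * (b + a) ≤ 2 * (b * b + a * a)) (m+[n∸m]≡n b≤a) (ordered b (a ∸ b)))

-- An oracle of g words per unit of size, where n (p L + K) bounds the size.
size-factor : ℕ → ℕ → ℕ → ℕ
size-factor g p q = g * g * (2 * (p * p + q))

scaled-size : ∀ g p q {S n M L K} → S ≤ n * (p * L + K) → L * L ≤ M * n → K * K ≤ q * (M * n) →
              (S * g) ^ 2 ≤ size-factor g p q * (M * n ^ 3)
scaled-size g p q {S} {n} {M} {L} {K} S≤ L²≤ K²≤ = begin
  (S * g) ^ 2                                          ≤⟨ ^-monoˡ-≤ 2 (*-monoˡ-≤ g S≤) ⟩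
  (n * y * g) ^ 2                                      ≡⟨ eq₁ g n y ⟩
  g * g * (n * n) * (y * y)                            ≤⟨ *-monoʳ-≤ (g * g * (n * n)) (square-+ (p * L) K) ⟩
  g * g * (n * n) * (2 * (p * L * (p * L) + K * K))    ≡⟨ cong (λ x → g * g * (n * n) * (2 * (x + K * K))) (eq₂ p L) ⟩
  g * g * (n * n) * (2 * (p * p * (L * L) + K * K))
    ≤⟨ *-monoʳ-≤ (g * g * (n * n)) (*-monoʳ-≤ 2 (+-mono-≤ (*-monoʳ-≤ (p * p) L²≤) K²≤)) ⟩
  g * g * (n * n) * (2 * (p * p * (M * n) + q * (M * n))) ≡⟨ eq₃ (g * g) (p * p) q n M ⟩
  size-factor g p q * (M * n ^ 3)                      ∎
  where
  open ≤-Reasoning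
  y = p * L + K
  eq₁ : ∀ c n x → n * x * c * (n * x * c * 1) ≡ c * c * (n * n) * (x * x)
  eq₁ = solve-∀
  eq₂ : ∀ c L → c * L * (c * L) ≡ c * c * (L * L)
  eq₂ = solve-∀
  eq₃ : ∀ a b c n M → a * (n * n) * (2 * (b * (M * n) + c * (M * n))) ≡ a * (2 * (b + c)) * (M * (n * (n * (n * 1))))
  eq₃ = solve-∀

-- From `p * L ≤ n < (L + 1)² ≤ 4 * L²` follows `p ≤ 4 * L`; the four summands then contribute 1 + 1
-- + 4 + 1 = 7 multiples of `n * L`.
linear-size : ∀ {n L K p} → 1 ≤ L → n < (L + 1) * (L + 1) → p * L ≤ n →
              n + n * L + p * n + n * (K + 1) ≤ n * (7 * L + K)
linear-size {n} {L} {K} {p} 1≤L n< pL≤n = begin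
  n + n * L + p * n + n * (K + 1)                ≤⟨ +-mono-≤ (+-mono-≤ (+-monoˡ-≤ (n * L) (m≤m*n n L)) (*-monoˡ-≤ n p≤4L)) (*-monoʳ-≤ n (+-monoʳ-≤ K 1≤L)) ⟩
  n * L + n * L + 4 * L * n + n * (K + L)        ≡⟨ eq n L K ⟩
  n * (7 * L + K)                                ∎
  where
  open ≤-Reasoning
  instance _ = >-nonZero 1≤L
  double : ∀ L → (L + L) * (L + L) ≡ 4 * L * L
  double = solve-∀
  p≤4L : p ≤ 4 * L
  p≤4L = *-cancelʳ-≤ p (4 * L) L (≤-trans pL≤n (≤-trans (<⇒≤ n<)
    (≤-trans (*-mono-≤ (+-monoʳ-≤ L 1≤L) (+-monoʳ-≤ L 1≤L)) (≤-reflexive (double L)))))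
  eq : ∀ n L K → n * L + n * L + 4 * L * n + n * (K + L) ≡ n * (7 * L + K)
  eq = solve-∀

power-room : ∀ l v {k b} → k < b → ((2 ^ suc l) ^ v) ^ k < 2 ^ (suc (v * b) * suc l)
power-room l v {k} {b} k<b = begin-strict
  ((2 ^ suc l) ^ v) ^ k      ≡⟨ trans (^-*-assoc (2 ^ suc l) v k) (^-*-assoc 2 (suc l) (v * k)) ⟩
  2 ^ (suc l * (v * k))      <⟨ ^-monoʳ-< 2 (s≤s (s≤s z≤n)) {suc l * (v * k)} {suc l * suc (v * b)}
                                  (*-monoʳ-< (suc l) {v * k} {suc (v * b)} (s≤s (*-monoʳ-≤ v (<⇒≤ k<b)))) ⟩
  2 ^ (suc l * suc (v * b))  ≡⟨ cong (2 ^_) (*-comm (suc l) (suc (v * b))) ⟩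
  2 ^ (suc (v * b) * suc l)  ∎
  where open ≤-Reasoning

module Powers (B : ℕ) (2≤B : 2 ≤ B) (κ : ℕ) where
  private
    instance
      B≢0 : NonZero B
      B≢0 = >-nonZero (≤-trans (s≤s z≤n) 2≤B)

  -- To be used with a power of two above `n` as `B`. The exponent 9 is 7 for `102 ≤ 2 ^ 7` and 2
  -- for `n * n`; of the two `κ`, one is for the factor `κ ≤ 2 ^ κ` and one for `n ^ κ` in the bound
  -- on `M`.
  bound : ℕ
  bound = B ^ (9 + (κ + κ))

  power : ∀ {a} e → a ≤ 2 ^ e → a ≤ B ^ e
  power e a≤ = ≤-trans a≤ (^-monoˡ-≤ e 2≤B)

  small : ∀ {a} e → e ≤ 9 → a ≤ B ^ e → a ≤ bound
  small e e≤9 a≤ = ≤-trans a≤ (^-monoʳ-≤ B {e} {9 + (κ + κ)} (≤-trans e≤9 (m≤m+n 9 (κ + κ))))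

  17≤bound : 17 ≤ bound
  17≤bound = small 5 (≤ᵇ⇒≤ 5 9 tt) (power 5 (≤ᵇ⇒≤ 17 32 tt))

  base≤bound : B ≤ bound
  base≤bound = small 1 (s≤s z≤n) (≤-reflexive (sym (^-identityʳ B)))

  search≤bound : ∀ {l} → l ≤ B → 6 * l ≤ bound
  search≤bound l≤B = small 4 (≤ᵇ⇒≤ 4 9 tt) (≤-trans (*-mono-≤ (power 3 (≤ᵇ⇒≤ 6 8 tt)) l≤B) (≤-reflexive (*-comm (B ^ 3) B)))

  square≤bound : ∀ {n} → n ≤ B → 102 * (n * n) ≤ bound
  square≤bound {n} n≤B = small 9 ≤-refl (≤-trans (*-mono-≤ (power 7 (≤ᵇ⇒≤ 102 128 tt)) (*-mono-≤ n≤B n≤B))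
    (≤-reflexive (trans (cong (λ x → B ^ 7 * (B * x)) (sym (*-identityʳ B))) (sym (^-distribˡ-+-* B 7 2)))))

  table≤bound : ∀ {n M} → n ≤ B → 1 ≤ n → 1 ≤ M → M ≤ κ * n ^ κ → suc (n * M) ≤ bound
  table≤bound {n} {M} n≤B 1≤n 1≤M M≤ = begin
    suc (n * M)                       ≤⟨ +-monoˡ-≤ (n * M) (*-mono-≤ 1≤n 1≤M) ⟩
    n * M + n * M                     ≡⟨ cong (n * M +_) (sym (+-identityʳ (n * M))) ⟩
    2 * (n * M)                       ≤⟨ *-mono-≤ 2≤B (*-mono-≤ n≤B M≤B) ⟩
    B * (B * B ^ (κ + κ))             ≤⟨ ^-monoʳ-≤ B {2 + (κ + κ)} {9 + (κ + κ)} (+-monoˡ-≤ (κ + κ) (≤ᵇ⇒≤ 2 9 tt)) ⟩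
    B ^ (9 + (κ + κ))                 ∎
    where
    open ≤-Reasoning
    M≤B : M ≤ B ^ (κ + κ)
    M≤B = begin
      M                 ≤⟨ M≤ ⟩
      κ * n ^ κ         ≤⟨ *-mono-≤ (power κ (<⇒≤ (n<2^n κ))) (^-monoˡ-≤ κ n≤B) ⟩
      B ^ κ * B ^ κ     ≡⟨ sym (^-distribˡ-+-* B κ κ) ⟩
      B ^ (κ + κ)       ∎

search≤ : ∀ l → 2 * suc (l + 2) ≤ 6 * suc l
search≤ l = subst (2 * suc (l + 2) ≤_) (eq l) (m≤m+n _ (4 * l))
  where
  eq : ∀ l → 2 * suc (l + 2) + 4 * l ≡ 6 * suc l
  eq = solve-∀

2≤2^[1+l] : ∀ l → 2 ≤ 2 ^ suc l
2≤2^[1+l] l = ^-monoʳ-≤ 2 {1} {suc l} (s≤s z≤n)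

n≤2^[1+log] : ∀ n → n ≤ 2 ^ suc ⌊log₂ n ⌋
n≤2^[1+log] n = <⇒≤ (n<2^[1+log] n)

abstract
  bits : ℕ → ℕ
  bits κ = suc ((9 + (κ + κ)) * 4096)

  -- All numbers of the computation are polynomial in n.
  capacity : ℕ → ℕ → ℕ
  capacity κ n = (2 ^ suc ⌊log₂ n ⌋) ^ (9 + (κ + κ))

  capacity-room : ∀ κ n k → T (k <ᵇ 4096) → capacity κ n ^ k < words (bits κ) n
  capacity-room κ n k k< = power-room ⌊log₂ n ⌋ (9 + (κ + κ)) {k} {4096} (<ᵇ⇒< k 4096 k<)

  17≤capacity : ∀ κ n → 17 ≤ capacity κ n
  17≤capacity κ n = Powers.17≤bound (2 ^ suc ⌊log₂ n ⌋) (2≤2^[1+l] ⌊log₂ n ⌋) κ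

  n≤capacity : ∀ κ n → n ≤ capacity κ n
  n≤capacity κ n = ≤-trans (n≤2^[1+log] n) (Powers.base≤bound (2 ^ suc ⌊log₂ n ⌋) (2≤2^[1+l] ⌊log₂ n ⌋) κ)

  power≤capacity : ∀ κ n → 2 ^ ⌊log₂ n ⌋ ≤ capacity κ n
  power≤capacity κ n = ≤-trans (^-monoʳ-≤ 2 {⌊log₂ n ⌋} {suc ⌊log₂ n ⌋} (n≤1+n _))
    (Powers.base≤bound (2 ^ suc ⌊log₂ n ⌋) (2≤2^[1+l] ⌊log₂ n ⌋) κ)

  square≤capacity : ∀ κ n → 102 * (n * n) ≤ capacity κ n
  square≤capacity κ n = Powers.square≤bound (2 ^ suc ⌊log₂ n ⌋) (2≤2^[1+l] ⌊log₂ n ⌋) κ (n≤2^[1+log] n)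

  search≤capacity : ∀ κ n → 2 * suc (⌊log₂ n ⌋ + 2) ≤ capacity κ n
  search≤capacity κ n = ≤-trans (search≤ ⌊log₂ n ⌋)
    (Powers.search≤bound (2 ^ suc ⌊log₂ n ⌋) (2≤2^[1+l] ⌊log₂ n ⌋) κ (<⇒≤ (n<2^n (suc ⌊log₂ n ⌋))))

  table≤capacity : ∀ κ n {M} → 1 ≤ n → 1 ≤ M → M ≤ κ * n ^ κ → suc (n * M) ≤ capacity κ n
  table≤capacity κ n = Powers.table≤bound (2 ^ suc ⌊log₂ n ⌋) (2≤2^[1+l] ⌊log₂ n ⌋) κ (n≤2^[1+log] n)

-- Oracles for a family of failures

query-result : ∀ κ n ora args target flag v f →
  (∀ i → contents ora i ≤ capacity κ n) → contents ora 3 ≡ ⌊log₂ n ⌋ → v ≤ n → f ≤ 1 → (∀ x → contents args x ≤ n) →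
  T (admissible target ∧ (cost target <ᵇ 4096)) → T (admissible flag ∧ (cost flag <ᵇ 4096)) →
  (∀ q r S → S 0 ≡ contents ora → ⟦ target ⟧ (state (counting (contents args) q r) S) ≡ v) →
  (∀ q r S → S 0 ≡ contents ora → ⟦ flag ⟧ (state (counting (contents args) q r) S) ≡ f) →
  ∃[ k ] ∃[ σ ] Run (words (bits κ) n) (query target flag) (queryInput ora args) k σ ×
    k ≤ charge (query target flag) * 6 * polylog 1 n ×
    vars σ 0 ≡ sel f (Lookup.answer (contents ora) (contents args 0) v) (contents ora (contents args 0 * 16 + 5))
query-result κ n ora args target flag v f O≤ log-at v≤n f≤1 args≤ okt okf target≡ flag≡ =
  let (k , σ , r , k≤ , eq) = query-run okt okf (λ r X → target≡ 0 r (S₀ [ 1 ↦ X ]) refl) (λ r X → flag≡ 0 r (S₁ [ 2 ↦ X ]) refl) initial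
  in k , σ , r , ≤-trans k≤ time , eq
  where
  O = contents ora
  V = capacity κ n
  open QueryRun {V} {words (bits κ) n} (17≤capacity κ n) (capacity-room κ n) (contents args) O O≤
    (subst (λ l → 2 ^ l ≤ V) (sym log-at) (power≤capacity κ n)) {2 * suc (⌊log₂ n ⌋ + 2)} (search≤capacity κ n)
    (≤-reflexive (cong (λ l → 2 * suc (l + 2)) log-at)) target flag v f (≤-trans v≤n (n≤capacity κ n)) f≤1
  initial : Machine.Represents {V} {words (bits κ) n} (17≤capacity κ n) (capacity-room κ n) (contents args) (queryInput ora args) S₀
  initial = record { low = λ _ _ → refl ; cells = cell ; vars≤ = λ x → ≤-trans (args≤ x) (n≤capacity κ n) }
    where
    cell : ∀ a j → arrays (queryInput ora args) a j ≡ S₀ a j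
    cell zero    j = refl
    cell (suc a) j = refl
  time : charge (query target flag) * (2 * suc (⌊log₂ n ⌋ + 2)) ≤ charge (query target flag) * 6 * polylog 1 n
  time = ≤-trans (*-monoʳ-≤ (charge (query target flag)) (search≤ ⌊log₂ n ⌋))
    (≤-reflexive (eq (charge (query target flag)) 6 (suc ⌊log₂ n ⌋)))
    where
    eq : ∀ c a l → c * (a * l) ≡ c * a * (l * 1)
    eq = solve-∀

halting : ∀ {W V P σ time size} {stream : ℕ → ℕ → ℕ} {Q : List ℕ → Set} →
  ∃[ k ] ∃[ σ′ ] Run W P σ k σ′ × k ≤ time × vars σ′ 0 ≡ size * 16 ×
    (∀ {i k} → i < size → k < 16 → arrays σ′ 3 (i * 16 + k) ≡ stream k i) × (∀ j → arrays σ′ 3 j ≤ V) →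
  (∀ {ora} → length ora ≡ size * 16 → (∀ {i k} → i < size → k < 16 → contents ora (i * 16 + k) ≡ stream k i) →
    (∀ i → contents ora i ≤ V) → Q ora) →
  Builds W P σ time Q
halting {size = size} (k , σ′ , r , k≤ , eq , cell , cell≤) q = k , σ′ , r , k≤ ,
  q (trans (length-applyUpTo (arrays σ′ 3) (vars σ′ 0)) eq)
    (λ {i} {k} i< k< → trans (contents-applyUpTo (arrays σ′ 3) (vars σ′ 0)
      (subst (i * 16 + k <_) (trans (+-identityʳ (size * 16)) (sym eq)) (rowMajor-< i< k< 0))) (cell i< k<))
    (contents≤ (arrays σ′ 3) (vars σ′ 0) cell≤)

module Construction {n} (M : ℕ) (G : Graph n) (full : ∀ z → z ∈ vertices G) (s : Fin n) (T : Parents n)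
  (tree : IsShortestPathTree G s T) {H : Fin n → Graph n} (failures : Failures G T H)
  (C : Fin n → Fin n → ℕ) (Valid : Fin n → Set)
  (coded : ∀ {v} → Valid v → ∀ t → IsCode (H v) s t (C t v))
  (tree-valid : ∀ {v k d} → Up T s v k d → Valid v)
  (C≤ : ∀ t v → C t v ≤ suc (n * M))
  {κ : ℕ} (1≤M : 1 ≤ M) (M≤ : M ≤ κ * n ^ κ) (range : WeightsInRange M G) where

  private
    input : State
    input = buildInput M s T C

    par w cells : ℕ → ℕ
    par   = arrays input 0
    w     = arrays input 1
    cells = arrays input 2

    par≤ : ∀ v → par v ≤ n
    par≤ = tabulated≤ _ λ v → parent≤ (T v)
      where
      parent≤ : ∀ (m : Maybe (Fin n × ℕ)) → maybe′ (λ (p , _) → suc (toℕ p)) 0 m ≤ n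
      parent≤ nothing        = z≤n
      parent≤ (just (p , _)) = Fin.toℕ<n p

    w≤ : ∀ v → w v ≤ M
    w≤ = tabulated≤ _ λ v → weight≤ v (T v) refl
      where
      weight≤ : ∀ v m → T v ≡ m → maybe′ proj₂ 0 m ≤ M
      weight≤ v nothing        eq = z≤n
      weight≤ v (just (p , _)) eq = proj₂ (range (IsShortestPathTree.subgraph tree eq))

    cells≤ : ∀ i → cells i ≤ suc (n * M)
    cells≤ = tabulated≤ _ λ i → C≤ (proj₁ (F.remQuot {n} n i)) (proj₂ (F.remQuot {n} n i))

    instance
      M≢0 : NonZero M
      M≢0 = >-nonZero 1≤M

  open Correctness G full s T tree failures C range par w cells par≤ w≤ cells≤
    (tabulated-at _) (tabulated-at _) (table-at C) Valid coded tree-valid public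
  open Tables n (toℕ s) par w cells public
  open Bounds 1≤n par≤ w≤ cells≤ public
  open TableFacts n (toℕ s) par w cells 1≤n par≤ w≤ cells≤ public
  open Serving n (toℕ s) par w cells 1≤n par≤ w≤ cells≤ public

  W V N : ℕ
  W = words (bits κ) n
  V = capacity κ n
  -- The largest fill is the output with at most `5 * (n * n)` rows of 16 words. Counting an extra
  -- row and an extra column gives the factor 6 * 17 = 102.
  N = 102 * (n * n)

  record Good (ora : List ℕ) : Set where
    field
      serving : Serves (contents ora)
      fitting : ∀ i → contents ora i ≤ V

  square≤N : suc (n + 1) * suc (n + 1) ≤ N
  square≤N = ≤-trans (*-mono-≤ n+2≤3n n+2≤3n) (≤-trans (≤-reflexive (eq n)) (*-monoˡ-≤ (n * n) (≤ᵇ⇒≤ 9 102 tt)))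
    where
    n+2≤3n : suc (n + 1) ≤ n + (n + n)
    n+2≤3n = ≤-trans (≤-reflexive (sym (+-suc n 1))) (+-monoʳ-≤ n (+-mono-≤ 1≤n 1≤n))
    eq : ∀ n → (n + (n + n)) * (n + (n + n)) ≡ 9 * (n * n)
    eq = solve-∀

  size≤N : suc size * 17 ≤ N
  size≤N = ≤-trans (*-monoˡ-≤ 17 (+-mono-≤ (*-mono-≤ 1≤n 1≤n) size≤)) (≤-reflexive (eq (n * n)))
    where
    eq : ∀ x → (x + 5 * x) * 17 ≡ 102 * x
    eq = solve-∀

  N≤V : N ≤ V
  N≤V = square≤capacity κ n

  table≤V : suc (n * M) ≤ V
  table≤V = table≤capacity κ n 1≤n 1≤M M≤

  open Build {V} {W} (17≤capacity κ n) (capacity-room κ n) {N} N≤V n M (toℕ s) par w cells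
    1≤n par≤ w≤ cells≤ table≤V square≤N size≤N using (S₀; ρ; stream; build-run)

  initial : Machine.Represents {V} {W} (17≤capacity κ n) (capacity-room κ n) ρ input S₀
  initial = record { low = λ _ _ → refl ; cells = cell ; vars≤ = small }
    where
    cell : ∀ a j → arrays input a j ≡ S₀ a j
    cell 0 j = refl
    cell 1 j = refl
    cell 2 j = refl
    cell (suc (suc (suc _))) j = refl
    small : ∀ x → vars input x ≤ V
    small 0 = n≤capacity κ n
    small 1 = ≤-trans (m≤n*m M n {{>-nonZero 1≤n}}) (≤-trans (n≤1+n _) table≤V)
    small 2 = ≤-trans (<⇒≤ (Fin.toℕ<n s)) (n≤capacity κ n)
    small (suc (suc (suc _))) = z≤n

  -- The three constants are the words per record, the multiples of `L` from `linear-size` and the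
  -- factor in the bound on the number of changes.
  length≤ : (size * 16) ^ 2 ≤ size-factor 16 7 16 * (M * n ^ 3)
  length≤ = scaled-size 16 7 16 {size} {n} {M} {L} {km n} (linear-size {n} {L} {km n} {pivots} 1≤L (sqrt-next n) pivots-few)
    (≤-trans (sqrt-square n) (m≤n*m n M)) km-few

  good : ∀ {ora} → (∀ {i k} → i < size → k < 16 → contents ora (i * 16 + k) ≡ stream k i) →
         (∀ i → contents ora i ≤ V) → Good ora
  good cell cell≤ = record
    { serving = Build-serves.serves {V} {W} (17≤capacity κ n) (capacity-room κ n) {N} N≤V table≤V square≤N size≤N cell
    ; fitting = cell≤ }

  built : Builds W build input (charge build * N) λ ora →
          length ora ^ 2 ≤ size-factor 16 7 16 * (M * n ^ 3) × Good ora
  built = halting {W} {V} {build} {input} {charge build * N} {size} {stream}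
    {λ ora → length ora ^ 2 ≤ size-factor 16 7 16 * (M * n ^ 3) × Good ora} (build-run initial) λ length≡ cell cell≤ →
    subst (λ l → l ^ 2 ≤ size-factor 16 7 16 * (M * n ^ 3)) (sym length≡) length≤ , good cell cell≤

  answered : ∀ {O} → Serves O → ∀ t {v} → Valid v → IsCode (H v) s t (Lookup.answer O (toℕ t) (toℕ v))
  answered {O} serving t {v} valid = choice (≤-<-connex (dep (toℕ t) ∸ dep (toℕ v)) (hop (toℕ t)))
    where
    open Answers serving (Fin.toℕ<n t) (Fin.toℕ<n v)
    choice : dep (toℕ t) ∸ dep (toℕ v) ≤ hop (toℕ t) ⊎ hop (toℕ t) < dep (toℕ t) ∸ dep (toℕ v) →
             IsCode (H v) s t (Lookup.answer O (toℕ t) (toℕ v))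
    choice (inj₁ j≤h) = subst (IsCode (H v) s t) (sym (answer-near j≤h)) (near t valid j≤h)
    choice (inj₂ h<j) = let (x<n , pivot) = far-pivot t {v} h<j in
      subst (IsCode (H v) s t) (sym (answer-far h<j x<n pivot)) (far t valid h<j)

  -- The query sees only words of the oracle; from the stored parent of `v` it learns whether `u`
  -- lies above `v` on a tree edge.
  parent-code : ∀ {O} → Serves O → ∀ u v →
    (∃[ ω ] T v ≡ just (u , ω) × O (toℕ v * 16 + 10) ≡ toℕ u + 1) ⊎
    ((∀ {ω} → T v ≢ just (u , ω)) × O (toℕ v * 16 + 10) ≢ toℕ u + 1)
  parent-code serving u v = decode (T v) refl (trans (Serves.par-at serving (Fin.toℕ<n v)) (tabulated-at _ v))
    where
    decode : ∀ m → T v ≡ m → ∀ {c} → c ≡ maybe′ (λ (p , _) → suc (toℕ p)) 0 (T v) →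
             (∃[ ω ] T v ≡ just (u , ω) × c ≡ toℕ u + 1) ⊎ ((∀ {ω} → T v ≢ just (u , ω)) × c ≢ toℕ u + 1)
    decode nothing eq c≡ = inj₂ ((λ eq′ → case trans (sym eq) eq′ of λ ()) ,
      λ c≡u → contradiction (trans (sym (trans c≡ (cong (maybe′ (λ (p , _) → suc (toℕ p)) 0) eq))) (trans c≡u (+-comm (toℕ u) 1))) λ ())
    decode (just (p , ω)) eq c≡ with p Fin.≟ u
    ... | yes refl = inj₁ (ω , eq , trans c≡ (trans (cong (maybe′ (λ (p , _) → suc (toℕ p)) 0) eq) (+-comm 1 (toℕ u))))
    ... | no p≢u = inj₂ ((λ eq′ → p≢u (cong proj₁ (just-injective (trans (sym eq) eq′)))) ,
      λ c≡u → p≢u (Fin.toℕ-injective (suc-injective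
        (trans (sym (trans c≡ (cong (maybe′ (λ (p , _) → suc (toℕ p)) 0) eq))) (trans c≡u (+-comm (toℕ u) 1))))))

  returns : ∀ {A t c σ₀ q time} → IsCode A s t c →
    ∃[ k ] ∃[ σ ] Run W q σ₀ k σ × k ≤ time × vars σ 0 ≡ c → Returns W q σ₀ time (IsDist A s t)
  returns γ (k , σ , r , k≤ , eq) = let (d , dist , eq′) = IsCode⇒IsDist γ in k , σ , r , k≤ , d , dist , trans eq eq′

Builds-map : ∀ {W P σ time time′} {Q Q′ : List ℕ → Set} → time ≤ time′ → (∀ {ora} → Q ora → Q′ ora) →
             Builds W P σ time Q → Builds W P σ time′ Q′
Builds-map time≤ f (k , σ′ , r , k≤ , q) = k , σ′ , r , ≤-trans k≤ time≤ , f q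

Returns-map : ∀ {W P σ time time′ Q} → time ≤ time′ → Returns W P σ time Q → Returns W P σ time′ Q
Returns-map time≤ (k , σ′ , r , k≤ , q) = k , σ′ , r , ≤-trans k≤ time≤ , q

-- Abstract, lest closed running times be evaluated.
abstract
  total : ℕ → ℕ → ℕ → ℕ
  total a b c = a + (b + c)

  total₁ : ∀ a b c → a ≤ total a b c
  total₁ a b c = m≤m+n a (b + c)

  total₂ : ∀ a b c → b ≤ total a b c
  total₂ a b c = ≤-trans (m≤m+n b c) (m≤n+m (b + c) a)

  total₃ : ∀ a b c → c ≤ total a b c
  total₃ a b c = ≤-trans (m≤n+m c b) (m≤n+m (b + c) a)

factor : Program → ℕ
factor P = total (charge build * 102) (charge P * 6) (size-factor 16 7 16)

square-time : ∀ x a n → x * (a * (n * n)) ≡ x * a * (n * (n * 1))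
square-time = solve-∀

scaled-time : ∀ x a n {c} → x * a ≤ c → x * (a * (n * n)) ≤ c * n ^ 2
scaled-time x a n {c} ≤c = ≤-trans (≤-reflexive (square-time x a n)) (*-monoˡ-≤ (n * (n * 1)) ≤c)

contents-all : ∀ {n xs} → All (_≤ n) xs → ∀ i → contents xs i ≤ n
contents-all []         i       = z≤n
contents-all (x≤ ∷ xs≤) zero    = x≤
contents-all (x≤ ∷ xs≤) (suc i) = contents-all xs≤ i

vertex-query : Program
vertex-query = query (var 1) (lit 1)

vertex-oracle : ∀ κ n M (G : Graph n) (s : Fin n) (T : Parents n) (D : Fin n → Fin n → Maybe ℕ) →
  vertices G ≡ ⊤ → 1 ≤ M → M ≤ κ * n ^ κ → WeightsInRange M G → IsShortestPathTree G s T →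
  (∀ t v → IsDist (G −vertex v) s t (D t v)) →
  Builds (words (bits κ) n) build (buildInput M s T (vertexTable D)) (factor vertex-query * n ^ 2) λ ora →
    length ora ^ 2 ≤ factor vertex-query * (M * n ^ 3) ×
    AnswersVertices (words (bits κ) n) vertex-query (factor vertex-query * polylog 1 n) G s ora
vertex-oracle κ n M G s T D all 1≤M M≤ range tree dist =
  Builds-map {Q = λ ora → length ora ^ 2 ≤ size-factor 16 7 16 * (M * n ^ 3) × Good ora}
    {λ ora → length ora ^ 2 ≤ factor vertex-query * (M * n ^ 3) ×
              AnswersVertices (words (bits κ) n) vertex-query (factor vertex-query * polylog 1 n) G s ora}
    (scaled-time (charge build) 102 n (total₁ (charge build * 102) (charge vertex-query * 6) (size-factor 16 7 16)))
    (λ (length≤ , good) → ≤-trans length≤ (*-monoˡ-≤ (M * n ^ 3) (total₃ (charge build * 102) (charge vertex-query * 6) (size-factor 16 7 16))) , answers good) built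
  where
  full : ∀ z → z ∈ vertices G
  full z = subst (z ∈_) (sym all) ∈⊤
  coded-vertices : ∀ {v} → Unit.⊤ → ∀ t → IsCode (G −vertex v) s t (vertexTable D t v)
  coded-vertices {v} _ t = IsDist⇒IsCode (dist t v)
  vertex≤ : ∀ t v → vertexTable D t v ≤ suc (n * M)
  vertex≤ t v = code≤ (λ {a} {b} eq → range (proj₂ (unless-just (touches? v a b) eq))) (dist t v)
  open Construction M G full s T tree (vertex-failures full tree) (vertexTable D) (λ _ → Unit.⊤)
    coded-vertices (λ _ → tt) vertex≤ {κ} 1≤M M≤ range
  answers : ∀ {ora} → Good ora → AnswersVertices (words (bits κ) n) vertex-query (factor vertex-query * polylog 1 n) G s ora
  answers {ora} good t v = Returns-map (*-monoˡ-≤ (polylog 1 n) (total₂ (charge build * 102) (charge vertex-query * 6) (size-factor 16 7 16)))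
    (returns code (query-result κ n ora (toℕ t ∷ toℕ v ∷ []) (var 1) (lit 1) (toℕ v) 1
      (Good.fitting good) (Serves.log-at (Good.serving good)) (<⇒≤ (Fin.toℕ<n v)) ≤-refl
      (contents-all (<⇒≤ (Fin.toℕ<n t) ∷ <⇒≤ (Fin.toℕ<n v) ∷ [])) tt tt (λ _ _ _ _ → refl) (λ _ _ _ _ → refl)))
    where
    code : IsCode (G −vertex v) s t (sel 1 (Lookup.answer (contents ora) (toℕ t) (toℕ v)) (contents ora (toℕ t * 16 + 5)))
    code = subst (IsCode (G −vertex v) s t) (sym (sel-1 (Lookup.answer (contents ora) (toℕ t) (toℕ v)) (contents ora (toℕ t * 16 + 5)) refl))
      (answered (Good.serving good) t tt)

-- The queried edge is named by that endpoint whose parent the other one is.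
edge-target edge-flag : Expr
edge-target = ite (stream-cell 10 (var 2) ≈ᵉ var 1 ⊕ lit 1) (var 2) (var 1)
edge-flag   = posᵉ ((stream-cell 10 (var 2) ≈ᵉ var 1 ⊕ lit 1) ⊕ (stream-cell 10 (var 1) ≈ᵉ var 2 ⊕ lit 1))

edge-query : Program
edge-query = query edge-target edge-flag

edge-oracle : ∀ κ n M (G : Graph n) (s : Fin n) (T : Parents n) (D : Fin n → Fin n → Maybe ℕ) →
  vertices G ≡ ⊤ → 1 ≤ M → M ≤ κ * n ^ κ → WeightsInRange M G → IsShortestPathTree G s T →
  (∀ t {v p w} → T v ≡ just (p , w) → IsDist (G −edge (p , v)) s t (D t v)) →
  Builds (words (bits κ) n) build (buildInput M s T (edgeTable T D)) (factor edge-query * n ^ 2) λ ora →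
    length ora ^ 2 ≤ factor edge-query * (M * n ^ 3) ×
    AnswersEdges (words (bits κ) n) edge-query (factor edge-query * polylog 1 n) G s ora
edge-oracle κ n M G s T D all 1≤M M≤ range tree dist =
  Builds-map {Q = λ ora → length ora ^ 2 ≤ size-factor 16 7 16 * (M * n ^ 3) × Good ora}
    {λ ora → length ora ^ 2 ≤ factor edge-query * (M * n ^ 3) ×
              AnswersEdges (words (bits κ) n) edge-query (factor edge-query * polylog 1 n) G s ora}
    (scaled-time (charge build) 102 n (total₁ (charge build * 102) (charge edge-query * 6) (size-factor 16 7 16)))
    (λ (length≤ , good) → ≤-trans length≤ (*-monoˡ-≤ (M * n ^ 3) (total₃ (charge build * 102) (charge edge-query * 6) (size-factor 16 7 16))) , answers good) built
  where
  full : ∀ z → z ∈ vertices G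
  full z = subst (z ∈_) (sym all) ∈⊤
  edge≤ : ∀ t v m → T v ≡ m → maybe′ (λ _ → codeDist (D t v)) 0 m ≤ suc (n * M)
  edge≤ t v nothing        eq = z≤n
  edge≤ t v (just (p , _)) eq = code≤ (λ {a} {b} eq′ → range (proj₂ (unless-just (sameEdge? (p , v) a b) eq′))) (dist t eq)
  open Construction M G full s T tree (edge-failures full tree) (edgeTable T D) (Named full tree)
    (edge-coded full tree dist) (tree-named full tree) (λ t v → edge≤ t v (T v) refl) {κ} 1≤M M≤ range

  answers : ∀ {ora} → Good ora → AnswersEdges (words (bits κ) n) edge-query (factor edge-query * polylog 1 n) G s ora
  answers {ora} good t u v _ = Returns-map (*-monoˡ-≤ (polylog 1 n) (total₂ (charge build * 102) (charge edge-query * 6) (size-factor 16 7 16)))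
    (returns (code (parent-code serving u v) (parent-code serving v u))
      (query-result κ n ora (toℕ t ∷ toℕ u ∷ toℕ v ∷ []) edge-target edge-flag target flag
        (Good.fitting good) (Serves.log-at serving)
        (sel≤ (apply equal (O (toℕ v * 16 + 10)) (toℕ u + 1)) (equal≤1 (O (toℕ v * 16 + 10)) (toℕ u + 1)) (<⇒≤ (Fin.toℕ<n v)) (<⇒≤ (Fin.toℕ<n u)))
        (less≤1 0 (apply equal (O (toℕ v * 16 + 10)) (toℕ u + 1) + apply equal (O (toℕ u * 16 + 10)) (toℕ v + 1)))
        (contents-all (<⇒≤ (Fin.toℕ<n t) ∷ <⇒≤ (Fin.toℕ<n u) ∷ <⇒≤ (Fin.toℕ<n v) ∷ [])) tt tt
        (λ _ _ _ eq → cong (λ O → sel (apply equal (O (toℕ v * 16 + 10)) (toℕ u + 1)) (toℕ v) (toℕ u)) eq)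
        (λ _ _ _ eq → cong (λ O → pos (apply equal (O (toℕ v * 16 + 10)) (toℕ u + 1) + apply equal (O (toℕ u * 16 + 10)) (toℕ v + 1))) eq)))
    where
    O = contents ora
    serving = Good.serving good
    target flag : ℕ
    target = sel (apply equal (O (toℕ v * 16 + 10)) (toℕ u + 1)) (toℕ v) (toℕ u)
    flag   = pos (apply equal (O (toℕ v * 16 + 10)) (toℕ u + 1) + apply equal (O (toℕ u * 16 + 10)) (toℕ v + 1))
    Parent : Fin n → Fin n → Set
    Parent u v = (∃[ ω ] T v ≡ just (u , ω) × O (toℕ v * 16 + 10) ≡ toℕ u + 1) ⊎
                 ((∀ {ω} → T v ≢ just (u , ω)) × O (toℕ v * 16 + 10) ≢ toℕ u + 1)
    result : ℕ → ℕ → ℕ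
    result f x = sel f (Lookup.answer O (toℕ t) x) (O (toℕ t * 16 + 5))
    named : ∀ {p x ω f y} → T x ≡ just (p , ω) → f ≡ 1 → y ≡ toℕ x → IsCode (G −edge (p , x)) s t (result f y)
    named {p} {x} eq refl refl = subst (IsCode (G −edge (p , x)) s t) (sym (sel-1 (Lookup.answer O (toℕ t) (toℕ x)) (O (toℕ t * 16 + 5)) refl))
      (subst (λ m → IsCode (failure-named full tree x m) s t (Lookup.answer O (toℕ t) (toℕ x))) eq
        (answered serving t (inj₁ (_ , eq))))
    outside-tree : (∀ {ω} → T u ≢ just (v , ω)) → (∀ {ω} → T v ≢ just (u , ω)) → Reach t → IsCode (G −edge (u , v)) s t (dst (toℕ t))
    outside-tree _ _ (outside eq _ none) = subst (IsCode (G −edge (u , v)) s t) (sym eq) record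
      { lower = λ p → contradiction (walk-map (λ z∈ → z∈) (λ {a} {b} e → proj₂ (unless-just (sameEdge? (u , v) a b) e)) p) none
      ; attained = λ () }
    outside-tree u↛v v↛u (inside S) = subst (IsCode (G −edge (u , v)) s t) (sym (dst-tree S)) record
      { lower    = λ p → s≤s z≤n , s≤s (Tree.tree-shortest G full s T tree S
                     (walk-map (λ z∈ → z∈) (λ {a} {b} e → proj₂ (unless-just (sameEdge? (u , v) a b) e)) p))
      ; attained = λ { refl → spared full tree u↛v v↛u S } }
    code : Parent u v → Parent v u → IsCode (G −edge (u , v)) s t (result flag target)
    code (inj₁ (_ , eq , O≡)) _ = named eq
      (pos-1 (subst (λ b → 1 ≤ b + apply equal (O (toℕ u * 16 + 10)) (toℕ v + 1)) (sym (equal-true O≡)) (s≤s z≤n)))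
      (sel-1 (toℕ v) (toℕ u) (equal-true O≡))
    -- Here `u` is the lower endpoint, and the table knows the edge with its endpoints in the other
    -- order.
    code (inj₂ (_ , O≢)) (inj₁ (_ , eq , O≡)) = code-swap {G = G} (named eq
      (cong pos (cong₂ _+_ (equal-false O≢) (equal-true O≡))) (sel-0 (toℕ v) (toℕ u) (equal-false O≢)))
    -- An edge outside the tree has no name, but all tree paths survive its failure; with flag 0 the
    -- stored tree distance is returned.
    code (inj₂ (v↛u , O≢)) (inj₂ (u↛v , O≢′)) = subst (IsCode (G −edge (u , v)) s t)
      (sym (trans (sel-0 (Lookup.answer O (toℕ t) target) (O (toℕ t * 16 + 5)) (cong pos (cong₂ _+_ (equal-false O≢) (equal-false O≢′))))
                  (Serves.dst-at serving (Fin.toℕ<n t))))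
      (outside-tree u↛v v↛u (reach t))

theorem2 : (∃[ build ] ∃[ query ] ∀ (κ : ℕ) → ∃[ b ] ∃[ c ] ∃[ e ]
    ∀ (n M : ℕ) (G : Graph n) (s : Fin n) (T : Parents n)
    (D : Fin n → Fin n → Maybe ℕ) →
    vertices G ≡ ⊤ →
    1 ≤ M → M ≤ κ * n ^ κ → WeightsInRange M G →
    IsShortestPathTree G s T →
    (∀ t {v p w} → T v ≡ just (p , w) → IsDist (G −edge (p , v)) s t (D t v)) →
    Builds (words b n) build (buildInput M s T (edgeTable T D)) (c * n ^ 2) λ ora →
    length ora ^ 2 ≤ c * (M * n ^ 3) ×
    AnswersEdges (words b n) query (c * polylog e n) G s ora)
    ×
    (∃[ build ] ∃[ query ] ∀ (κ : ℕ) → ∃[ b ] ∃[ c ] ∃[ e ]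
    ∀ (n M : ℕ) (G : Graph n) (s : Fin n) (T : Parents n)
    (D : Fin n → Fin n → Maybe ℕ) →
    vertices G ≡ ⊤ →
    1 ≤ M → M ≤ κ * n ^ κ → WeightsInRange M G →
    IsShortestPathTree G s T →
    (∀ t v → IsDist (G −vertex v) s t (D t v)) →
    Builds (words b n) build (buildInput M s T (vertexTable D)) (c * n ^ 2) λ ora →
    length ora ^ 2 ≤ c * (M * n ^ 3) ×
    AnswersVertices (words b n) query (c * polylog e n) G s ora)
theorem2 =
  -- The exponent is 1 because the loops of a query, for the powers of two and the binary search,
  -- have logarithmic length.
  (build , edge-query , λ κ → bits κ , factor edge-query , 1 , edge-oracle κ) ,
  (build , vertex-query , λ κ → bits κ , factor vertex-query , 1 , vertex-oracle κ)
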